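{- Let $C\colon y^2=f(x)$ be a hyperelliptic curve over $K$ with $f(x)\in\mathcal O_K[x]$. If $d_{\mathcal R}=0$, $v(c_f)=0$ and there is no cluster $\mathfrak s\neq\mathcal R$ with $|\mathfrak s|>g+1$, then $y^2=f(x)$ is a minimal Weierstrass equation for $C$.
   Context: $K$ is a non-archimedean local field with ring of integers $\mathcal O_K$, finite residue field of characteristic $p\ne2$, valuation $v$ on $\bar K$ normalised on $K$. $f$ is separable of degree $2g+1$ or $2g+2$, $g\ge2$ the genus, with leading coefficient $c_f$ and roots $\mathcal R$. Clusters: non-empty $D\cap\mathcal R$ for discs $D=\{x\in\bar K:v(x-z)\ge d\}$; $d_{\mathcal R}=\min_{r,r'\in\mathcal R}v(r-r')$. The discriminant of $y^2=h(x)$ is $16^gc_h^{4g+2}\mathrm{disc}(h/c_h)$; an integral Weierstrass equation for $C$ is a $K$-isomorphic model $y^2=h(x)$, $h\in\mathcal O_K[x]$, and it is minimal if its discriminant has minimal valuation among all integral Weierstrass equations for $C$. -}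

module Defs where

open import Level using (Level; _⊔_; suc)
open import Algebra.Bundles using (CommutativeRing; RawRing; Semiring)
open import Algebra.Morphism.Structures using (module RingMorphisms)
import Algebra.Definitions.RawSemiring as RawSemiringDefs
import Algebra.Properties.Ring as RingProperties
open import Data.List.Base using (List; []; _∷_; length; map; foldr)
import Data.List.Membership.Setoid as Membership
import Data.List.Relation.Unary.Unique.Setoid as UniqueSetoid
open import Data.Nat.Base as ℕ using (ℕ; zero; z≤n; s≤s)
import Data.Nat.Properties as ℕ
open import Data.Nat.Primality using (Prime)
open import Data.Product.Base using (Σ-syntax; ∃; ∃-syntax; ∃₂; _×_; _,_; proj₁)
open import Data.Rational.Base as ℚ using (ℚ; 0ℚ; 1ℚ)
open import Data.Sum.Base using (_⊎_)
open import Function.Base using (_∘_)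
open import Function.Bundles using (_⇔_)
import Relation.Binary.Construct.Add.Supremum.NonStrict as NonStrict
import Relation.Binary.Construct.Add.Supremum.Strict as Strict
open import Relation.Binary.PropositionalEquality.Core as ≡ using (_≡_)
open import Relation.Nullary using (¬_; yes; no)
open import Relation.Nullary.Decidable.Core using (¬¬-excluded-middle)
open import Relation.Nullary.Construct.Add.Supremum using (_⁺; [_]; ⊤⁺) public
open import Relation.Unary using (Pred; _∈_; _∩_; _≐_; Satisfiable)

------------------------------------------------------------------------
-- ℚ ∪ {∞}

open NonStrict ℚ._≤_ public using (_≤⁺_)
open Strict    ℚ._<_ public using (_<⁺_)

ℚ∞ : Set
ℚ∞ = ℚ ⁺

0∞ : ℚ∞
0∞ = [ 0ℚ ]

infixl 6 _+∞_
_+∞_ : ℚ∞ → ℚ∞ → ℚ∞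
[ x ] +∞ [ y ] = [ x ℚ.+ y ]
[ _ ] +∞ ⊤⁺    = ⊤⁺
⊤⁺    +∞ _     = ⊤⁺

infixl 7 _⊓∞_
_⊓∞_ : ℚ∞ → ℚ∞ → ℚ∞
[ x ] ⊓∞ [ y ] = [ x ℚ.⊓ y ]
[ x ] ⊓∞ ⊤⁺    = [ x ]
⊤⁺    ⊓∞ y     = y

------------------------------------------------------------------------
-- Fields and valuations

-- Inverses are required for all x ≉ 0#, as in the classical notion; a
-- HeytingField would only supply them for x # 0#.
record Field (c ℓ : Level) : Set (suc (c ⊔ ℓ)) where
  field
    commutativeRing : CommutativeRing c ℓ
  open CommutativeRing commutativeRing public
  field
    0≉1     : ¬ (0# ≈ 1#)
    inverse : ∀ x → ¬ (x ≈ 0#) → ∃[ y ] x * y ≈ 1#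

record IsValuation {c ℓ} (F : Field c ℓ) (v : Field.Carrier F → ℚ∞) : Set (c ⊔ ℓ) where
  open Field F
  field
    v-cong : ∀ {x y} → x ≈ y → v x ≡ v y
    v-∞    : ∀ x → v x ≡ ⊤⁺ ⇔ x ≈ 0#
    v-*    : ∀ x y → v (x * y) ≡ v x +∞ v y
    v-+    : ∀ x y → v x ⊓∞ v y ≤⁺ v (x + y)

------------------------------------------------------------------------
-- Polynomials: a₀ ∷ a₁ ∷ … is a₀ + a₁X + …, trailing zeros being allowed

module Polynomials {c ℓ} (F : Field c ℓ) where
  open Field F hiding (zero)
  open RingProperties ring using (-‿distribˡ-*; -0#≈0#)

  Poly : Set c
  Poly = List Carrier

  coeff : Poly → ℕ → Carrier
  coeff []      _         = 0#
  coeff (a ∷ _) zero      = a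
  coeff (_ ∷ p) (ℕ.suc n) = coeff p n

  infix 4 _≈ₚ_
  _≈ₚ_ : Poly → Poly → Set ℓ
  p ≈ₚ q = ∀ n → coeff p n ≈ coeff q n

  HasDegree : Poly → ℕ → Set ℓ
  HasDegree p n = ¬ (coeff p n ≈ 0#) × (∀ m → n ℕ.< m → coeff p m ≈ 0#)

  eval : Poly → Carrier → Carrier
  eval []      x = 0#
  eval (a ∷ p) x = a + x * eval p x

  0ₚ 1ₚ : Poly
  0ₚ = []
  1ₚ = 1# ∷ []

  infix 8 X-_
  X-_ : Carrier → Poly
  X- r = - r ∷ 1# ∷ []

  infixl 6 _+ₚ_
  _+ₚ_ : Poly → Poly → Poly
  []      +ₚ q       = q
  (a ∷ p) +ₚ []      = a ∷ p
  (a ∷ p) +ₚ (b ∷ q) = a + b ∷ p +ₚ q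

  -ₚ_ : Poly → Poly
  -ₚ_ = map (-_)

  infixl 7 _*ₚ_
  _*ₚ_ : Poly → Poly → Poly
  []      *ₚ q = []
  (a ∷ p) *ₚ q = map (a *_) q +ₚ (0# ∷ p *ₚ q)

  linearProduct : Carrier → List Carrier → Poly
  linearProduct a []       = a ∷ []
  linearProduct a (r ∷ rs) = X- r *ₚ linearProduct a rs

  -- ∏_{i<j} (rᵢ - rⱼ)²
  rootDiscriminant : List Carrier → Carrier
  rootDiscriminant []       = 1#
  rootDiscriminant (r ∷ rs) =
    foldr (λ s acc → (r - s) * (r - s) * acc) 1# rs * rootDiscriminant rs

  coeff-+ₚ : ∀ p q n → coeff (p +ₚ q) n ≈ coeff p n + coeff q n
  coeff-+ₚ []      q       n         = sym (+-identityˡ _)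
  coeff-+ₚ (a ∷ p) []      n         = sym (+-identityʳ _)
  coeff-+ₚ (a ∷ p) (b ∷ q) zero      = refl
  coeff-+ₚ (a ∷ p) (b ∷ q) (ℕ.suc n) = coeff-+ₚ p q n

  coeff-scale : ∀ a p n → coeff (map (a *_) p) n ≈ a * coeff p n
  coeff-scale a []      n         = sym (zeroʳ a)
  coeff-scale a (_ ∷ p) zero      = refl
  coeff-scale a (_ ∷ p) (ℕ.suc n) = coeff-scale a p n

  coeff-*ₚ : ∀ a p q n → coeff ((a ∷ p) *ₚ q) n ≈ a * coeff q n + coeff (0# ∷ p *ₚ q) n
  coeff-*ₚ a p q n =
    trans (coeff-+ₚ (map (a *_) q) (0# ∷ p *ₚ q) n) (+-congʳ (coeff-scale a q n))

  -- K[X] is an integral domain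

  *ₚ-shift-zero : ∀ p b q → b ≈ 0# → coeff (p *ₚ (b ∷ q)) 0 ≈ 0#
  *ₚ-shift-zero []      b q b≈0 = refl
  *ₚ-shift-zero (a ∷ p) b q b≈0 =
    trans (+-identityʳ _) (trans (*-congˡ b≈0) (zeroʳ a))

  *ₚ-shift-suc : ∀ p b q → b ≈ 0# → ∀ n → coeff (p *ₚ (b ∷ q)) (ℕ.suc n) ≈ coeff (p *ₚ q) n
  *ₚ-shift-suc []      b q b≈0 n = refl
  *ₚ-shift-suc (a ∷ p) b q b≈0 n =
    trans (coeff-*ₚ a p (b ∷ q) (ℕ.suc n))
      (trans (+-congˡ (shift n)) (sym (coeff-*ₚ a p q n)))
    where
    shift : ∀ n → coeff (p *ₚ (b ∷ q)) n ≈ coeff (0# ∷ p *ₚ q) n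
    shift zero      = *ₚ-shift-zero p b q b≈0
    shift (ℕ.suc n) = *ₚ-shift-suc p b q b≈0 n

  *-nonzero : ∀ {x y} → ¬ (x ≈ 0#) → x * y ≈ 0# → y ≈ 0#
  *-nonzero {x} {y} x≉0 xy≈0 with inverse x x≉0
  ... | x⁻¹ , xx⁻¹≈1 =
    trans (sym (*-identityˡ y))
      (trans (*-congʳ (trans (sym xx⁻¹≈1) (*-comm x x⁻¹)))
        (trans (*-assoc x⁻¹ x y) (trans (*-congˡ xy≈0) (zeroʳ x⁻¹))))

  ∷-nonzero : ∀ {a p} → a ≈ 0# → ¬ ((a ∷ p) ≈ₚ 0ₚ) → ¬ (p ≈ₚ 0ₚ)
  ∷-nonzero a≈0 ap≉0 p≈0 = ap≉0 λ { zero → a≈0 ; (ℕ.suc n) → p≈0 n }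

  *ₚ-nonzero : ∀ p q → ¬ (p ≈ₚ 0ₚ) → ¬ (q ≈ₚ 0ₚ) → ¬ ((p *ₚ q) ≈ₚ 0ₚ)
  *ₚ-nonzero []      q p≉0 q≉0 pq≈0 = p≉0 (λ _ → refl)
  *ₚ-nonzero (a ∷ p) q p≉0 q≉0 pq≈0 =
    ¬¬-excluded-middle λ { (yes a≈0) → drop a≈0 ; (no a≉0) → lead a≉0 q q≉0 pq≈0 }
    where
    drop : ¬ (a ≈ 0#)
    drop a≈0 = *ₚ-nonzero p q (∷-nonzero a≈0 p≉0) q≉0 λ n →
      trans (sym (trans (coeff-*ₚ a p q (ℕ.suc n))
        (trans (+-congʳ (trans (*-congʳ a≈0) (zeroˡ _))) (+-identityˡ _))))
        (pq≈0 (ℕ.suc n))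

    lead : ¬ (a ≈ 0#) → ∀ q → ¬ (q ≈ₚ 0ₚ) → ¬ (((a ∷ p) *ₚ q) ≈ₚ 0ₚ)
    lead a≉0 []      q≉0 pq≈0 = q≉0 (λ _ → refl)
    lead a≉0 (b ∷ q) q≉0 pq≈0 = lead a≉0 q (∷-nonzero b≈0 q≉0) λ n →
      trans (sym (*ₚ-shift-suc (a ∷ p) b q b≈0 n)) (pq≈0 (ℕ.suc n))
      where
      b≈0 : b ≈ 0#
      b≈0 = *-nonzero a≉0 (trans (sym (+-identityʳ _)) (pq≈0 0))

  -- Division by X - r

  quotient : Poly → Carrier → Poly
  quotient []      r = []
  quotient (_ ∷ p) r = eval p r ∷ quotient p r

  coeff-X- : ∀ r q n → coeff (X- r *ₚ q) n ≈ - (r * coeff q n) + coeff (0# ∷ q) n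
  coeff-X- r q n =
    trans (coeff-*ₚ (- r) (1# ∷ []) q n)
      (+-cong (sym (-‿distribˡ-* r _)) (tail n))
    where
    tail : ∀ n → coeff (0# ∷ (1# ∷ []) *ₚ q) n ≈ coeff (0# ∷ q) n
    tail zero      = refl
    tail (ℕ.suc n) = trans (coeff-*ₚ 1# [] q n)
      (trans (+-cong (*-identityˡ _) (nil n)) (+-identityʳ _))
      where
      nil : ∀ n → coeff (0# ∷ []) n ≈ 0#
      nil zero      = refl
      nil (ℕ.suc _) = refl

  -x+[a+x]≈a : ∀ a x → - x + (a + x) ≈ a
  -x+[a+x]≈a a x = trans (+-congˡ (+-comm a x))
    (trans (sym (+-assoc _ _ _)) (trans (+-congʳ (-‿inverseˡ x)) (+-identityˡ a)))

  quotient-suc : ∀ p r n →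
    coeff p (ℕ.suc n) ≈ - (r * coeff (quotient p r) (ℕ.suc n)) + coeff (quotient p r) n
  quotient-suc []      r n = sym (trans (+-congʳ (trans (-‿cong (zeroʳ r)) -0#≈0#)) (+-identityˡ 0#))
  quotient-suc (_ ∷ []) r zero = quotient-suc [] r zero
  quotient-suc (_ ∷ a ∷ p) r zero = sym (-x+[a+x]≈a a (r * eval p r))
  quotient-suc (_ ∷ p) r (ℕ.suc n) = quotient-suc p r n

  quotient-zero : ∀ p r → eval p r ≈ 0# → coeff p 0 ≈ - (r * coeff (quotient p r) 0) + 0#
  quotient-zero []      r _ = trans (sym -0#≈0#)
    (trans (-‿cong (sym (zeroʳ r))) (sym (+-identityʳ _)))
  quotient-zero (a ∷ p) r a+rp≈0 =
    trans (sym (-x+[a+x]≈a a (r * eval p r))) (+-congˡ a+rp≈0)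

  factor : ∀ p r → eval p r ≈ 0# → p ≈ₚ (X- r *ₚ quotient p r)
  factor p r root zero      =
    trans (quotient-zero p r root) (sym (coeff-X- r (quotient p r) 0))
  factor p r root (ℕ.suc n) =
    trans (quotient-suc p r n) (sym (coeff-X- r (quotient p r) (ℕ.suc n)))

  eval-zero : ∀ p r → p ≈ₚ 0ₚ → eval p r ≈ 0#
  eval-zero []      r p≈0 = refl
  eval-zero (a ∷ p) r p≈0 =
    trans (+-cong (p≈0 0) (trans (*-congˡ (eval-zero p r (p≈0 ∘ ℕ.suc))) (zeroʳ r)))
      (+-identityˡ 0#)

  quotient-bound : ∀ p r n → (∀ m → n ℕ.< m → coeff p m ≈ 0#) →
    ∀ m → n ℕ.≤ m → coeff (quotient p r) m ≈ 0#
  quotient-bound []      r n         bd m         n≤m       = refl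
  quotient-bound (a ∷ p) r zero      bd zero      n≤m       =
    eval-zero p r λ m → bd (ℕ.suc m) (s≤s z≤n)
  quotient-bound (a ∷ p) r zero      bd (ℕ.suc m) n≤m       =
    quotient-bound p r zero (λ k k>0 → bd (ℕ.suc k) (s≤s z≤n)) m z≤n
  quotient-bound (a ∷ p) r (ℕ.suc n) bd (ℕ.suc m) (s≤s n≤m) =
    quotient-bound p r n (λ k n<k → bd (ℕ.suc k) (s≤s n<k)) m n≤m

  quotient-lead : ∀ p r n → HasDegree p (ℕ.suc n) →
    coeff (quotient p r) n ≈ coeff p (ℕ.suc n)
  quotient-lead p r n (_ , bd) = sym
    (trans (quotient-suc p r n)
      (trans (+-congʳ (trans (-‿cong (trans (*-congˡ
          (quotient-bound p r (ℕ.suc n) bd (ℕ.suc n) ℕ.≤-refl)) (zeroʳ r))) -0#≈0#))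
        (+-identityˡ _)))

  quotient-degree : ∀ p r n → HasDegree p (ℕ.suc n) → HasDegree (quotient p r) n
  quotient-degree p r n deg@(lc≉0 , bd) =
    (λ lc≈0 → lc≉0 (trans (sym (quotient-lead p r n deg)) lc≈0)) ,
    λ m n<m → quotient-bound p r (ℕ.suc n) bd m n<m

  X-*-cong : ∀ r p q → p ≈ₚ q → (X- r *ₚ p) ≈ₚ (X- r *ₚ q)
  X-*-cong r p q p≈q n =
    trans (coeff-X- r p n)
      (trans (+-cong (-‿cong (*-congˡ (p≈q n))) (shift n)) (sym (coeff-X- r q n)))
    where
    shift : ∀ n → coeff (0# ∷ p) n ≈ coeff (0# ∷ q) n
    shift zero      = refl
    shift (ℕ.suc n) = p≈q n

  linearProduct-cong : ∀ {a b} → a ≈ b → ∀ rs → linearProduct a rs ≈ₚ linearProduct b rs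
  linearProduct-cong a≈b []       zero      = a≈b
  linearProduct-cong a≈b []       (ℕ.suc _) = refl
  linearProduct-cong {a} {b} a≈b (r ∷ rs)   =
    X-*-cong r (linearProduct a rs) (linearProduct b rs) (linearProduct-cong a≈b rs)

  AlgebraicallyClosed : Set (c ⊔ ℓ)
  AlgebraicallyClosed = ∀ p n → HasDegree p (ℕ.suc n) → ∃[ r ] eval p r ≈ 0#

  splits : AlgebraicallyClosed → ∀ n p → HasDegree p n →
           Σ[ rs ∈ List Carrier ] length rs ≡ n × p ≈ₚ linearProduct (coeff p n) rs
  splits closed zero      p (_ , bd) =
    [] , ≡.refl , λ { zero → refl ; (ℕ.suc m) → bd (ℕ.suc m) (s≤s z≤n) }
  splits closed (ℕ.suc n) p deg with closed p n deg
  ... | r , root with splits closed n (quotient p r) (quotient-degree p r n deg)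
  ... | rs , len , q≈ = r ∷ rs , ≡.cong ℕ.suc len , λ m →
    trans (factor p r root m)
      (X-*-cong r (quotient p r) (linearProduct (coeff p (ℕ.suc n)) rs) (λ k → trans (q≈ k)
        (linearProduct-cong (quotient-lead p r n deg) rs k)) m)

------------------------------------------------------------------------
-- Non-archimedean local fields

record LocalField (c ℓ : Level) : Set (suc (c ⊔ ℓ)) where
  field
    baseField   : Field c ℓ
  open Field baseField public
  open RawSemiringDefs (Semiring.rawSemiring semiring) public using () renaming (_×_ to _·_)
  field
    v           : Carrier → ℚ∞
    isValuation : IsValuation baseField v

    -- v(K×) = ℤ
    discrete    : ∀ x → ¬ (x ≈ 0#) → ∃[ n ] v x ≡ [ n ℚ./ 1 ]
    uniformiser : ∃[ π ] v π ≡ [ 1ℚ ]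

  𝒪 : Pred Carrier _
  𝒪 x = 0∞ ≤⁺ v x

  -- congruence modulo the maximal ideal
  infix 4 _≡ₘ_
  _≡ₘ_ : Carrier → Carrier → Set
  x ≡ₘ y = 0∞ <⁺ v (x - y)

  Cauchy : (ℕ → Carrier) → Set
  Cauchy s = ∀ (N : ℚ) → ∃[ M ] ∀ m n → M ℕ.≤ m → M ℕ.≤ n → [ N ] ≤⁺ v (s m - s n)

  ConvergesTo : (ℕ → Carrier) → Carrier → Set
  ConvergesTo s l = ∀ (N : ℚ) → ∃[ M ] ∀ n → M ℕ.≤ n → [ N ] ≤⁺ v (s n - l)

  field
    complete      : ∀ s → Cauchy s → ∃ (ConvergesTo s)
    residues      : List Carrier
    finiteResidue : ∀ x → x ∈ 𝒪 → ∃[ y ] Membership._∈_ setoid y residues × x ≡ₘ y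
    p             : ℕ
    p-prime       : Prime p
    residueChar   : (p · 1#) ≡ₘ 0#

-- An algebraic closure together with the extension of v to it.
record AlgebraicClosure {c ℓ} (K : LocalField c ℓ) (c′ ℓ′ : Level)
       : Set (c ⊔ ℓ ⊔ suc (c′ ⊔ ℓ′)) where
  private module K = LocalField K
  field
    closure : Field c′ ℓ′
  open Field closure public
  open Polynomials closure public
  private module KP = Polynomials K.baseField
  field
    ι                   : K.Carrier → Carrier
    isRingMonomorphism  : RingMorphisms.IsRingMonomorphism K.rawRing rawRing ι
    algebraicallyClosed : AlgebraicallyClosed
    algebraic           : ∀ x → ∃[ q ] ¬ (q KP.≈ₚ KP.0ₚ) × eval (map ι q) x ≈ 0#
    v̄                   : Carrier → ℚ∞
    isValuation         : IsValuation closure v̄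
    extends             : ∀ x → v̄ (ι x) ≡ K.v x

  open RingMorphisms.IsRingMonomorphism isRingMonomorphism

  coeff-ι : ∀ q n → coeff (map ι q) n ≈ ι (KP.coeff q n)
  coeff-ι []      n         = sym 0#-homo
  coeff-ι (a ∷ q) zero      = refl
  coeff-ι (a ∷ q) (ℕ.suc n) = coeff-ι q n

  degree-ι : ∀ q n → KP.HasDegree q n → HasDegree (map ι q) n
  degree-ι q n (lc≉0 , bd) =
    (λ lc≈0 → lc≉0 (injective (trans (sym (coeff-ι q n)) (trans lc≈0 (sym 0#-homo))))) ,
    λ m n<m → trans (coeff-ι q m) (trans (⟦⟧-cong (bd m n<m)) 0#-homo)

------------------------------------------------------------------------
-- The function field of y² = f(x)

module _ {c ℓ} (F : Field c ℓ) where
  open Field F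
  open Polynomials F

  -- (α + βy)/δ
  record Fraction : Set (c ⊔ ℓ) where
    constructor fraction
    field
      α β δ : Poly
      δ≉0   : ¬ (δ ≈ₚ 0ₚ)

  1ₚ≉0 : ¬ (1ₚ ≈ₚ 0ₚ)
  1ₚ≉0 1≈0 = 0≉1 (sym (1≈0 0))

  constant : Carrier → Fraction
  constant a = fraction (a ∷ []) 0ₚ 1ₚ 1ₚ≉0

  -- For f not a square, this is the field F(x)[y]/(y² - f).
  functionField : Poly → RawRing (c ⊔ ℓ) ℓ
  functionField f = record
    { Carrier = Fraction
    ; _≈_ = λ (fraction α β δ _) (fraction α′ β′ δ′ _) →
        (α *ₚ δ′) ≈ₚ (α′ *ₚ δ) × (β *ₚ δ′) ≈ₚ (β′ *ₚ δ)
    ; _+_ = λ (fraction α β δ δ≉0) (fraction α′ β′ δ′ δ′≉0) →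
        fraction (α *ₚ δ′ +ₚ α′ *ₚ δ) (β *ₚ δ′ +ₚ β′ *ₚ δ)
                 (δ *ₚ δ′) (*ₚ-nonzero δ δ′ δ≉0 δ′≉0)
    ; _*_ = λ (fraction α β δ δ≉0) (fraction α′ β′ δ′ δ′≉0) →
        fraction (α *ₚ α′ +ₚ f *ₚ (β *ₚ β′)) (α *ₚ β′ +ₚ α′ *ₚ β)
                 (δ *ₚ δ′) (*ₚ-nonzero δ δ′ δ≉0 δ′≉0)
    ; -_ = λ (fraction α β δ δ≉0) → fraction (-ₚ α) (-ₚ β) δ δ≉0
    ; 0# = constant 0#
    ; 1# = constant 1#
    }

  -- The smooth projective curves y² = f and y² = h are isomorphic over F
  -- precisely when their function fields are isomorphic as F-algebras.
  record _≅_ (f h : Poly) : Set (c ⊔ ℓ) where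
    private
      module Kf = RawRing (functionField f)
      module Kh = RawRing (functionField h)
    field
      to             : Kf.Carrier → Kh.Carrier
      isIsomorphism  : RingMorphisms.IsRingIsomorphism (functionField f) (functionField h) to
      fixesConstants : ∀ a → to (constant a) Kh.≈ constant a

------------------------------------------------------------------------
-- Hyperelliptic curves over a local field

module Hyperelliptic {c ℓ c′ ℓ′} (K : LocalField c ℓ) (K̄ : AlgebraicClosure K c′ ℓ′) where
  private
    module K  = LocalField K
    module KP = Polynomials K.baseField
  open AlgebraicClosure K̄
  open RawSemiringDefs (Semiring.rawSemiring semiring) using (_^_) renaming (_×_ to _·_)

  Separable : KP.Poly → Set (c′ ⊔ ℓ′)
  Separable f = ∀ r q → ¬ (map ι f ≈ₚ X- r *ₚ (X- r *ₚ q))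

  -- y² = f(x), of genus g
  record HyperellipticCurve (g : ℕ) : Set (c ⊔ ℓ ⊔ c′ ⊔ ℓ′) where
    field
      f         : KP.Poly
      degree    : ℕ
      hasDegree : KP.HasDegree f degree
      degree≡   : degree ≡ 2 ℕ.* g ℕ.+ 1 ⊎ degree ≡ 2 ℕ.* g ℕ.+ 2
      separable : Separable f

    c-f : K.Carrier
    c-f = KP.coeff f degree

    ℛ : Pred Carrier ℓ′
    ℛ r = eval (map ι f) r ≈ 0#

    rootList : List Carrier
    rootList = proj₁ (splits algebraicallyClosed degree (map ι f) (degree-ι f degree hasDegree))

    discriminant : Carrier
    discriminant = (16 · 1#) ^ g * ι c-f ^ (4 ℕ.* g ℕ.+ 2) * rootDiscriminant rootList

  open HyperellipticCurve public using (c-f; ℛ; discriminant)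

  Disc : Carrier → ℚ → Pred Carrier _
  Disc z d x = [ d ] ≤⁺ v̄ (x - z)

  IsCluster : ∀ {g} → HyperellipticCurve g → Pred Carrier ℓ′ → Set (c′ ⊔ ℓ′)
  IsCluster C 𝔰 = Satisfiable 𝔰 × ∃₂ λ z d → 𝔰 ≐ (Disc z d ∩ ℛ C)

  HasSize : Pred Carrier ℓ′ → ℕ → Set (c′ ⊔ ℓ′)
  HasSize 𝔰 n = Σ[ xs ∈ List Carrier ]
    length xs ≡ n × UniqueSetoid.Unique setoid xs ×
    (∀ x → x ∈ 𝔰 ⇔ Membership._∈_ setoid x xs)

  -- d is the minimum of v(r - r′) over r, r′ ∈ 𝔰
  HasDepth : Pred Carrier ℓ′ → ℚ∞ → Set (c′ ⊔ ℓ′)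
  HasDepth 𝔰 d =
    (∃₂ λ r r′ → r ∈ 𝔰 × r′ ∈ 𝔰 × v̄ (r - r′) ≡ d) ×
    (∀ r r′ → r ∈ 𝔰 → r′ ∈ 𝔰 → d ≤⁺ v̄ (r - r′))

  IsIntegral : ∀ {g} → HyperellipticCurve g → Set
  IsIntegral E = ∀ n → KP.coeff (HyperellipticCurve.f E) n ∈ K.𝒪

  IsIntegralWeierstrassEquation : ∀ {g} → HyperellipticCurve g → HyperellipticCurve g → Set (c ⊔ ℓ)
  IsIntegralWeierstrassEquation C E =
    IsIntegral E × _≅_ K.baseField (HyperellipticCurve.f E) (HyperellipticCurve.f C)

  IsMinimalWeierstrassEquation :
    ∀ {g} → HyperellipticCurve g → HyperellipticCurve g → Set (c ⊔ ℓ ⊔ c′ ⊔ ℓ′)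
  IsMinimalWeierstrassEquation C E =
    IsIntegralWeierstrassEquation C E ×
    (∀ E′ → IsIntegralWeierstrassEquation C E′ → v̄ (discriminant E) ≤⁺ v̄ (discriminant E′))

{-# OPTIONS --safe #-}
module Submission where

-- A K-isomorphism from the function field of y² = h to that of y² = f sends x to some u = (A + By)/D. Since x is in
-- turn quadratic over K(u), a form of Gauss's lemma shows that u satisfies a quadratic equation over K(x) with
-- coefficients of degree at most 2. If B ≠ 0, the discriminant of this equation has degree at most 4 and equals f up
-- to squares, which is impossible as f is squarefree of degree at least 5. So u is a function of x, the same argument
-- shows that it is a Möbius transformation M, and comparing squares yields e²F = H ∘ M for the binary forms F and H
-- of degree 2g + 2 attached to f and h. Hence the valuations of the two discriminants differ by a positive multiple
-- of 2v(e) - (g + 1)v(det M).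
--
-- To see that this is nonnegative, let the linear factors of F have the roots Pᵢ, and let cᵢ be the least valuation of
-- a coordinate of M Pᵢ. Gauss's lemma and the integrality of H give (2g + 2)v(det M) ≤ 2v(e) + Σ cᵢ. If Pᵢ and Pⱼ are
-- distinct modulo the maximal ideal, then cᵢ + cⱼ ≤ v(det M); by the hypothesis on clusters every residue class
-- contains at most half of the Pᵢ, so that Σ cᵢ ≤ (g + 1)v(det M).

open import Algebra.Bundles using (CommutativeRing; RawRing; Semiring)
open import Algebra.Solver.Ring.AlmostCommutativeRing using (fromCommutativeRing; _-Raw-AlmostCommutative⟶_)
import Algebra.Solver.Ring as RingSolver
import Data.Maybe.Base as Maybe
import Relation.Nullary.Decidable.Core as Dec
open import Defs
open import Level using (Level; _⊔_)
open import Data.List.Base using (List; []; _∷_; length; map; foldr; filter; _++_; take)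
import Data.List.Properties as List
open import Data.List.Relation.Unary.All as All using (All; []; _∷_)
import Data.List.Relation.Unary.All.Properties as All
open import Data.List.Relation.Unary.Any using (Any; here; there)
open import Data.Nat.Base as ℕ using (ℕ; zero; suc; _≤_; _<_; z≤n; s≤s)
import Data.Nat.Properties as ℕ
open import Data.Product.Base using (∃; ∃₂; ∃-syntax; Σ-syntax; _×_; _,_; proj₁; proj₂)
open import Data.Sum.Base using (_⊎_; inj₁; inj₂)
open import Data.Empty using (⊥; ⊥-elim)
open import Function.Base using (_∘_)
open import Relation.Binary.Definitions using (Decidable)
open import Relation.Binary.PropositionalEquality as ≡ using (_≡_)
open import Relation.Nullary using (¬_; Dec; yes; no; ¬?; contradiction)
import Relation.Binary.Reasoning.Setoid as SetoidReasoning
import Algebra.Properties.Ring as RingProperties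
import Algebra.Properties.CommutativeSemiring.Exp as Exponentiation
import Algebra.Definitions.RawSemiring as RawSemiringDefs
open import Data.Rational.Base as ℚ using (ℚ; 0ℚ)
import Data.Rational.Properties as ℚ
import Algebra.Properties.Group as GroupProperties
import Algebra.Properties.AbelianGroup as AbelianGroupProperties
import Algebra.Definitions.RawMonoid as RawMonoidDefs
open import Function.Bundles using (Equivalence; mk⇔)
import Relation.Binary.Construct.Add.Supremum.NonStrict as NonStrict
import Relation.Binary.Construct.Add.Supremum.Strict as Strict
open NonStrict ℚ._≤_ using (_≤⊤⁺; ≤⁺-trans; ≤⁺-dec; [≤]-injective)
open Strict ℚ._<_ using ([_]<⊤⁺)
open import Relation.Nullary.Construct.Add.Supremum using (≡-dec; []-injective)
open import Data.Nat.Solver using (module +-*-Solver)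
open import Algebra.Morphism.Structures using (module RingMorphisms)
import Algebra.Morphism.Construct.Identity as Identity
import Data.List.Membership.Setoid.Properties as Membership
import Data.List.Relation.Unary.Unique.Setoid as UniqueSetoid
import Data.List.Relation.Unary.Unique.Setoid.Properties as Unique
import Algebra.Properties.Semiring.Mult as Multiples
open import Relation.Unary using (_≐_)
open import Data.List.Relation.Unary.AllPairs.Core using ([]; _∷_)

-- Function fields enter only through evaluation: a fraction (α + βy)/δ is evaluated at points (ρ ,
-- η) of the algebraic closure with η² = f(ρ), and identities are asserted for all but finitely many
-- ρ. Since a polynomial function with cofinitely many zeros is zero, generic identities become
-- identities of polynomials, and evaluating at both η and -η replaces the comparison of
-- coefficients of 1 and y.
--
-- The obstacle is that the isomorphism is an abstract one of K-algebras. Degree counting does the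
-- work of the uniqueness of the hyperelliptic involution; the bound 4 < 5 ≤ 2g + 1 comes from g ≥
-- 2.
--
-- In odd degree the point at infinity is adjoined as a zero. Both forms then have an even number 2m
-- = 2g + 2 of zeros, so that the denominator of H ∘ M is the square of an m-th power, and the
-- balancing argument can speak of half of the zeros.
--
-- The multiple in the overview arises as follows. With n = 2m - 1 there are mn pairs of zeros, so
-- the discriminants differ by e^(4n) against det(M)^(2mn), that is by 2n(2v(e) - m v(det M)) in
-- valuation.

module IntegerCoefficientSolver {c ℓ} (R : CommutativeRing c ℓ) where
  open CommutativeRing R
  open Multiples semiring using (×-homo-+; ×1-homo-*) renaming (_×_ to _·_)
  open RingProperties ring using (-‿distribˡ-*; -‿distribʳ-*; -‿involutive; -0#≈0#)
  open AbelianGroupProperties +-abelianGroup using (⁻¹-∙-comm)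
  open SetoidReasoning setoid

  -- (a , b) stands for the integer a - b.
  differences : RawRing _ _
  differences = record
    { Carrier = ℕ × ℕ
    ; _≈_     = λ (a , b) (c , d) → a ℕ.+ d ≡ c ℕ.+ b
    ; _+_     = λ (a , b) (c , d) → a ℕ.+ c , b ℕ.+ d
    ; _*_     = λ (a , b) (c , d) → a ℕ.* c ℕ.+ b ℕ.* d , a ℕ.* d ℕ.+ b ℕ.* c
    ; -_      = λ (a , b) → b , a
    ; 0#      = 0 , 0
    ; 1#      = 1 , 0
    }

  private
    module D = RawRing differences

    ⟦_⟧ : D.Carrier → Carrier
    ⟦ a , b ⟧ = a · 1# - b · 1#

    -- 0 and 1 are interpreted as 0# and 1# on the nose, so that refl proves the solved equations.
    ⟦_⟧′ : D.Carrier → Carrier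
    ⟦ 0 , 0 ⟧′ = 0#
    ⟦ 1 , 0 ⟧′ = 1#
    ⟦ m ⟧′     = ⟦ m ⟧

    ⟦⟧′≈⟦⟧ : ∀ m → ⟦ m ⟧′ ≈ ⟦ m ⟧
    ⟦⟧′≈⟦⟧ (0 , 0)                 = sym (-‿inverseʳ 0#)
    ⟦⟧′≈⟦⟧ (1 , 0)                 = sym (trans (+-cong (+-identityʳ 1#) -0#≈0#) (+-identityʳ 1#))
    ⟦⟧′≈⟦⟧ (ℕ.suc (ℕ.suc _) , 0)   = refl
    ⟦⟧′≈⟦⟧ (0 , ℕ.suc _)           = refl
    ⟦⟧′≈⟦⟧ (1 , ℕ.suc _)           = refl
    ⟦⟧′≈⟦⟧ (ℕ.suc (ℕ.suc _) , ℕ.suc _) = refl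

    interchange : ∀ w x y z → (w + x) + (y + z) ≈ (w + y) + (x + z)
    interchange w x y z = begin
      (w + x) + (y + z)  ≈⟨ +-assoc w x (y + z) ⟩
      w + (x + (y + z))  ≈⟨ +-congˡ (+-assoc x y z) ⟨
      w + ((x + y) + z)  ≈⟨ +-congˡ (+-congʳ (+-comm x y)) ⟩
      w + ((y + x) + z)  ≈⟨ +-congˡ (+-assoc y x z) ⟩
      w + (y + (x + z))  ≈⟨ +-assoc w y (x + z) ⟨
      (w + y) + (x + z)  ∎

    -‿+ : ∀ w x y z → (w + x) - (y + z) ≈ (w - y) + (x - z)
    -‿+ w x y z = trans (+-congˡ (sym (⁻¹-∙-comm y z))) (interchange w x (- y) (- z))

    +-homo : ∀ m n → ⟦ m D.+ n ⟧ ≈ ⟦ m ⟧ + ⟦ n ⟧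
    +-homo (a , b) (c , d) = trans
      (+-cong (×-homo-+ 1# a c) (-‿cong (×-homo-+ 1# b d))) (-‿+ _ _ _ _)

    *-homo : ∀ m n → ⟦ m D.* n ⟧ ≈ ⟦ m ⟧ * ⟦ n ⟧
    *-homo (a , b) (c , d) = begin
      (a ℕ.* c ℕ.+ b ℕ.* d) · 1# - (a ℕ.* d ℕ.+ b ℕ.* c) · 1#
        ≈⟨ +-cong (expand a c b d) (-‿cong (expand a d b c)) ⟩
      (A * C + B * E) - (A * E + B * C)
        ≈⟨ -‿+ _ _ _ _ ⟩
      (A * C - A * E) + (B * E - B * C)
        ≈⟨ +-congˡ (trans (+-comm _ _) (+-congˡ (sym (-‿involutive _)))) ⟩
      (A * C - A * E) + (- (B * C) - - (B * E))
        ≈⟨ +-cong (+-congˡ (-‿distribʳ-* A E)) (+-cong (-‿distribˡ-* B C)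
             (trans (-‿cong (-‿distribˡ-* B E)) (-‿distribʳ-* (- B) E))) ⟩
      (A * C + A * - E) + (- B * C + - B * - E)
        ≈⟨ +-cong (distribˡ A C (- E)) (distribˡ (- B) C (- E)) ⟨
      A * (C - E) + - B * (C - E)
        ≈⟨ distribʳ (C - E) A (- B) ⟨
      (A - B) * (C - E) ∎
      where
      A = a · 1#
      B = b · 1#
      C = c · 1#
      E = d · 1#

      expand : ∀ k l m n → (k ℕ.* l ℕ.+ m ℕ.* n) · 1# ≈ k · 1# * l · 1# + m · 1# * n · 1#
      expand k l m n = trans (×-homo-+ 1# (k ℕ.* l) (m ℕ.* n)) (+-cong (×1-homo-* k l) (×1-homo-* m n))

    -‿homo : ∀ m → ⟦ D.- m ⟧ ≈ - ⟦ m ⟧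
    -‿homo (a , b) = begin
      b · 1# - a · 1#        ≈⟨ +-comm _ _ ⟩
      - (a · 1#) + b · 1#    ≈⟨ +-congˡ (-‿involutive _) ⟨
      - (a · 1#) - - (b · 1#) ≈⟨ ⁻¹-∙-comm _ _ ⟩
      - (a · 1# - b · 1#)    ∎

    morphism : differences -Raw-AlmostCommutative⟶ fromCommutativeRing R
    morphism = record
      { ⟦_⟧    = ⟦_⟧′
      ; +-homo = λ m n → trans (⟦⟧′≈⟦⟧ (m D.+ n))
          (trans (+-homo m n) (sym (+-cong (⟦⟧′≈⟦⟧ m) (⟦⟧′≈⟦⟧ n))))
      ; *-homo = λ m n → trans (⟦⟧′≈⟦⟧ (m D.* n))
          (trans (*-homo m n) (sym (*-cong (⟦⟧′≈⟦⟧ m) (⟦⟧′≈⟦⟧ n))))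
      ; -‿homo = λ m → trans (⟦⟧′≈⟦⟧ (D.- m)) (trans (-‿homo m) (-‿cong (sym (⟦⟧′≈⟦⟧ m))))
      ; 0-homo = refl
      ; 1-homo = refl
      }

    cancel : ∀ {a b c d} → a + d ≈ c + b → a - b ≈ c - d
    cancel {a} {b} {c} {d} a+d≈c+b = begin
      a - b                  ≈⟨ +-identityʳ _ ⟨
      (a - b) + 0#           ≈⟨ +-congˡ (-‿inverseʳ d) ⟨
      (a - b) + (d - d)      ≈⟨ interchange a (- b) d (- d) ⟩
      (a + d) + (- b - d)    ≈⟨ +-congʳ a+d≈c+b ⟩
      (c + b) + (- b - d)    ≈⟨ +-assoc c b _ ⟩
      c + (b + (- b - d))    ≈⟨ +-congˡ (+-assoc b (- b) (- d)) ⟨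
      c + ((b - b) - d)      ≈⟨ +-congˡ (trans (+-congʳ (-‿inverseʳ b)) (+-identityˡ _)) ⟩
      c - d                  ∎

    sound : ∀ a b c d → a ℕ.+ d ≡ c ℕ.+ b → ⟦ a , b ⟧′ ≈ ⟦ c , d ⟧′
    sound a b c d eq = trans (⟦⟧′≈⟦⟧ (a , b)) (trans
      (cancel (trans (sym (×-homo-+ 1# a d)) (trans (reflexive (≡.cong (_· 1#) eq)) (×-homo-+ 1# c b))))
      (sym (⟦⟧′≈⟦⟧ (c , d))))

  open RingSolver differences (fromCommutativeRing R) morphism
    (λ (a , b) (c , d) → Maybe.map (sound a b c d) (Dec.dec⇒maybe (a ℕ.+ d ℕ.≟ c ℕ.+ b))) public

-- Algebra over an algebraically closed field with decidable equality.

module PolynomialFunctions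
  {c ℓ} (F : Field c ℓ) (_≟_ : Decidable (Field._≈_ F))
  (closed : Polynomials.AlgebraicallyClosed F) where

  open Field F hiding (zero) public
  open Polynomials F public
  open RingProperties ring using (-0#≈0#; +-cancelˡ) public
  open IntegerCoefficientSolver commutativeRing public using (Polynomial; solve; _:=_; _:+_; _:*_; _:-_; :-_; con)
  module ≈-Reasoning = SetoidReasoning setoid

  :0 :1 :2 : ∀ {n} → Polynomial n
  :0 = con (0 , 0)
  :1 = con (1 , 0)
  :2 = :1 :+ :1
  open ≈-Reasoning

  integral : ∀ {x y} → x * y ≈ 0# → x ≈ 0# ⊎ y ≈ 0#
  integral {x} {y} xy≈0 with x ≟ 0#
  ... | yes x≈0 = inj₁ x≈0
  ... | no  x≉0 = inj₂ (*-nonzero x≉0 xy≈0)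

  *≉0 : ∀ {x y} → ¬ x ≈ 0# → ¬ y ≈ 0# → ¬ x * y ≈ 0#
  *≉0 x≉0 y≉0 xy≈0 = y≉0 (*-nonzero x≉0 xy≈0)

  factorsˡ≉0 : ∀ {x y} → ¬ x * y ≈ 0# → ¬ x ≈ 0#
  factorsˡ≉0 xy≉0 x≈0 = xy≉0 (trans (*-congʳ x≈0) (zeroˡ _))

  factorsʳ≉0 : ∀ {x y} → ¬ x * y ≈ 0# → ¬ y ≈ 0#
  factorsʳ≉0 xy≉0 y≈0 = xy≉0 (trans (*-congˡ y≈0) (zeroʳ _))

  1≉0 : ¬ 1# ≈ 0#
  1≉0 = 0≉1 ∘ sym

  -1≉0 : ¬ - 1# ≈ 0#
  -1≉0 -1≈0 = 1≉0 (trans (sym (+-identityʳ 1#)) (trans (+-congˡ (sym -1≈0)) (-‿inverseʳ 1#)))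

  x-y≈0⇒x≈y : ∀ {x y} → x - y ≈ 0# → x ≈ y
  x-y≈0⇒x≈y {x} {y} x-y≈0 = begin
    x            ≈⟨ solve 2 (λ x y → x := (x :- y) :+ y) refl x y ⟩
    (x - y) + y  ≈⟨ +-congʳ x-y≈0 ⟩
    0# + y       ≈⟨ +-identityˡ y ⟩
    y            ∎

  x≈y⇒x-y≈0 : ∀ {x y} → x ≈ y → x - y ≈ 0#
  x≈y⇒x-y≈0 {x} {y} x≈y = trans (+-congʳ x≈y) (-‿inverseʳ y)

  -‿cong₂ : ∀ {w x y z} → w ≈ x → y ≈ z → w - y ≈ x - z
  -‿cong₂ w≈x y≈z = +-cong w≈x (-‿cong y≈z)

  *-cancelˡ : ∀ {x y z} → ¬ x ≈ 0# → x * y ≈ x * z → y ≈ z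
  *-cancelˡ {x} {y} {z} x≉0 xy≈xz = x-y≈0⇒x≈y (*-nonzero x≉0 (begin
    x * (y - z)    ≈⟨ solve 3 (λ x y z → x :* (y :- z) := x :* y :- x :* z) refl x y z ⟩
    x * y - x * z  ≈⟨ x≈y⇒x-y≈0 xy≈xz ⟩
    0#             ∎))

  eval-cong : ∀ p {x y} → x ≈ y → eval p x ≈ eval p y
  eval-cong []      x≈y = refl
  eval-cong (a ∷ p) x≈y = +-congˡ (*-cong x≈y (eval-cong p x≈y))

  eval-≈ₚ : ∀ p q → p ≈ₚ q → ∀ x → eval p x ≈ eval q x
  eval-≈ₚ []      q       p≈q x = sym (eval-zero q x (sym ∘ p≈q))
  eval-≈ₚ (a ∷ p) []      p≈q x = eval-zero (a ∷ p) x p≈q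
  eval-≈ₚ (a ∷ p) (b ∷ q) p≈q x = +-cong (p≈q 0) (*-congˡ (eval-≈ₚ p q (p≈q ∘ suc) x))

  eval-+ₚ : ∀ p q x → eval (p +ₚ q) x ≈ eval p x + eval q x
  eval-+ₚ []      q       x = sym (+-identityˡ _)
  eval-+ₚ (a ∷ p) []      x = sym (+-identityʳ _)
  eval-+ₚ (a ∷ p) (b ∷ q) x = trans (+-congˡ (*-congˡ (eval-+ₚ p q x)))
    (solve 5 (λ a b x p q → (a :+ b) :+ x :* (p :+ q) := (a :+ x :* p) :+ (b :+ x :* q)) refl
      a b x (eval p x) (eval q x))

  eval-scale : ∀ a p x → eval (map (a *_) p) x ≈ a * eval p x
  eval-scale a []      x = sym (zeroʳ a)
  eval-scale a (b ∷ p) x = trans (+-congˡ (*-congˡ (eval-scale a p x)))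
    (solve 4 (λ a b x p → a :* b :+ x :* (a :* p) := a :* (b :+ x :* p)) refl a b x (eval p x))

  eval-*ₚ : ∀ p q x → eval (p *ₚ q) x ≈ eval p x * eval q x
  eval-*ₚ []      q x = sym (zeroˡ _)
  eval-*ₚ (a ∷ p) q x = begin
    eval (map (a *_) q +ₚ (0# ∷ p *ₚ q)) x
      ≈⟨ eval-+ₚ (map (a *_) q) (0# ∷ p *ₚ q) x ⟩
    eval (map (a *_) q) x + (0# + x * eval (p *ₚ q) x)
      ≈⟨ +-cong (eval-scale a q x) (trans (+-identityˡ _) (*-congˡ (eval-*ₚ p q x))) ⟩
    a * eval q x + x * (eval p x * eval q x)
      ≈⟨ solve 4 (λ a q x p → a :* q :+ x :* (p :* q) := (a :+ x :* p) :* q) refl a (eval q x) x (eval p x) ⟩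
    (a + x * eval p x) * eval q x ∎

  eval-constant : ∀ a x → eval (a ∷ []) x ≈ a
  eval-constant a x = trans (+-congˡ (zeroʳ x)) (+-identityʳ a)

  eval-X- : ∀ r x → eval (X- r) x ≈ x - r
  eval-X- r x = trans (+-congˡ (trans (*-congˡ (eval-constant 1# x)) (*-identityʳ x))) (+-comm _ _)

  rootProduct : List Carrier → Carrier → Carrier
  rootProduct rs x = foldr (λ r acc → (x - r) * acc) 1# rs

  rootProduct-++ : ∀ rs ss x → rootProduct (rs ++ ss) x ≈ rootProduct rs x * rootProduct ss x
  rootProduct-++ []       ss x = sym (*-identityˡ _)
  rootProduct-++ (r ∷ rs) ss x = trans (*-congˡ (rootProduct-++ rs ss x)) (sym (*-assoc _ _ _))

  rootProduct-root : ∀ {r rs} → Any (r ≈_) rs → rootProduct rs r ≈ 0#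
  rootProduct-root (here r≈s)   = trans (*-congʳ (x≈y⇒x-y≈0 r≈s)) (zeroˡ _)
  rootProduct-root (there r∈rs) = trans (*-congˡ (rootProduct-root r∈rs)) (zeroʳ _)

  rootProduct≈0 : ∀ {x} rs → rootProduct rs x ≈ 0# → Any (x ≈_) rs
  rootProduct≈0 []       1≈0 = contradiction 1≈0 1≉0
  rootProduct≈0 (r ∷ rs) eq with integral eq
  ... | inj₁ x-r≈0 = here (x-y≈0⇒x≈y x-r≈0)
  ... | inj₂ eq′   = there (rootProduct≈0 rs eq′)

  eval-linearProduct : ∀ a rs x → eval (linearProduct a rs) x ≈ a * rootProduct rs x
  eval-linearProduct a []       x = trans (eval-constant a x) (sym (*-identityʳ a))
  eval-linearProduct a (r ∷ rs) x = begin
    eval (X- r *ₚ linearProduct a rs) x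
      ≈⟨ eval-*ₚ (X- r) (linearProduct a rs) x ⟩
    eval (X- r) x * eval (linearProduct a rs) x
      ≈⟨ *-cong (eval-X- r x) (eval-linearProduct a rs x) ⟩
    (x - r) * (a * rootProduct rs x)
      ≈⟨ solve 3 (λ y a p → y :* (a :* p) := a :* (y :* p)) refl (x - r) a (rootProduct rs x) ⟩
    a * ((x - r) * rootProduct rs x) ∎

  degree-X-* : ∀ r q n → HasDegree q n → HasDegree (X- r *ₚ q) (suc n)
  degree-X-* r q n (lc≉0 , bound) =
    (λ eq → lc≉0 (trans (sym (shift n ℕ.≤-refl)) eq)) ,
    λ { (suc m) (s≤s n<m) → trans (shift m (ℕ.<⇒≤ n<m)) (bound m n<m) }
    where
    shift : ∀ m → n ≤ m → coeff (X- r *ₚ q) (suc m) ≈ coeff q m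
    shift m n≤m = trans (coeff-X- r q (suc m))
      (trans (+-congʳ (trans (-‿cong (trans (*-congˡ (bound (suc m) (s≤s n≤m))) (zeroʳ r))) -0#≈0#))
        (+-identityˡ _))

  degree-linearProduct : ∀ {a} → ¬ a ≈ 0# → ∀ rs → HasDegree (linearProduct a rs) (length rs)
  degree-linearProduct a≉0 []       = a≉0 , λ { (suc _) _ → refl }
  degree-linearProduct a≉0 (r ∷ rs) = degree-X-* r (linearProduct _ rs) (length rs) (degree-linearProduct a≉0 rs)

  module _ (z : Carrier) (zs : List Carrier) where
    private
      p = linearProduct 1# (z ∷ zs)

      degree-p : HasDegree p (suc (length zs))
      degree-p = degree-linearProduct 1≉0 (z ∷ zs)

      shift : ∀ n → coeff (p +ₚ 1ₚ) (suc n) ≈ coeff p (suc n)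
      shift n = trans (coeff-+ₚ p 1ₚ (suc n)) (+-identityʳ _)

      degree-p+1 : HasDegree (p +ₚ 1ₚ) (suc (length zs))
      degree-p+1 =
        (λ eq → proj₁ degree-p (trans (sym (shift (length zs))) eq)) ,
        λ { (suc m) lt → trans (shift m) (proj₂ degree-p (suc m) lt) }

      rootProduct≈-1 : ∀ ξ → eval (p +ₚ 1ₚ) ξ ≈ 0# → rootProduct (z ∷ zs) ξ ≈ - 1#
      rootProduct≈-1 ξ root = x-y≈0⇒x≈y (trans
        (solve 1 (λ r → r :- (:- :1) := :1 :* r :+ :1) refl (rootProduct (z ∷ zs) ξ))
        (trans (+-cong (sym (eval-linearProduct 1# (z ∷ zs) ξ)) (sym (eval-constant 1# ξ)))
        (trans (sym (eval-+ₚ p 1ₚ ξ)) root)))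

    -- ∏ (X - z) + 1 is nonconstant because the list is nonempty, so it has a root. Such a root
    -- avoids every listed element, and over a valued field it even avoids their residue classes.
    unit-rootProduct : ∃[ ξ ] rootProduct (z ∷ zs) ξ ≈ - 1#
    unit-rootProduct = let ξ , root = closed (p +ₚ 1ₚ) (length zs) degree-p+1 in ξ , rootProduct≈-1 ξ root

  -- Cofinite sets

  Avoids : List Carrier → Carrier → Set (c ⊔ ℓ)
  Avoids zs x = All (λ z → ¬ x ≈ z) zs

  -- Carrying the exceptional set as a list makes intersection a concatenation and allows a witness
  -- to be computed.
  Cofinitely : ∀ {a} → (Carrier → Set a) → Set (a ⊔ c ⊔ ℓ)
  Cofinitely P = ∃[ zs ] ∀ x → Avoids zs x → P x

  module _ {a b} {P : Carrier → Set a} {Q : Carrier → Set b} where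

    cofinitely-map : (∀ {x} → P x → Q x) → Cofinitely P → Cofinitely Q
    cofinitely-map f (zs , h) = zs , λ x av → f (h x av)

    cofinitely-∩ : Cofinitely P → Cofinitely Q → Cofinitely (λ x → P x × Q x)
    cofinitely-∩ (zs , h) (ws , k) = zs ++ ws , λ x av →
      h x (All.++⁻ˡ zs av) , k x (All.++⁻ʳ zs av)

  cofinitely-All : ∀ {a b} {B : Set b} {P : B → Carrier → Set a} → (∀ y → Cofinitely (P y)) →
                   ∀ ys → Cofinitely (λ x → All (λ y → P y x) ys)
  cofinitely-All h []       = [] , λ _ _ → []
  cofinitely-All h (y ∷ ys) = cofinitely-map (λ (p , ps) → p ∷ ps) (cofinitely-∩ (h y) (cofinitely-All h ys))

  rootProduct≉0 : ∀ zs x → ¬ rootProduct zs x ≈ 0# → Avoids zs x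
  rootProduct≉0 []       x _  = []
  rootProduct≉0 (z ∷ zs) x eq =
    (λ x≈z → factorsˡ≉0 eq (x≈y⇒x-y≈0 x≈z)) ∷ rootProduct≉0 zs x (factorsʳ≉0 eq)

  avoids-rootProduct : ∀ zs x → Avoids zs x → ¬ rootProduct zs x ≈ 0#
  avoids-rootProduct []       x []         = 1≉0
  avoids-rootProduct (z ∷ zs) x (x≉z ∷ av) = *≉0 (x≉z ∘ x-y≈0⇒x≈y) (avoids-rootProduct zs x av)

  -- An algebraically closed field is infinite: where ∏ (ξ - z) is -1, no factor vanishes. The
  -- additional `0#` makes the product nonconstant even if `zs` is empty.
  cofinitely-witness : ∀ {a} {P : Carrier → Set a} → Cofinitely P → ∃ P
  cofinitely-witness (zs , h) = let ξ , eq = unit-rootProduct 0# zs in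
    ξ , h ξ (rootProduct≉0 zs ξ (factorsʳ≉0 {ξ - 0#} λ eq0 → -1≉0 (trans (sym eq) eq0)))

  -- Polynomial functions

  -- Polynomials are treated as functions, for which the ring solver applies pointwise. Nothing is
  -- lost, since over an infinite field the function determines the coefficients (`eval-injective`).
  IsPoly : (Carrier → Carrier) → Set (c ⊔ ℓ)
  IsPoly a = ∃[ p ] ∀ x → a x ≈ eval p x

  DegreeAtMost : ℕ → (Carrier → Carrier) → Set (c ⊔ ℓ)
  DegreeAtMost m a = ∃[ p ] length p ≤ suc m × ∀ x → a x ≈ eval p x

  isPoly : ∀ {m a} → DegreeAtMost m a → IsPoly a
  isPoly (p , _ , h) = p , h

  poly : ∀ p → IsPoly (eval p)
  poly p = p , λ _ → refl

  constantᵖ : ∀ a → IsPoly (λ _ → a)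
  constantᵖ a = a ∷ [] , λ x → sym (eval-constant a x)

  identityᵖ : IsPoly (λ x → x)
  identityᵖ = 0# ∷ 1# ∷ [] , λ x → sym (trans (+-identityˡ _) (trans (*-congˡ (eval-constant 1# x)) (*-identityʳ x)))

  module _ {a b : Carrier → Carrier} where

    infixl 6 _+ᵖ_ _-ᵖ_
    infixl 7 _*ᵖ_

    _+ᵖ_ : IsPoly a → IsPoly b → IsPoly (λ x → a x + b x)
    (p , h) +ᵖ (q , k) = p +ₚ q , λ x → trans (+-cong (h x) (k x)) (sym (eval-+ₚ p q x))

    _*ᵖ_ : IsPoly a → IsPoly b → IsPoly (λ x → a x * b x)
    (p , h) *ᵖ (q , k) = p *ₚ q , λ x → trans (*-cong (h x) (k x)) (sym (eval-*ₚ p q x))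

    _-ᵖ_ : IsPoly a → IsPoly b → IsPoly (λ x → a x - b x)
    (p , h) -ᵖ (q , k) = p +ₚ map (- 1# *_) q , λ x →
      trans (+-cong (h x) (trans (-‿cong (k x)) (solve 1 (λ y → :- y := (:- :1) :* y) refl (eval q x))))
        (sym (trans (eval-+ₚ p (map (- 1# *_) q) x) (+-congˡ (eval-scale (- 1#) q x))))

    poly-resp : (∀ x → a x ≈ b x) → IsPoly a → IsPoly b
    poly-resp a≈b (p , h) = p , λ x → trans (sym (a≈b x)) (h x)

    degree-resp : ∀ {m} → (∀ x → a x ≈ b x) → DegreeAtMost m a → DegreeAtMost m b
    degree-resp a≈b (p , len , h) = p , len , λ x → trans (sym (a≈b x)) (h x)

  poly-cong : ∀ {a} → IsPoly a → ∀ {x y} → x ≈ y → a x ≈ a y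
  poly-cong (p , h) {x} {y} x≈y = trans (h x) (trans (eval-cong p x≈y) (sym (h y)))

  linearᵖ : ∀ r → IsPoly (λ x → x - r)
  linearᵖ r = identityᵖ -ᵖ constantᵖ r

  rootProductᵖ : ∀ rs → IsPoly (rootProduct rs)
  rootProductᵖ []       = constantᵖ 1#
  rootProductᵖ (r ∷ rs) = linearᵖ r *ᵖ rootProductᵖ rs

  length-+ₚ : ∀ p q {n} → length p ≤ n → length q ≤ n → length (p +ₚ q) ≤ n
  length-+ₚ []      q       lp lq = lq
  length-+ₚ (_ ∷ _) []      lp lq = lp
  length-+ₚ (_ ∷ p) (_ ∷ q) (s≤s lp) (s≤s lq) = s≤s (length-+ₚ p q lp lq)

  length-scale : ∀ a p {n} → length p ≤ n → length (map (a *_) p) ≤ n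
  length-scale a p = ℕ.≤-trans (ℕ.≤-reflexive (List.length-map (a *_) p))

  length-*ₚ : ∀ p q {m n} → length p ≤ suc m → length q ≤ suc n → length (p *ₚ q) ≤ suc (m ℕ.+ n)
  length-*ₚ []      q       lp       lq = z≤n
  length-*ₚ (a ∷ p) q {m} {n} (s≤s lp) lq = length-+ₚ (map (a *_) q) (0# ∷ p *ₚ q)
    (length-scale a q (ℕ.≤-trans lq (s≤s (ℕ.m≤n+m n m)))) (s≤s (tail p lp))
    where
    tail : ∀ p {m} → length p ≤ m → length (p *ₚ q) ≤ m ℕ.+ n
    tail []        _        = z≤n
    tail p@(_ ∷ _) {suc m} lp = length-*ₚ p q lp lq

  degree-* : ∀ {m n a b} → DegreeAtMost m a → DegreeAtMost n b → DegreeAtMost (m ℕ.+ n) (λ x → a x * b x)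
  degree-* (p , lp , h) (q , lq , k) = p *ₚ q , length-*ₚ p q lp lq , proj₂ ((p , h) *ᵖ (q , k))

  degree-sub : ∀ {n a b} → DegreeAtMost n a → DegreeAtMost n b → DegreeAtMost n (λ x → a x - b x)
  degree-sub (p , lp , h) (q , lq , k) =
    p +ₚ map (- 1# *_) q , length-+ₚ p _ lp (length-scale _ q lq) , proj₂ ((p , h) -ᵖ (q , k))

  degree-linear : ∀ a b → DegreeAtMost 1 (λ x → a * x + b)
  degree-linear a b = b ∷ a ∷ [] , s≤s (s≤s z≤n) , λ x →
    trans (+-comm _ _) (+-congˡ (trans (*-comm _ _) (*-congˡ (sym (eval-constant a x)))))

  degree-scale : ∀ {n a} k → DegreeAtMost n a → DegreeAtMost n (λ x → k * a x)
  degree-scale k (p , lp , h) =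
    map (k *_) p , length-scale k p lp , λ x → trans (*-congˡ (h x)) (sym (eval-scale k p x))

  -- The same quotient by X - r as `quotient`, but without its trailing zero coefficient, so that
  -- the length of the list really drops.
  deflate : Poly → Carrier → Poly
  deflate []              r = []
  deflate (a ∷ [])        r = []
  deflate (a ∷ p@(_ ∷ _)) r = eval p r ∷ deflate p r

  length-deflate : ∀ p r {m} → length p ≤ suc m → length (deflate p r) ≤ m
  length-deflate []                  r         _         = z≤n
  length-deflate (_ ∷ [])            r         _         = z≤n
  length-deflate (_ ∷ p@(_ ∷ _))     r {suc m} (s≤s len) = s≤s (length-deflate p r len)
  length-deflate (_ ∷ _ ∷ _)         r {zero}  (s≤s ())

  eval-deflate : ∀ p r x → eval p x - eval p r ≈ (x - r) * eval (deflate p r) x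
  eval-deflate []              r x = trans (-‿inverseʳ 0#) (sym (zeroʳ _))
  eval-deflate (a ∷ [])        r x =
    solve 3 (λ a r x → (a :+ x :* :0) :- (a :+ r :* :0) := (x :- r) :* :0) refl a r x
  eval-deflate (a ∷ p@(_ ∷ _)) r x = begin
    (a + x * P x) - (a + r * P r)
      ≈⟨ solve 5 (λ a r x p q → (a :+ x :* p) :- (a :+ r :* q) := (x :- r) :* q :+ x :* (p :- q)) refl
           a r x (P x) (P r) ⟩
    (x - r) * P r + x * (P x - P r)
      ≈⟨ +-congˡ (*-congˡ (eval-deflate p r x)) ⟩
    (x - r) * P r + x * ((x - r) * D)
      ≈⟨ solve 4 (λ r x q d → (x :- r) :* q :+ x :* ((x :- r) :* d) := (x :- r) :* (q :+ x :* d)) refl r x (P r) D ⟩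
    (x - r) * (P r + x * D) ∎
    where
    P = eval p
    D = eval (deflate p r) x

  x-0≈x : ∀ x → x - 0# ≈ x
  x-0≈x x = trans (+-congˡ -0#≈0#) (+-identityʳ x)

  eval-root : ∀ p {r} → eval p r ≈ 0# → ∀ x → eval p x ≈ (x - r) * eval (deflate p r) x
  eval-root p {r} root x = trans (sym (trans (+-congˡ (-‿cong root)) (x-0≈x _))) (eval-deflate p r x)

  infix 4 _∣ᵖ_
  _∣ᵖ_ : (b a : Carrier → Carrier) → Set (c ⊔ ℓ)
  b ∣ᵖ a = ∃[ q ] IsPoly q × ∀ x → a x ≈ b x * q x

  poly-root : ∀ {a r} → IsPoly a → a r ≈ 0# → (λ x → x - r) ∣ᵖ a
  poly-root {r = r} (p , h) root =
    eval (deflate p r) , poly (deflate p r) , λ x → trans (h x) (eval-root p (trans (sym (h r)) root) x)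

  -- The form in which nonzero polynomial functions are used: it displays the finite zero set, and
  -- `length rs` counts the zeros with multiplicity.
  Factored : (Carrier → Carrier) → Set (c ⊔ ℓ)
  Factored a = ∃[ k ] ∃[ rs ] ¬ k ≈ 0# × ∀ x → a x ≈ k * rootProduct rs x

  zeroOrDegree : ∀ p → p ≈ₚ 0ₚ ⊎ ∃ (HasDegree p)
  zeroOrDegree []      = inj₁ λ _ → refl
  zeroOrDegree (a ∷ p) with zeroOrDegree p | a ≟ 0#
  ... | inj₂ (n , lc≉0 , bd) | _       = inj₂ (suc n , lc≉0 , λ { (suc m) (s≤s n<m) → bd m n<m })
  ... | inj₁ p≈0             | yes a≈0 = inj₁ λ { zero → a≈0 ; (suc n) → p≈0 n }
  ... | inj₁ p≈0             | no a≉0  = inj₂ (0 , a≉0 , λ { (suc m) _ → p≈0 m })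

  coeff-beyond : ∀ p n → length p ≤ n → coeff p n ≈ 0#
  coeff-beyond []      n       _         = refl
  coeff-beyond (a ∷ p) (suc n) (s≤s len) = coeff-beyond p n len

  factorization : ∀ p n → HasDegree p n →
    ∃[ rs ] length rs ≡ n × (∀ x → eval p x ≈ coeff p n * rootProduct rs x)
  factorization p n deg with splits closed n p deg
  ... | rs , len , p≈ = rs , len , λ x → trans (eval-≈ₚ p (linearProduct (coeff p n) rs) p≈ x)
    (eval-linearProduct (coeff p n) rs x)

  factored-of-degree : ∀ p n → HasDegree p n → Factored (eval p)
  factored-of-degree p n deg = let rs , _ , h = factorization p n deg in coeff p n , rs , proj₁ deg , h

  zeroOrFactored : ∀ {a} → IsPoly a → (∀ x → a x ≈ 0#) ⊎ Factored a
  zeroOrFactored (p , h) with zeroOrDegree p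
  ... | inj₁ p≈0       = inj₁ λ x → trans (h x) (eval-zero p x p≈0)
  ... | inj₂ (n , deg) = let k , rs , k≉0 , h′ = factored-of-degree p n deg in
    inj₂ (k , rs , k≉0 , λ x → trans (h x) (h′ x))

  cofinitely-≉0 : ∀ {a} → Factored a → Cofinitely (λ x → ¬ a x ≈ 0#)
  cofinitely-≉0 (k , rs , k≉0 , h) = rs , λ x av → λ ax≈0 →
    *≉0 k≉0 (avoids-rootProduct rs x av) (trans (sym (h x)) ax≈0)

  factored≢0 : ∀ {a} → Factored a → ¬ (∀ x → a x ≈ 0#)
  factored≢0 fa a≈0 = let x , ax≉0 = cofinitely-witness (cofinitely-≉0 fa) in ax≉0 (a≈0 x)

  factored : ∀ {a} → IsPoly a → ¬ (∀ x → a x ≈ 0#) → Factored a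
  factored pa a≢0 with zeroOrFactored pa
  ... | inj₁ a≈0 = contradiction a≈0 a≢0
  ... | inj₂ fa  = fa

  factored-* : ∀ {a b} → Factored a → Factored b → Factored (λ x → a x * b x)
  factored-* {a} {b} (k , rs , k≉0 , h) (l , ss , l≉0 , h′) = k * l , rs ++ ss , *≉0 k≉0 l≉0 , λ x → begin
    a x * b x
      ≈⟨ *-cong (h x) (h′ x) ⟩
    (k * rootProduct rs x) * (l * rootProduct ss x)
      ≈⟨ solve 4 (λ k p l q → (k :* p) :* (l :* q) := (k :* l) :* (p :* q)) refl
           k (rootProduct rs x) l (rootProduct ss x) ⟩
    k * l * (rootProduct rs x * rootProduct ss x)
      ≈⟨ *-congˡ (rootProduct-++ rs ss x) ⟨
    k * l * rootProduct (rs ++ ss) x ∎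

  factored-const : ∀ {k} → ¬ k ≈ 0# → Factored (λ _ → k)
  factored-const {k} k≉0 = k , [] , k≉0 , λ _ → sym (*-identityʳ k)

  factored-linear : ∀ r → Factored (λ x → x - r)
  factored-linear r = 1# , r ∷ [] , 1≉0 , λ x → sym (trans (*-identityˡ _) (*-identityʳ _))

  vanishing : ∀ {a} → IsPoly a → Cofinitely (λ x → a x ≈ 0#) → ∀ x → a x ≈ 0#
  vanishing pa co with zeroOrFactored pa
  ... | inj₁ a≈0 = a≈0
  ... | inj₂ fa  = let _ , eq , neq = cofinitely-witness (cofinitely-∩ co (cofinitely-≉0 fa)) in
    contradiction eq neq

  -- The principle that turns generic identities into identities everywhere: the difference can be
  -- nonzero only if it has finitely many zeros.
  agree : ∀ {a b} → IsPoly a → IsPoly b → Cofinitely (λ x → a x ≈ b x) → ∀ x → a x ≈ b x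
  agree pa pb co x = x-y≈0⇒x≈y (vanishing (pa -ᵖ pb) (cofinitely-map x≈y⇒x-y≈0 co) x)

  cancel : ∀ {k a b} → Factored k → IsPoly a → IsPoly b → (∀ x → k x * a x ≈ k x * b x) → ∀ x → a x ≈ b x
  cancel fk pa pb eq = agree pa pb (cofinitely-map (λ {x} k≉0 → *-cancelˡ k≉0 (eq x)) (cofinitely-≉0 fk))

  eval-zero⇒≈ₚ0 : ∀ p → (∀ x → eval p x ≈ 0#) → p ≈ₚ 0ₚ
  eval-zero⇒≈ₚ0 p p≈0 with zeroOrDegree p
  ... | inj₁ eq        = eq
  ... | inj₂ (n , deg) = contradiction p≈0 (factored≢0 (factored-of-degree p n deg))

  eval-injective : ∀ p q → (∀ x → eval p x ≈ eval q x) → p ≈ₚ q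
  eval-injective p q eq n = x-y≈0⇒x≈y (begin
    coeff p n - coeff q n
      ≈⟨ solve 2 (λ p q → p :- q := p :+ (:- :1) :* q) refl (coeff p n) (coeff q n) ⟩
    coeff p n + - 1# * coeff q n
      ≈⟨ +-congˡ (coeff-scale (- 1#) q n) ⟨
    coeff p n + coeff (map (- 1# *_) q) n
      ≈⟨ coeff-+ₚ p (map (- 1# *_) q) n ⟨
    coeff (p +ₚ map (- 1# *_) q) n
      ≈⟨ eval-zero⇒≈ₚ0 (p +ₚ map (- 1# *_) q) (λ x → trans (sym (proj₂ (poly p -ᵖ poly q) x)) (x≈y⇒x-y≈0 (eq x))) n ⟩
    0# ∎)

  factored-of-≉ : ∀ p → ¬ p ≈ₚ 0ₚ → Factored (eval p)
  factored-of-≉ p p≉0 = factored (poly p) (p≉0 ∘ eval-zero⇒≈ₚ0 p)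

  -- Multiplicities are respected because each root is divided out of both sides before the next is
  -- considered; `cancel` restores the product identity after each division.
  roots≤degree : ∀ {m a b} rs → DegreeAtMost m a → IsPoly b → ¬ (∀ x → a x ≈ 0#) →
    (∀ x → a x ≈ rootProduct rs x * b x) → length rs ≤ m
  roots≤degree []       _ _ _ _ = z≤n
  roots≤degree {m} {a} {b} (r ∷ rs) (p , len , h) pb a≢0 eq = go m len
    where
    ar≈0 : a r ≈ 0#
    ar≈0 = trans (eq r) (trans (*-congʳ (rootProduct-root {rs = r ∷ rs} (here refl))) (zeroˡ _))

    a′ : Carrier → Carrier
    a′ = eval (deflate p r)

    a≈ : ∀ x → a x ≈ (x - r) * a′ x
    a≈ x = trans (h x) (eval-root p (trans (sym (h r)) ar≈0) x)

    go : ∀ m → length p ≤ suc m → suc (length rs) ≤ m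
    go zero    len = contradiction (λ x → trans (a≈ x) (trans (*-congˡ (deflate-constant p len x)) (zeroʳ _))) a≢0
      where
      deflate-constant : ∀ p → length p ≤ 1 → ∀ x → eval (deflate p r) x ≈ 0#
      deflate-constant []          _        x = refl
      deflate-constant (_ ∷ [])    _        x = refl
      deflate-constant (_ ∷ _ ∷ _) (s≤s ()) x
    go (suc m) len = s≤s (roots≤degree rs (deflate p r , length-deflate p r len , λ _ → refl) pb
      (λ a′≈0 → a≢0 λ x → trans (a≈ x) (trans (*-congˡ (a′≈0 x)) (zeroʳ _)))
      (cancel (factored-linear r) (poly (deflate p r)) (rootProductᵖ rs *ᵖ pb) λ x →
        trans (sym (a≈ x)) (trans (eq x) (*-assoc _ _ _))))

  coeff-bound⇒degree : ∀ p m → (∀ k → m < k → coeff p k ≈ 0#) → DegreeAtMost m (eval p)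
  coeff-bound⇒degree p m bd = take (suc m) p , bound (suc m) p , eval-≈ₚ p (take (suc m) p) (go p m bd)
    where
    bound : ∀ n (p : Poly) → length (take n p) ≤ n
    bound zero    p       = z≤n
    bound (suc n) []      = z≤n
    bound (suc n) (_ ∷ p) = s≤s (bound n p)

    go : ∀ p m → (∀ k → m < k → coeff p k ≈ 0#) → p ≈ₚ take (suc m) p
    go []      m       bd k       = refl
    go (a ∷ p) m       bd zero    = refl
    go (a ∷ p) zero    bd (suc k) = bd (suc k) (s≤s z≤n)
    go (a ∷ p) (suc m) bd (suc k) = go p m (λ k m<k → bd (suc k) (s≤s m<k)) k

  degree⇒coeff-bound : ∀ p m → DegreeAtMost m (eval p) → ∀ k → m < k → coeff p k ≈ 0#
  degree⇒coeff-bound p m (q , len , h) k m<k =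
    trans (eval-injective p q h k) (coeff-beyond q k (ℕ.≤-trans len m<k))

  -- Divisibility

  Squarefree : (Carrier → Carrier) → Set (c ⊔ ℓ)
  Squarefree f = ∀ r {q} → IsPoly q → ¬ (∀ x → f x ≈ (x - r) * ((x - r) * q x))

  private
    pull-square : ∀ y s f → (y * y) * (s * s * f) ≈ (y * s) * (y * s) * f
    pull-square = solve 3 (λ y s f → (y :* y) :* (s :* s :* f) := (y :* s) :* (y :* s) :* f) refl

    pull-past : ∀ k y r → k * (y * r) ≈ y * (k * r)
    pull-past = solve 3 (λ k y r → k :* (y :* r) := y :* (k :* r)) refl

  -- Each root of δ is a root of s, for otherwise it would be a double root of f.
  squarefree-quotient : ∀ {k s f G} ds → IsPoly s → IsPoly f → IsPoly G → Squarefree f →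
    (∀ x → s x * s x * f x ≈ (k * rootProduct ds x) * (k * rootProduct ds x) * G x) →
    ∃[ t ] IsPoly t × (∀ x → s x ≈ rootProduct ds x * t x) × (∀ x → t x * t x * f x ≈ k * k * G x)
  squarefree-quotient {k} {s} {f} {G} [] ps pf pG sf eq =
    s , ps , (λ x → sym (*-identityˡ _)) ,
    λ x → trans (eq x) (*-congʳ (*-cong (*-identityʳ k) (*-identityʳ k)))
  squarefree-quotient {k} {s} {f} {G} (d ∷ ds) ps pf pG sf eq = go (s d ≟ 0#)
    where
    δ₁ : Carrier → Carrier
    δ₁ x = k * rootProduct ds x

    pδ₁ : IsPoly δ₁
    pδ₁ = constantᵖ k *ᵖ rootProductᵖ ds

    eq′ : ∀ x → s x * s x * f x ≈ (x - d) * (x - d) * (δ₁ x * δ₁ x * G x)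
    eq′ x = trans (eq x) (trans
      (*-congʳ (*-cong (pull-past k (x - d) (rootProduct ds x)) (pull-past k (x - d) (rootProduct ds x))))
      (sym (pull-square (x - d) (δ₁ x) (G x))))

    Result : Set (c ⊔ ℓ)
    Result = ∃[ t ] IsPoly t × (∀ x → s x ≈ ((x - d) * rootProduct ds x) * t x) ×
      (∀ x → t x * t x * f x ≈ k * k * G x)

    s-root : (λ x → x - d) ∣ᵖ s → Result
    s-root (s₁ , ps₁ , s≈) = extend (squarefree-quotient ds ps₁ pf pG sf
      (cancel (factored-* (factored-linear d) (factored-linear d)) (ps₁ *ᵖ ps₁ *ᵖ pf) (pδ₁ *ᵖ pδ₁ *ᵖ pG)
        λ x → trans (pull-square (x - d) (s₁ x) (f x))
          (trans (*-congʳ (*-cong (sym (s≈ x)) (sym (s≈ x)))) (eq′ x))))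
      where
      extend : ∃[ t ] IsPoly t × (∀ x → s₁ x ≈ rootProduct ds x * t x) × (∀ x → t x * t x * f x ≈ k * k * G x) →
        Result
      extend (t , pt , s₁≈ , t²f≈) = t , pt , (λ x → trans (s≈ x) (trans (*-congˡ (s₁≈ x)) (sym (*-assoc _ _ _)))) ,
        t²f≈

    f-root : ¬ s d * s d ≈ 0# → ¬ (λ x → x - d) ∣ᵖ f
    f-root s²≉0 (f₁ , pf₁ , f≈) =
      -- After one factor x - d is cancelled, another remains on the right, so `f₁` vanishes at d as
      -- well.
      double (poly-root pf₁ (*-nonzero s²≉0 (trans (eq₁ d) (trans (*-congʳ (-‿inverseʳ d)) (zeroˡ _)))))
      where
      eq₁ : ∀ x → s x * s x * f₁ x ≈ (x - d) * (δ₁ x * δ₁ x * G x)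
      eq₁ = cancel (factored-linear d) (ps *ᵖ ps *ᵖ pf₁) (linearᵖ d *ᵖ (pδ₁ *ᵖ pδ₁ *ᵖ pG)) λ x →
        trans (sym (pull-past (s x * s x) (x - d) (f₁ x)))
          (trans (*-congˡ (sym (f≈ x))) (trans (eq′ x) (*-assoc _ _ _)))

      double : ¬ (λ x → x - d) ∣ᵖ f₁
      double (f₂ , pf₂ , f₁≈) = sf d pf₂ λ x → trans (f≈ x) (*-congˡ (f₁≈ x))

    go : Dec (s d ≈ 0#) → Result
    go (yes sd≈0) = s-root (poly-root ps sd≈0)
    go (no sd≉0)  = ⊥-elim (f-root (*≉0 sd≉0 sd≉0) (poly-root pf (*-nonzero (*≉0 sd≉0 sd≉0) (trans (eq′ d)
      (trans (*-congʳ (*-congʳ (-‿inverseʳ d))) (trans (*-congʳ (zeroˡ _)) (zeroˡ _)))))))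

  factored-rootProduct : ∀ rs → Factored (rootProduct rs)
  factored-rootProduct rs = 1# , rs , 1≉0 , λ x → sym (*-identityˡ _)

  square-degree : ∀ {l k cf m} {f G : Carrier → Carrier} ts fs → ¬ l ≈ 0# → ¬ cf ≈ 0# → DegreeAtMost m G →
    (∀ x → f x ≈ cf * rootProduct fs x) →
    (∀ x → (l * rootProduct ts x) * (l * rootProduct ts x) * f x ≈ k * k * G x) →
    length ts ℕ.+ (length ts ℕ.+ length fs) ≤ m
  square-degree {l} {k} {cf} {m} {f} {G} ts fs l≉0 cf≉0 dG f≈ eq =
    ℕ.≤-trans (ℕ.≤-reflexive (≡.sym (≡.trans (List.length-++ ts) (≡.cong (length ts ℕ.+_) (List.length-++ ts)))))
      (roots≤degree (ts ++ ts ++ fs) (degree-scale (k * k) dG) (constantᵖ (l * l * cf)) nonzero split)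
    where
    T = rootProduct ts

    split : ∀ x → k * k * G x ≈ rootProduct (ts ++ ts ++ fs) x * (l * l * cf)
    split x = begin
      k * k * G x                        ≈⟨ eq x ⟨
      (l * T x) * (l * T x) * f x        ≈⟨ *-congˡ (f≈ x) ⟩
      (l * T x) * (l * T x) * (cf * rootProduct fs x)
        ≈⟨ solve 4 (λ l t c f → (l :* t) :* (l :* t) :* (c :* f) := (t :* (t :* f)) :* (l :* l :* c)) refl
             l (T x) cf (rootProduct fs x) ⟩
      (T x * (T x * rootProduct fs x)) * (l * l * cf)
        ≈⟨ *-congʳ (trans (rootProduct-++ ts (ts ++ fs) x) (*-congˡ (rootProduct-++ ts fs x))) ⟨
      rootProduct (ts ++ ts ++ fs) x * (l * l * cf) ∎

    nonzero : ¬ (∀ x → k * k * G x ≈ 0#)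
    nonzero k²G≈0 = factored≢0
      (factored-* (factored-rootProduct (ts ++ ts ++ fs)) (factored-const (*≉0 (*≉0 l≉0 l≉0) cf≉0)))
      λ x → trans (sym (split x)) (k²G≈0 x)

  -- As f is squarefree, δ divides s, and G is a constant multiple of t²f for the quotient t. A
  -- bound for the degree of G thus bounds those of f and t. It is applied once to contradict the
  -- degree of f, and once to see that t is constant.
  squarefree-degree : ∀ {s δ f G m} (ff : Factored f) → Factored s → Factored δ → IsPoly s → IsPoly f →
    DegreeAtMost m G → Squarefree f → (∀ x → s x * s x * f x ≈ δ x * δ x * G x) →
    ∃[ l ] ∃[ ts ] ∃[ k ] ¬ l ≈ 0# × ¬ k ≈ 0# ×
      (∀ x → (l * rootProduct ts x) * (l * rootProduct ts x) * f x ≈ k * k * G x) ×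
      length ts ℕ.+ (length ts ℕ.+ length (proj₁ (proj₂ ff))) ≤ m
  squarefree-degree {s} {δ} {f} {G} {m} (cf , fs , cf≉0 , f≈) s-factored (k , ds , k≉0 , δ≈) ps pf dG sf eq =
    go (squarefree-quotient ds ps pf (isPoly dG) sf (λ x → trans (eq x) (*-congʳ (*-cong (δ≈ x) (δ≈ x)))))
    where
    Result : Set (c ⊔ ℓ)
    Result = ∃[ l ] ∃[ ts ] ∃[ k ] ¬ l ≈ 0# × ¬ k ≈ 0# ×
      (∀ x → (l * rootProduct ts x) * (l * rootProduct ts x) * f x ≈ k * k * G x) ×
      length ts ℕ.+ (length ts ℕ.+ length fs) ≤ m

    go : ∃[ t ] IsPoly t × (∀ x → s x ≈ rootProduct ds x * t x) × (∀ x → t x * t x * f x ≈ k * k * G x) → Result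
    go (t , pt , s≈ , t²f≈) =
      conclude (factored pt (λ t≈0 → factored≢0 s-factored λ x → trans (s≈ x) (trans (*-congˡ (t≈0 x)) (zeroʳ _))))
      where
      conclude : Factored t → Result
      conclude (l , ts , l≉0 , t≈) = l , ts , k , l≉0 , k≉0 , l²T²f≈ , square-degree ts fs l≉0 cf≉0 dG f≈ l²T²f≈
        where
        l²T²f≈ : ∀ x → (l * rootProduct ts x) * (l * rootProduct ts x) * f x ≈ k * k * G x
        l²T²f≈ x = trans (*-congʳ (*-cong (sym (t≈ x)) (sym (t≈ x)))) (t²f≈ x)

  record Reduced (p q r : Carrier → Carrier) : Set (c ⊔ ℓ) where
    field
      κ p′ q′ r′ : Carrier → Carrier
      κ-factored : Factored κ
      p′-factored : Factored p′
      q′-poly    : IsPoly q′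
      r′-poly    : IsPoly r′
      p≈         : ∀ x → p x ≈ κ x * p′ x
      q≈         : ∀ x → q x ≈ κ x * q′ x
      r≈         : ∀ x → r x ≈ κ x * r′ x
      coprime    : ∀ x → p′ x ≈ 0# → q′ x ≈ 0# → ¬ r′ x ≈ 0#

  -- Only roots of p can be common roots. Each is either divided out of all three functions or moved
  -- to `ks`, the list of roots of p at which q and r do not both vanish.
  reduce : ∀ {p q r} → Factored p → IsPoly q → IsPoly r → Reduced p q r
  reduce (k , rs , k≉0 , p≈) pq pr = go rs [] pq pr (λ x → trans (p≈ x) (*-congˡ (sym (*-identityʳ _)))) []
    where
    go : ∀ {p q r} rs ks → IsPoly q → IsPoly r → (∀ x → p x ≈ k * (rootProduct rs x * rootProduct ks x)) →
         All (λ z → ¬ (q z ≈ 0# × r z ≈ 0#)) ks → Reduced p q r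
    go {p} {q} {r} [] ks pq pr p≈ distinct = record
      { κ = λ _ → 1#
      ; κ-factored = factored-const 1≉0
      ; p′-factored = k , ks , k≉0 , λ x → trans (p≈ x) (*-congˡ (*-identityˡ _))
      ; q′-poly = pq
      ; r′-poly = pr
      ; p≈ = λ x → sym (*-identityˡ _)
      ; q≈ = λ x → sym (*-identityˡ _)
      ; r≈ = λ x → sym (*-identityˡ _)
      ; coprime = λ x px≈0 qx≈0 rx≈0 → clash distinct qx≈0 rx≈0
          (rootProduct≈0 ks (*-nonzero k≉0 (trans (sym (trans (p≈ x) (*-congˡ (*-identityˡ _)))) px≈0)))
      }
      where
      clash : ∀ {x ks} → All (λ z → ¬ (q z ≈ 0# × r z ≈ 0#)) ks → q x ≈ 0# → r x ≈ 0# → ¬ Any (x ≈_) ks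
      clash (d ∷ _) qx rx (here x≈z)   = d (trans (poly-cong pq (sym x≈z)) qx , trans (poly-cong pr (sym x≈z)) rx)
      clash (_ ∷ d) qx rx (there x∈ks) = clash d qx rx x∈ks
    go {p} {q} {r} (z ∷ rs) ks pq pr p≈ distinct with q z ≟ 0# | r z ≟ 0#
    ... | yes qz | yes rz = divide (poly-root pq qz) (poly-root pr rz)
      where
      divide : (λ x → x - z) ∣ᵖ q → (λ x → x - z) ∣ᵖ r → Reduced p q r
      divide (q₁ , pq₁ , q≈₁) (r₁ , pr₁ , r≈₁) = record
        { κ = λ x → (x - z) * R.κ x
        ; κ-factored = factored-* (factored-linear z) R.κ-factored
        ; p′-factored = R.p′-factored
        ; q′-poly = R.q′-poly
        ; r′-poly = R.r′-poly
        ; p≈ = λ x → trans (trans (p≈ x) (solve 4 (λ k y a b → k :* ((y :* a) :* b) := y :* (k :* (a :* b))) refl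
                 k (x - z) (rootProduct rs x) (rootProduct ks x))) (trans (*-congˡ (R.p≈ x)) (sym (*-assoc _ _ _)))
        ; q≈ = λ x → trans (q≈₁ x) (trans (*-congˡ (R.q≈ x)) (sym (*-assoc _ _ _)))
        ; r≈ = λ x → trans (r≈₁ x) (trans (*-congˡ (R.r≈ x)) (sym (*-assoc _ _ _)))
        ; coprime = R.coprime
        }
        where
        module R = Reduced (go {λ x → k * (rootProduct rs x * rootProduct ks x)} rs ks pq₁ pr₁ (λ _ → refl)
          -- A common zero of the quotients `q₁` and `r₁` is also one of q and r, so the invariant
          -- for `ks` survives the division.
          (All.map (λ ¬c (eq , eq′) → ¬c (trans (q≈₁ _) (trans (*-congˡ eq) (zeroʳ _)) ,
                                           trans (r≈₁ _) (trans (*-congˡ eq′) (zeroʳ _)))) distinct))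
    ... | no qz | _      = go rs (z ∷ ks) pq pr (λ x → trans (p≈ x) (move x)) ((qz ∘ proj₁) ∷ distinct)
      where
      move : ∀ x → k * (((x - z) * rootProduct rs x) * rootProduct ks x) ≈ k *
        (rootProduct rs x * ((x - z) * rootProduct ks x))
      move x = *-congˡ (trans (*-congʳ (*-comm _ _)) (*-assoc _ _ _))
    ... | _     | no rz = go rs (z ∷ ks) pq pr (λ x → trans (p≈ x) (move x)) ((rz ∘ proj₂) ∷ distinct)
      where
      move : ∀ x → k * (((x - z) * rootProduct rs x) * rootProduct ks x) ≈ k *
        (rootProduct rs x * ((x - z) * rootProduct ks x))
      move x = *-congˡ (trans (*-congʳ (*-comm _ _)) (*-assoc _ _ _))

  degree-rootProduct : ∀ rs → DegreeAtMost (length rs) (rootProduct rs)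
  degree-rootProduct []       = 1# ∷ [] , s≤s z≤n , λ x → sym (eval-constant 1# x)
  degree-rootProduct (r ∷ rs) = degree-*
    (degree-resp (λ x → +-congʳ (*-identityˡ x)) (degree-linear 1# (- r))) (degree-rootProduct rs)

  degree-weaken : ∀ {m n a} → m ≤ n → DegreeAtMost m a → DegreeAtMost n a
  degree-weaken m≤n (p , len , h) = p , ℕ.≤-trans len (s≤s m≤n) , h

  -- At ρ the left side vanishes while Q does not, so H absorbs the factor x - ρ. Cancelling it and
  -- repeating removes the whole product.
  euclid : ∀ {P Q H} rs → IsPoly P → IsPoly Q → IsPoly H → All (λ ρ → ¬ Q ρ ≈ 0#) rs →
    (∀ x → rootProduct rs x * P x ≈ Q x * H x) → Q ∣ᵖ P
  euclid {H = H} [] pP pQ pH [] eq = H , pH , λ x → trans (sym (*-identityˡ _)) (eq x)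
  euclid {P} {Q} {H} (ρ ∷ rs) pP pQ pH (Qρ≉0 ∷ Q≉0) eq =
    go (poly-root pH (*-nonzero Qρ≉0 (trans (sym (eq ρ))
      (trans (*-congʳ (trans (*-congʳ (-‿inverseʳ ρ)) (zeroˡ _))) (zeroˡ _)))))
    where
    go : (λ x → x - ρ) ∣ᵖ H → Q ∣ᵖ P
    go (H₁ , pH₁ , H≈) = euclid rs pP pQ pH₁ Q≉0
      (cancel (factored-linear ρ) (rootProductᵖ rs *ᵖ pP) (pQ *ᵖ pH₁) λ x → begin
      (x - ρ) * (rootProduct rs x * P x)  ≈⟨ *-assoc _ _ _ ⟨
      ((x - ρ) * rootProduct rs x) * P x  ≈⟨ eq x ⟩
      Q x * H x                           ≈⟨ *-congˡ (H≈ x) ⟩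
      Q x * ((x - ρ) * H₁ x)              ≈⟨ solve 3 (λ q y h → q :* (y :* h) := y :* (q :* h)) refl (Q x) (x - ρ)
        (H₁ x) ⟩
      (x - ρ) * (Q x * H₁ x)              ∎)

  -- Q has no zero in common with s, so by `euclid` it already divides a constant multiple of P; its
  -- zeros are then counted among those of P.
  divisor-degree : ∀ {s P Q m} ((_ , rs , _) : Factored s) → DegreeAtMost m P → ¬ (∀ x → P x ≈ 0#) →
    IsPoly Q → All (λ ρ → ¬ Q ρ ≈ 0#) rs → Q ∣ᵖ (λ x → s x * P x) → DegreeAtMost m Q
  divisor-degree {s} {P} {Q} {m} (k , rs , k≉0 , s≈) dP P≢0 pQ Q≉0 (H , pH , eq) =
    go (euclid {λ x → k * P x} rs (constantᵖ k *ᵖ isPoly dP) pQ pH Q≉0 λ x → trans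
      (trans (solve 3 (λ r k p → r :* (k :* p) := (k :* r) :* p) refl (rootProduct rs x) k (P x))
        (*-congʳ (sym (s≈ x)))) (eq x))
    where
    kP≢0 : ¬ (∀ x → k * P x ≈ 0#)
    kP≢0 kP≈0 = P≢0 λ x → *-nonzero k≉0 (kP≈0 x)

    go : Q ∣ᵖ (λ x → k * P x) → DegreeAtMost m Q
    go (H′ , pH′ , kP≈) = conclude (factored pQ
      (λ Q≈0 → kP≢0 λ x → trans (kP≈ x) (trans (*-congʳ (Q≈0 x)) (zeroˡ _))))
      where
      conclude : Factored Q → DegreeAtMost m Q
      conclude (q , qs , q≉0 , Q≈) = degree-resp (λ x → sym (Q≈ x)) (degree-scale q (degree-weaken
        (roots≤degree qs (degree-scale k dP) (constantᵖ q *ᵖ pH′) kP≢0 λ x → begin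
            k * P x                          ≈⟨ kP≈ x ⟩
            Q x * H′ x                       ≈⟨ *-congʳ (trans (Q≈ x) (*-comm _ _)) ⟩
            (rootProduct qs x * q) * H′ x    ≈⟨ *-assoc _ _ _ ⟩
            rootProduct qs x * (q * H′ x)    ∎)
        (degree-rootProduct qs)))

  quadratic : Carrier → Carrier → Carrier → Carrier → Carrier
  quadratic a b d τ = a * (τ * τ) + (b * τ + d)

  eval-quadratic : ∀ a b d τ → eval (d ∷ b ∷ a ∷ []) τ ≈ quadratic a b d τ
  eval-quadratic a b d τ = solve 4 (λ a b d τ →
    d :+ τ :* (b :+ τ :* (a :+ τ :* :0)) := a :* (τ :* τ) :+ (b :* τ :+ d)) refl a b d τ

  quadratic-vanishing : ∀ {a b d} → Cofinitely (λ τ → quadratic a b d τ ≈ 0#) → a ≈ 0# × b ≈ 0# × d ≈ 0#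
  quadratic-vanishing {a} {b} {d} co = p≈0 2 , p≈0 1 , p≈0 0
    where
    p≈0 : (d ∷ b ∷ a ∷ []) ≈ₚ 0ₚ
    p≈0 = eval-zero⇒≈ₚ0 (d ∷ b ∷ a ∷ []) (vanishing (poly (d ∷ b ∷ a ∷ []))
      (cofinitely-map (trans (eval-quadratic a b d _)) co))

  quadratic-cofinitely-≉0 : ∀ {a b d} → (a ≈ 0# → b ≈ 0# → ¬ d ≈ 0#) → Cofinitely (λ τ → ¬ quadratic a b d τ ≈ 0#)
  quadratic-cofinitely-≉0 {a} {b} {d} ≉0 = cofinitely-map (λ ≉0 eq → ≉0 (trans (eval-quadratic a b d _) eq))
    (cofinitely-≉0 (factored-of-≉ (d ∷ b ∷ a ∷ []) λ p≈0 → ≉0 (p≈0 2) (p≈0 1) (p≈0 0)))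

  -- A form of Gauss's lemma: a polynomial Q in x and τ that divides P over the rational
  -- functions of x, and has no factor in x alone, has degree in x at most that of P.
  gauss-degree : ∀ {s a b d m} → Factored s → IsPoly a → IsPoly b → IsPoly d →
    (∀ x → a x ≈ 0# → b x ≈ 0# → ¬ d x ≈ 0#) →
    Cofinitely (λ τ → ∃[ P ] DegreeAtMost m P × ¬ (∀ x → P x ≈ 0#) ×
      (λ x → quadratic (a x) (b x) (d x) τ) ∣ᵖ (λ x → s x * P x)) →
    DegreeAtMost m a × DegreeAtMost m b × DegreeAtMost m d
  gauss-degree {s} {a} {b} {d} {m} fs (p , a≈) (q , b≈) (r , d≈) coprime family =
    bounded p a≈ (λ k m<k → proj₁ (coeffs k m<k)) ,
    bounded q b≈ (λ k m<k → proj₁ (proj₂ (coeffs k m<k))) ,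
    bounded r d≈ (λ k m<k → proj₂ (proj₂ (coeffs k m<k)))
    where
    bounded : ∀ {a} p → (∀ x → a x ≈ eval p x) → (∀ k → m < k → coeff p k ≈ 0#) → DegreeAtMost m a
    bounded p a≈ bd = degree-resp (λ x → sym (a≈ x)) (coeff-bound⇒degree p m bd)

    Q : Carrier → Poly
    Q τ = map (τ * τ *_) p +ₚ (map (τ *_) q +ₚ r)

    eval-Q : ∀ τ x → eval (Q τ) x ≈ quadratic (a x) (b x) (d x) τ
    eval-Q τ x = trans (eval-+ₚ (map (τ * τ *_) p) (map (τ *_) q +ₚ r) x) (+-cong
      (trans (eval-scale (τ * τ) p x) (trans (*-comm _ _) (*-congʳ (sym (a≈ x)))))
      (trans (eval-+ₚ (map (τ *_) q) r x) (+-cong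
        (trans (eval-scale τ q x) (trans (*-comm _ _) (*-congʳ (sym (b≈ x))))) (sym (d≈ x)))))

    coeff-Q : ∀ τ k → coeff (Q τ) k ≈ quadratic (coeff p k) (coeff q k) (coeff r k) τ
    coeff-Q τ k = trans (coeff-+ₚ (map (τ * τ *_) p) (map (τ *_) q +ₚ r) k) (+-cong
      (trans (coeff-scale (τ * τ) p k) (*-comm _ _))
      (trans (coeff-+ₚ (map (τ *_) q) r k) (+-congʳ (trans (coeff-scale τ q k) (*-comm _ _)))))

    -- By coprimality `Q τ` vanishes at a given root of s for only finitely many τ, and s has
    -- finitely many roots. For all other τ, `divisor-degree` applies.
    degree-Q : Cofinitely (λ τ → DegreeAtMost m (eval (Q τ)))
    degree-Q = cofinitely-map
      (λ {τ} ((P , dP , P≢0 , H , pH , eq) , Q≉0) → divisor-degree fs dP P≢0 (poly (Q τ))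
        (All.map (λ ≉0 eq → ≉0 (trans (sym (eval-Q τ _)) eq)) Q≉0)
        (H , pH , λ x → trans (eq x) (*-congʳ (sym (eval-Q τ x)))))
      (cofinitely-∩ family (cofinitely-All
        {P = λ ρ τ → ¬ quadratic (a ρ) (b ρ) (d ρ) τ ≈ 0#} (λ ρ → quadratic-cofinitely-≉0 (coprime ρ))
          (proj₁ (proj₂ fs))))

    -- A fixed coefficient of `Q τ` with respect to x is a quadratic polynomial in τ. Beyond degree
    -- m it vanishes for almost all τ, hence identically.
    coeffs : ∀ k → m < k → coeff p k ≈ 0# × coeff q k ≈ 0# × coeff r k ≈ 0#
    coeffs k m<k = quadratic-vanishing (cofinitely-map
      (λ {τ} dQ → trans (sym (coeff-Q τ k)) (degree⇒coeff-bound (Q τ) m dQ k m<k)) degree-Q)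

  -- Function fields

  square-root : ∀ a → ∃[ η ] η * η ≈ a
  square-root a = root (closed (- a ∷ 0# ∷ 1# ∷ []) 1
    (1≉0 , λ { (suc (suc (suc _))) _ → refl ; (suc zero) (s≤s ()) ; (suc (suc zero)) (s≤s (s≤s ())) }))
    where
    root : ∃[ η ] eval (- a ∷ 0# ∷ 1# ∷ []) η ≈ 0# → ∃[ η ] η * η ≈ a
    root (η , eq) = η , x-y≈0⇒x≈y (trans (solve 2 (λ a η → η :* η :- a :=
      :- a :+ η :* (:0 :+ η :* (:1 :+ η :* :0))) refl a η) eq)

  -- For u = (A + By)/D with y² = f, the polynomial θ(x, τ) - θ(x, u) in τ is a multiple of τ - u,
  -- up to a denominator s that does not depend on τ.
  module Division
    {f A B D : Carrier → Carrier} (pf : IsPoly f) (pA : IsPoly A) (pB : IsPoly B)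
    (D-factored : Factored D) (pD : IsPoly D) where

    Cofactor : (Carrier → Carrier → Carrier) → (Carrier → Carrier) → Carrier → Set (c ⊔ ℓ)
    Cofactor θ s τ = ∃[ G ] ∃[ H ] IsPoly G × IsPoly H × ∀ x y μ → y * y ≈ f x → D x * μ ≈ A x + B x * y →
      s x * (θ x τ - θ x μ) ≈ (τ * D x - (A x + B x * y)) * (G x + H x * y)

    Divides : (Carrier → Carrier → Carrier) → Set (c ⊔ ℓ)
    Divides θ = ∃[ s ] Factored s × IsPoly s × ∀ τ → Cofactor θ s τ

    divides-eval : ∀ p → Divides (λ _ → eval p)
    divides-eval []      = (λ _ → 1#) , factored-const 1≉0 , constantᵖ 1# , λ τ →
      (λ _ → 0#) , (λ _ → 0#) , constantᵖ 0# , constantᵖ 0# , λ x y μ _ _ →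
      solve 2 (λ q y → :1 :* (:0 :- :0) := q :* (:0 :+ :0 :* y)) refl
        (τ * D x - (A x + B x * y)) y
    divides-eval (a ∷ p) = extend (divides-eval p)
      where
      extend : Divides (λ _ → eval p) → Divides (λ _ → eval (a ∷ p))
      extend (s , s-factored , ps , cof) = (λ x → D x * s x) , factored-* D-factored s-factored , pD *ᵖ ps , λ τ →
        step τ (cof τ)
        where
        step : ∀ τ → Cofactor (λ _ → eval p) s τ → Cofactor (λ _ → eval (a ∷ p)) (λ x → D x * s x) τ
        step τ (G , H , pG , pH , eq) =
          -- From τp(τ) - μp(μ) = p(τ)(τ - μ) + μ(p(τ) - p(μ)): the new factor D clears the
          -- denominator of μ, and y² becomes f in the product of A + By with G + Hy.
          (λ x → s x * eval p τ + (A x * G x + B x * H x * f x)) , (λ x → A x * H x + B x * G x) ,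
          ps *ᵖ constantᵖ (eval p τ) +ᵖ (pA *ᵖ pG +ᵖ pB *ᵖ pH *ᵖ pf) , pA *ᵖ pH +ᵖ pB *ᵖ pG , λ x y μ y² Dμ → begin
            D x * s x * ((a + τ * eval p τ) - (a + μ * eval p μ))
              ≈⟨ solve 7 (λ D s a τ μ p q → D :* s :* ((a :+ τ :* p) :- (a :+ μ :* q)) :=
                   s :* p :* (τ :* D :- D :* μ) :+ D :* μ :* (s :* (p :- q))) refl
                   (D x) (s x) a τ μ (eval p τ) (eval p μ) ⟩
            s x * eval p τ * (τ * D x - D x * μ) + D x * μ * (s x * (eval p τ - eval p μ))
              ≈⟨ +-cong (*-congˡ (+-congˡ (-‿cong Dμ))) (*-cong Dμ (eq x y μ y² Dμ)) ⟩
            s x * eval p τ * (τ * D x - (A x + B x * y)) + (A x + B x * y) *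
              ((τ * D x - (A x + B x * y)) * (G x + H x * y))
              ≈⟨ regroup (s x) (eval p τ) (τ * D x - (A x + B x * y)) (A x) (B x) y (G x) (H x) ⟩
            (τ * D x - (A x + B x * y)) * (s x * eval p τ + (A x * G x + B x * H x * (y * y)) +
              (A x * H x + B x * G x) * y)
              ≈⟨ *-congˡ (+-congʳ (+-congˡ (+-congˡ (*-congˡ y²)))) ⟩
            (τ * D x - (A x + B x * y)) * (s x * eval p τ + (A x * G x + B x * H x * f x) + (A x * H x + B x * G x)
              * y) ∎
          where
          regroup : ∀ s p q A B y G H → s * p * q + (A + B * y) * (q * (G + H * y)) ≈
            q * (s * p + (A * G + B * H * (y * y)) + (A * H + B * G) * y)
          regroup = solve 8 (λ s p q A B y G H → s :* p :* q :+ (A :+ B :* y) :* (q :* (G :+ H :* y)) :=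
            q :* (s :* p :+ (A :* G :+ B :* H :* (y :* y)) :+ (A :* H :+ B :* G) :* y)) refl

    divides-* : ∀ {k θ} → IsPoly k → Divides θ → Divides (λ x τ → k x * θ x τ)
    divides-* {k} {θ} pk (s , s-factored , ps , cof) = s , s-factored , ps , λ τ → step τ (cof τ)
      where
      step : ∀ τ → Cofactor θ s τ → Cofactor (λ x τ → k x * θ x τ) s τ
      step τ (G , H , pG , pH , eq) = (λ x → k x * G x) , (λ x → k x * H x) , pk *ᵖ pG , pk *ᵖ pH , λ x y μ y² Dμ →
        trans (solve 4 (λ s k p q → s :* (k :* p :- k :* q) := k :* (s :* (p :- q))) refl (s x) (k x) (θ x τ) (θ x μ))
        (trans (*-congˡ (eq x y μ y² Dμ))
        (solve 5 (λ k q G H y → k :* (q :* (G :+ H :* y)) := q :* (k :* G :+ k :* H :* y)) refl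
          (k x) (τ * D x - (A x + B x * y)) (G x) (H x) y))

    divides-+ : ∀ {θ ψ} → Divides θ → Divides ψ → Divides (λ x τ → θ x τ + ψ x τ)
    divides-+ {θ} {ψ} (s , s-factored , ps , cof) (t , t-factored , pt , cof′) =
      (λ x → s x * t x) , factored-* s-factored t-factored , ps *ᵖ pt , λ τ → step τ (cof τ) (cof′ τ)
      where
      step : ∀ τ → Cofactor θ s τ → Cofactor ψ t τ → Cofactor (λ x τ → θ x τ + ψ x τ) (λ x → s x * t x) τ
      step τ (G , H , pG , pH , eq) (G′ , H′ , pG′ , pH′ , eq′) =
        (λ x → t x * G x + s x * G′ x) , (λ x → t x * H x + s x * H′ x) ,
        pt *ᵖ pG +ᵖ ps *ᵖ pG′ , pt *ᵖ pH +ᵖ ps *ᵖ pH′ , λ x y μ y² Dμ →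
          trans (solve 6 (λ s t p q p′ q′ → s :* t :* ((p :+ p′) :- (q :+ q′)) := t :* (s :* (p :- q)) :+ s :*
            (t :* (p′ :- q′)))
                  refl (s x) (t x) (θ x τ) (θ x μ) (ψ x τ) (ψ x μ))
          (trans (+-cong (*-congˡ (eq x y μ y² Dμ)) (*-congˡ (eq′ x y μ y² Dμ)))
          (regroup (s x) (t x) (τ * D x - (A x + B x * y)) (G x) (H x) (G′ x) (H′ x) y))
        where
        regroup : ∀ s t q G H G′ H′ y → t * (q * (G + H * y)) + s * (q * (G′ + H′ * y)) ≈
          q * ((t * G + s * G′) + (t * H + s * H′) * y)
        regroup = solve 8 (λ s t q G H G′ H′ y → t :* (q :* (G :+ H :* y)) :+ s :* (q :* (G′ :+ H′ :* y)) :=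
          q :* ((t :* G :+ s :* G′) :+ (t :* H :+ s :* H′) :* y)) refl

    divides-poly : ∀ {a} → IsPoly a → Divides (λ _ → a)
    divides-poly {a} (p , a≈) = convert (divides-eval p)
      where
      convert : Divides (λ _ → eval p) → Divides (λ _ → a)
      convert (s , s-factored , ps , cof) = s , s-factored , ps , λ τ → step τ (cof τ)
        where
        step : ∀ τ → Cofactor (λ _ → eval p) s τ → Cofactor (λ _ → a) s τ
        step τ (G , H , pG , pH , eq) = G , H , pG , pH , λ x y μ y² Dμ →
          trans (*-congˡ (-‿cong₂ (a≈ τ) (a≈ μ))) (eq x y μ y² Dμ)

  poly-dichotomy : ∀ {a} → IsPoly a → (Factored a → ∀ x → a x ≈ 0#) → ∀ x → a x ≈ 0#
  poly-dichotomy pa h with zeroOrFactored pa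
  ... | inj₁ a≈0 = a≈0
  ... | inj₂ fa  = h fa

  factored-poly : ∀ {a} → Factored a → IsPoly a
  factored-poly (k , rs , _ , h) = linearProduct k rs , λ x → trans (h x) (sym (eval-linearProduct k rs x))

  linear-coefficients : ∀ {a} → DegreeAtMost 1 a → ∃[ m ] ∃[ n ] ∀ x → a x ≈ m * x + n
  linear-coefficients ([]              , _ , h) = 0# , 0# , λ x → trans (h x) (sym (trans (+-identityʳ _) (zeroˡ x)))
  linear-coefficients (n ∷ []          , _ , h) = 0# , n , λ x → trans (h x)
    (solve 2 (λ n x → n :+ x :* :0 := :0 :* x :+ n) refl n x)
  linear-coefficients (n ∷ m ∷ []      , _ , h) = m , n , λ x → trans (h x)
    (solve 3 (λ n m x → n :+ x :* (m :+ x :* :0) := m :* x :+ n) refl n m x)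
  linear-coefficients (_ ∷ _ ∷ _ ∷ _ , s≤s (s≤s ()) , _)

  proportional : ∀ {x z x′ z′} → ¬ (x ≈ 0# × z ≈ 0#) → x′ * z - z′ * x ≈ 0# → ∃[ k ] k * x ≈ x′ × k * z ≈ z′
  proportional {x} {z} {x′} {z′} ≢0 det≈0 with x ≟ 0# | z ≟ 0#
  ... | yes x≈0 | yes z≈0 = contradiction (x≈0 , z≈0) ≢0
  ... | no x≉0  | _       = scale (inverse x x≉0)
    where
    scale : ∃[ i ] x * i ≈ 1# → ∃[ k ] k * x ≈ x′ × k * z ≈ z′
    scale (i , xi≈1) = x′ * i ,
      trans (solve 3 (λ a b c → a :* b :* c := (c :* b) :* a) refl x′ i x) (trans (*-congʳ xi≈1) (*-identityˡ x′)) ,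
      trans (solve 3 (λ a b c → a :* b :* c := b :* (a :* c)) refl x′ i z)
        (trans (*-congˡ (x-y≈0⇒x≈y det≈0)) (trans (solve 3 (λ a b c → b :* (a :* c) := (c :* b) :* a) refl z′ i x)
          (trans (*-congʳ xi≈1) (*-identityˡ z′))))
  ... | yes _   | no z≉0  = scale (inverse z z≉0)
    where
    scale : ∃[ i ] z * i ≈ 1# → ∃[ k ] k * x ≈ x′ × k * z ≈ z′
    scale (i , zi≈1) = z′ * i ,
      trans (solve 3 (λ a b c → a :* b :* c := b :* (a :* c)) refl z′ i x)
        (trans (*-congˡ (sym (x-y≈0⇒x≈y det≈0)))
          (trans (solve 3 (λ a b c → b :* (a :* c) := (c :* b) :* a) refl x′ i z)
          (trans (*-congʳ zi≈1) (*-identityˡ x′)))) ,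
      trans (solve 3 (λ a b c → a :* b :* c := (c :* b) :* a) refl z′ i z) (trans (*-congʳ zi≈1) (*-identityˡ z′))

  2# : Carrier
  2# = 1# + 1#

  -- P holds at all but finitely many points (ρ , η) of the curve y² = f.
  Generically : ∀ {a} → (Carrier → Carrier) → (Carrier → Carrier → Set a) → Set (a ⊔ c ⊔ ℓ)
  Generically f P = Cofinitely λ ρ → ∀ η → η * η ≈ f ρ → P ρ η

  -- The images u = (A + By)/D and w = (α + βy)/δ of x and y under an isomorphism from the function field of
  -- y² = h to that of y² = f, together with preimages of x and y, evaluated at the points (ρ , η) of y² = f.
  record Correspondence (f h : Carrier → Carrier) : Set (c ⊔ ℓ) where
    field
      A B D α β δ Aˣ Bˣ Dˣ Aʸ Bʸ Dʸ : Carrier → Carrier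
      A-poly    : IsPoly A
      B-poly    : IsPoly B
      D-poly    : IsPoly D
      α-poly    : IsPoly α
      β-poly    : IsPoly β
      δ-poly    : IsPoly δ
      Aˣ-poly   : IsPoly Aˣ
      Bˣ-poly   : IsPoly Bˣ
      Dˣ-poly   : IsPoly Dˣ
      Aʸ-poly  : IsPoly Aʸ
      Bʸ-poly  : IsPoly Bʸ
      Dʸ-poly  : IsPoly Dʸ
      D-factored   : Factored D
      δ-factored   : Factored δ
      Dˣ-factored  : Factored Dˣ
      Dʸ-factored : Factored Dʸ
      μ ω : Carrier → Carrier → Carrier
      μ-eq : Generically f λ ρ η → D ρ * μ ρ η ≈ A ρ + B ρ * η
      ω-eq : Generically f λ ρ η → δ ρ * ω ρ η ≈ α ρ + β ρ * η
      curve : Generically f λ ρ η → ω ρ η * ω ρ η ≈ h (μ ρ η)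
      x-preimage : Generically f λ ρ η → Dˣ (μ ρ η) * ρ ≈ Aˣ (μ ρ η) + Bˣ (μ ρ η) * ω ρ η
      y-preimage : Generically f λ ρ η → Dʸ (μ ρ η) * η ≈ Aʸ (μ ρ η) + Bʸ (μ ρ η) * ω ρ η
      transcendental : ∀ τ → Generically f λ ρ η → ¬ μ ρ η ≈ τ

  -- The image of y will turn out to be (β/δ)y. Only the square of this relation is recorded, so
  -- that y is eliminated and everything is a statement about x.
  record Möbius (f h : Carrier → Carrier) : Set (c ⊔ ℓ) where
    field
      m₁ m₂ m₃ m₄ : Carrier
      det≉0 : ¬ m₁ * m₄ - m₂ * m₃ ≈ 0#
      β δ : Carrier → Carrier
      β-poly : IsPoly β
      δ-poly : IsPoly δ
      β-factored : Factored β
      δ-factored : Factored δ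
      points : Cofinitely λ ρ → ∃[ μ ] (m₃ * ρ + m₄) * μ ≈ m₁ * ρ + m₂ × β ρ * β ρ * f ρ ≈ δ ρ * δ ρ * h μ

  -- Isomorphisms act on x by Möbius transformations.

  module HyperellipticMaps
    {f h : Carrier → Carrier} (2≉0 : ¬ 2# ≈ 0#) (f-poly : IsPoly f) (h-poly : IsPoly h)
    (f-factored : Factored f) (f-squarefree : Squarefree f)
    (5≤degree : 5 ≤ length (proj₁ (proj₂ f-factored))) (C : Correspondence f h) where
    open Correspondence C
    open Division f-poly A-poly B-poly D-factored D-poly

    -- Each of the finitely many zeros of q is avoided generically by transcendence.
    μ-avoids : ∀ {q} → Factored q → Generically f λ ρ η → ¬ q (μ ρ η) ≈ 0#
    μ-avoids (k , rs , k≉0 , q≈) = cofinitely-map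
      (λ ≉rs η η² eq → *≉0 k≉0 (avoids-rootProduct rs _ (All.map (λ h → h η η²) ≉rs)) (trans (sym (q≈ _)) eq))
      (cofinitely-All {P = λ τ ρ → ∀ η → η * η ≈ f ρ → ¬ μ ρ η ≈ τ} transcendental rs)

    η≉0 : Generically f λ ρ η → ¬ η ≈ 0#
    η≉0 = cofinitely-map (λ fρ≉0 η η² η≈0 → fρ≉0 (trans (sym η²) (trans (*-congʳ η≈0) (zeroˡ _))))
      (cofinitely-≉0 f-factored)

    neg² : ∀ {y z} → y * y ≈ z → (- y) * (- y) ≈ z
    neg² {y} eq = trans (solve 1 (λ y → (:- y) :* (:- y) := y :* y) refl y) eq

    -- The quadratic equation of x over K(u), with τ in place of u: the expansion of (Dˣx - Aˣ)² -
    -- (Bˣ)²h, the norm of Dˣx - Aˣ - Bˣw. It is written as a sum of products to suit `divides-+`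
    -- and `divides-*`.
    quadratic-in-x : Carrier → Carrier → Carrier
    quadratic-in-x x τ = x * x * (Dˣ τ * Dˣ τ) + (x * (- 2# * (Dˣ τ * Aˣ τ)) + 1# * (Aˣ τ * Aˣ τ - Bˣ τ * Bˣ τ * h τ))

    quadratic-in-x-list : Carrier → Poly
    quadratic-in-x-list τ = (Aˣ τ * Aˣ τ - Bˣ τ * Bˣ τ * h τ) ∷ - 2# * (Dˣ τ * Aˣ τ) ∷ Dˣ τ * Dˣ τ ∷ []

    quadratic-in-x-eval : ∀ τ x → quadratic-in-x x τ ≈ eval (quadratic-in-x-list τ) x
    quadratic-in-x-eval τ x = solve 4 (λ x p q r → x :* x :* p :+ (x :* q :+ :1 :* r) :=
      r :+ x :* (q :+ x :* (p :+ x :* :0))) refl x (Dˣ τ * Dˣ τ) (- 2# * (Dˣ τ * Aˣ τ))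
        (Aˣ τ * Aˣ τ - Bˣ τ * Bˣ τ * h τ)

    quadratic-in-x-divides : Divides quadratic-in-x
    quadratic-in-x-divides = divides-+ (divides-* (identityᵖ *ᵖ identityᵖ) (divides-poly (Dˣ-poly *ᵖ Dˣ-poly)))
      (divides-+ (divides-* identityᵖ (divides-poly (constantᵖ (- 2#) *ᵖ (Dˣ-poly *ᵖ Aˣ-poly))))
        (divides-* (constantᵖ 1#) (divides-poly (Aˣ-poly *ᵖ Aˣ-poly -ᵖ Bˣ-poly *ᵖ Bˣ-poly *ᵖ h-poly))))

    quadratic-in-x-vanishes : Generically f λ ρ η → quadratic-in-x ρ (μ ρ η) ≈ 0#
    quadratic-in-x-vanishes = cofinitely-map (λ (pre , cur) η η² → vanish (pre η η²) (cur η η²))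
      (cofinitely-∩ x-preimage curve)
      where
      vanish : ∀ {ρ m w} → Dˣ m * ρ ≈ Aˣ m + Bˣ m * w → w * w ≈ h m → quadratic-in-x ρ m ≈ 0#
      vanish {ρ} {m} {w} pre cur = begin
        quadratic-in-x ρ m
          ≈⟨ solve 5 (λ x D A B h → x :* x :* (D :* D) :+ (x :* (:- :2 :* (D :* A)) :+ :1 :* (A :* A :- B :* B :* h))
               := (D :* x :- A) :* (D :* x :- A) :- B :* B :* h) refl ρ (Dˣ m) (Aˣ m) (Bˣ m) (h m) ⟩
        (Dˣ m * ρ - Aˣ m) * (Dˣ m * ρ - Aˣ m) - Bˣ m * Bˣ m * h m
          ≈⟨ -‿cong₂ (*-cong (+-congʳ pre) (+-congʳ pre)) (*-congˡ (sym cur)) ⟩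
        ((Aˣ m + Bˣ m * w) - Aˣ m) * ((Aˣ m + Bˣ m * w) - Aˣ m) - Bˣ m * Bˣ m * (w * w)
          ≈⟨ solve 3 (λ A B w → ((A :+ B :* w) :- A) :* ((A :+ B :* w) :- A) :- B :* B :* (w :* w) := :0) refl
            (Aˣ m) (Bˣ m) w ⟩
        0# ∎

    -- D² times the norm of τ - u, that is (τD - A)² - B²f.
    norm : Carrier → Carrier → Carrier
    norm τ x = quadratic (D x * D x) (- 2# * (A x * D x)) (A x * A x - B x * B x * f x) τ

    -- Since θ(x, u) = 0, the cofactor identity reads sθ(x, τ) = (τD - A - By)(G + Hy).
    -- Multiplication by the conjugate τD - A + By turns the right side into the norm times G + Hy.
    -- The coefficients of y then give sBθ = norm · H, which explains the factor B. They are
    -- extracted as the difference of the values at y and -y, divided by 2y.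
    norm-divides : ∀ {θ} → ((s , _) : Divides θ) → (∀ τ → IsPoly (λ x → θ x τ)) →
      (Generically f λ ρ η → θ ρ (μ ρ η) ≈ 0#) →
      ∀ τ → norm τ ∣ᵖ (λ x → s x * B x * θ x τ)
    norm-divides {θ} (s , s-factored , ps , cof) pθ θ≈0 τ = go (cof τ)
      where
      go : Cofactor θ s τ → norm τ ∣ᵖ (λ x → s x * B x * θ x τ)
      go (G , H , pG , pH , eq) = H , pH , agree (ps *ᵖ B-poly *ᵖ pθ τ)
        (((D-poly *ᵖ D-poly) *ᵖ constantᵖ (τ * τ) +ᵖ (constantᵖ (- 2#) *ᵖ (A-poly *ᵖ D-poly) *ᵖ constantᵖ τ +ᵖ
          (A-poly *ᵖ A-poly -ᵖ B-poly *ᵖ B-poly *ᵖ f-poly))) *ᵖ pH)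
        (cofinitely-map (λ (θ≈0 , μ≈ , η≉0) → at-point θ≈0 μ≈ η≉0) (cofinitely-∩ θ≈0 (cofinitely-∩ μ-eq η≉0)))
        where
        at-root : ∀ {x} → (∀ η → η * η ≈ f x → θ x (μ x η) ≈ 0#) → (∀ η → η * η ≈ f x → D x * μ x η ≈ A x + B x * η) →
          ∀ y → y * y ≈ f x → s x * θ x τ ≈ (τ * D x - (A x + B x * y)) * (G x + H x * y)
        at-root {x} θ≈0 μ≈ y y² = trans (*-congˡ (trans (sym (x-0≈x _)) (+-congˡ (-‿cong (sym (θ≈0 y y²))))))
          (eq x y (μ x y) y² (μ≈ y y²))

        conjugate : ∀ {k T A B D G H y f} → y * y ≈ f →
          k ≈ (T * D - (A + B * y)) * (G + H * y) → k ≈ (T * D - (A + B * - y)) * (G + H * - y) →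
          2# * y * (k * B) ≈ 2# * y * ((D * D * (T * T) + (- 2# * (A * D) * T + (A * A - B * B * f))) * H)
        conjugate {k} {T} {A} {B} {D} {G} {H} {y} {f} y² eq₁ eq₂ = begin
          2# * y * (k * B)
            ≈⟨ solve 5 (λ k y b n d → :2 :* y :* (k :* b) :=
                 k :* (n :+ b :* y) :- k :* (n :- b :* y)) refl k y B (T * D - A) D ⟩
          k * ((T * D - A) + B * y) - k * ((T * D - A) - B * y)
            ≈⟨ -‿cong₂ (*-congʳ eq₁) (*-congʳ eq₂) ⟩
          (T * D - (A + B * y)) * (G + H * y) * ((T * D - A) + B * y) - (T * D - (A + B * - y)) * (G + H * - y) *
            ((T * D - A) - B * y)
            ≈⟨ solve 7 (λ T D A B y G H →
                 (T :* D :- (A :+ B :* y)) :* (G :+ H :* y) :* ((T :* D :- A) :+ B :* y) :-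
                   (T :* D :- (A :+ B :* :- y)) :* (G :+ H :* :- y) :* ((T :* D :- A) :- B :* y)
                 := :2 :* y :* ((D :* D :* (T :* T) :+ (:- :2 :* (A :* D) :* T :+ (A :* A :- B :* B :* (y :* y))))
                   :* H))
                 refl T D A B y G H ⟩
          2# * y * ((D * D * (T * T) + (- 2# * (A * D) * T + (A * A - B * B * (y * y)))) * H)
            ≈⟨ *-congˡ (*-congʳ (+-congˡ (+-congˡ (+-congˡ (-‿cong (*-congˡ y²)))))) ⟩
          2# * y * ((D * D * (T * T) + (- 2# * (A * D) * T + (A * A - B * B * f))) * H) ∎

        at-point : ∀ {x} → (∀ η → η * η ≈ f x → θ x (μ x η) ≈ 0#) →
          (∀ η → η * η ≈ f x → D x * μ x η ≈ A x + B x * η) →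
          (∀ η → η * η ≈ f x → ¬ η ≈ 0#) →
          s x * B x * θ x τ ≈ norm τ x * H x
        at-point {x} θ≈0 μ≈ η≉0 = with-root (square-root (f x))
          where
          with-root : ∃[ η ] η * η ≈ f x → s x * B x * θ x τ ≈ norm τ x * H x
          with-root (η , η²) = trans (trans (*-assoc _ _ _) (trans (*-congˡ (*-comm _ _)) (sym (*-assoc _ _ _))))
            (*-cancelˡ (*≉0 2≉0 (η≉0 η η²)) (conjugate η² (at-root θ≈0 μ≈ η η²) (at-root θ≈0 μ≈ (- η) (neg² η²))))

    sqD-factored : Factored (λ x → D x * D x)
    sqD-factored = factored-* D-factored D-factored

    -- If B ≠ 0, then x and u satisfy a polynomial equation of bidegree (2, 2), whose discriminant in u has
    -- degree at most 4 and equals f up to squares; but f is squarefree of degree at least 5.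
    B-not-factored : ¬ Factored B
    B-not-factored B-factored = reduced (reduce sqD-factored (constantᵖ (- 2#) *ᵖ (A-poly *ᵖ D-poly))
      (A-poly *ᵖ A-poly -ᵖ B-poly *ᵖ B-poly *ᵖ f-poly))
      where
      reduced : ¬ Reduced (λ x → D x * D x) (λ x → - 2# * (A x * D x)) (λ x → A x * A x - B x * B x * f x)
      reduced R = too-small (gauss-degree (factored-* (proj₁ (proj₂ quadratic-in-x-divides)) B-factored)
        p′-poly q′-poly r′-poly coprime family)
        where
        open Reduced R
        s = proj₁ quadratic-in-x-divides

        p′-poly : IsPoly p′
        p′-poly = factored-poly p′-factored

        Q : Carrier → Carrier → Carrier
        Q τ x = quadratic (p′ x) (q′ x) (r′ x) τ

        divisible : ∀ τ → norm τ ∣ᵖ (λ x → s x * B x * quadratic-in-x x τ) → Q τ ∣ᵖ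
          (λ x → s x * B x * quadratic-in-x x τ)
        divisible τ (H , pH , eq) = (λ x → κ x * H x) , factored-poly κ-factored *ᵖ pH , λ x → trans (eq x)
          (trans (*-congʳ (+-cong (*-congʳ (p≈ x)) (+-cong (*-congʳ (q≈ x)) (r≈ x))))
          (solve 6 (λ κ p q r τ H → (κ :* p :* (τ :* τ) :+ (κ :* q :* τ :+ κ :* r)) :* H :=
            (p :* (τ :* τ) :+ (q :* τ :+ r)) :* (κ :* H))
            refl (κ x) (p′ x) (q′ x) (r′ x) τ (H x)))

        family : Cofinitely (λ τ → ∃[ P ] DegreeAtMost 2 P × ¬ (∀ x → P x ≈ 0#) × Q τ ∣ᵖ (λ x → s x * B x * P x))
        -- The zeros τ of Dˣ are excluded, so that the coefficient Dˣ(τ)² of x² survives and P is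
        -- not zero.
        family = cofinitely-map (λ {τ} Dτ≉0 → member τ Dτ≉0 (divisible τ
            (norm-divides quadratic-in-x-divides (λ τ → poly-resp (λ x → sym (quadratic-in-x-eval τ x))
              (poly (quadratic-in-x-list τ)))
              quadratic-in-x-vanishes τ))) (cofinitely-≉0 Dˣ-factored)
          where
          member : ∀ τ → ¬ Dˣ τ ≈ 0# → Q τ ∣ᵖ (λ x → s x * B x * quadratic-in-x x τ) →
            ∃[ P ] DegreeAtMost 2 P × ¬ (∀ x → P x ≈ 0#) × Q τ ∣ᵖ (λ x → s x * B x * P x)
          member τ Dτ≉0 divides = (λ x → quadratic-in-x x τ) ,
            (quadratic-in-x-list τ , ℕ.≤-refl , quadratic-in-x-eval τ) ,
            (λ P≈0 → *≉0 Dτ≉0 Dτ≉0 (eval-zero⇒≈ₚ0 (quadratic-in-x-list τ)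
              (λ x → trans (sym (quadratic-in-x-eval τ x)) (P≈0 x)) 2)) , divides

        -- As a polynomial in τ, the norm has the roots (A ± By)/D and leading coefficient D², hence
        -- discriminant (2DB)²f. Division by the common factor κ divides the discriminant by κ².
        discriminant-eq : ∀ x → (2# * D x * B x) * (2# * D x * B x) * f x ≈ κ x * κ x *
          (q′ x * q′ x - (2# * 2#) * (p′ x * r′ x))
        discriminant-eq x = begin
          (2# * D x * B x) * (2# * D x * B x) * f x
            ≈⟨ solve 4 (λ A B D f → (:2 :* D :* B) :* (:2 :* D :* B) :* f :=
                 (:- :2 :* (A :* D)) :* (:- :2 :* (A :* D)) :- (:2 :* :2) :* ((D :* D) :* (A :* A :- B :* B :* f)))
                   refl (A x) (B x) (D x) (f x) ⟩
          (- 2# * (A x * D x)) * (- 2# * (A x * D x)) - (2# * 2#) * ((D x * D x) * (A x * A x - B x * B x * f x))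
            ≈⟨ -‿cong₂ (*-cong (q≈ x) (q≈ x)) (*-congˡ (*-cong (p≈ x) (r≈ x))) ⟩
          (κ x * q′ x) * (κ x * q′ x) - (2# * 2#) * ((κ x * p′ x) * (κ x * r′ x))
            ≈⟨ solve 4 (λ k p q r → (k :* q) :* (k :* q) :- (:2 :* :2) :* ((k :* p) :* (k :* r)) :=
                 k :* k :* (q :* q :- (:2 :* :2) :* (p :* r))) refl (κ x) (p′ x) (q′ x) (r′ x) ⟩
          κ x * κ x * (q′ x * q′ x - (2# * 2#) * (p′ x * r′ x)) ∎

        too-small : ¬ (DegreeAtMost 2 p′ × DegreeAtMost 2 q′ × DegreeAtMost 2 r′)
        too-small (dp , dq , dr) = contradict (squarefree-degree f-factored
          (factored-* (factored-* (factored-const 2≉0) D-factored) B-factored) κ-factored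
          (constantᵖ 2# *ᵖ D-poly *ᵖ B-poly) f-poly
          (degree-sub (degree-* dq dq) (degree-scale (2# * 2#) (degree-* dp dr))) f-squarefree discriminant-eq)
          where
          contradict : ¬ (∃[ l ] ∃[ ts ] ∃[ k ] ¬ l ≈ 0# × ¬ k ≈ 0# ×
            (∀ x → (l * rootProduct ts x) * (l * rootProduct ts x) * f x ≈ k * k *
              (q′ x * q′ x - (2# * 2#) * (p′ x * r′ x))) ×
            length ts ℕ.+ (length ts ℕ.+ length (proj₁ (proj₂ f-factored))) ≤ 4)
          contradict (_ , ts , _ , _ , _ , _ , len) = ℕ.<-irrefl ≡.refl (ℕ.≤-trans 5≤degree
            (ℕ.≤-trans (ℕ.m≤n+m _ (length ts)) (ℕ.≤-trans (ℕ.m≤n+m _ (length ts)) len)))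

    B≈0 : ∀ x → B x ≈ 0#
    B≈0 = poly-dichotomy B-poly (⊥-elim ∘ B-not-factored)

    μ≈A/D : Generically f λ ρ η → D ρ * μ ρ η ≈ A ρ
    μ≈A/D = cofinitely-map (λ {ρ} eq η η² → trans (eq η η²)
      (trans (+-congˡ (trans (*-congʳ (B≈0 ρ)) (zeroˡ η))) (+-identityʳ _))) μ-eq

    -- Since u does not involve y, it takes the same value at (ρ , η) and (ρ , -η).
    μ-even : Generically f λ ρ η → μ ρ (- η) ≈ μ ρ η
    μ-even = cofinitely-map (λ (eq , Dρ≉0) η η² → *-cancelˡ Dρ≉0 (trans (eq (- η) (neg² η²)) (sym (eq η η²))))
      (cofinitely-∩ μ≈A/D (cofinitely-≉0 D-factored))

    -- Every ρ lies below some point of the curve, because f(ρ) has a square root. A contradiction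
    -- at all generic points is therefore a contradiction.
    impossible : ¬ Cofinitely (λ ρ → ∀ η → ¬ η * η ≈ f ρ)
    impossible co = at (cofinitely-witness co)
      where
      at : ¬ (∃[ ρ ] ∀ η → ¬ η * η ≈ f ρ)
      at (ρ , none) = none (proj₁ (square-root (f ρ))) (proj₂ (square-root (f ρ)))

    y≈-y⇒y≈0 : ∀ {y} → y ≈ - y → y ≈ 0#
    y≈-y⇒y≈0 {y} eq = *-nonzero 2≉0 (trans (solve 1 (λ y → :2 :* y := y :- (:- y)) refl y) (x≈y⇒x-y≈0 eq))

    Conjugate : Carrier → Carrier → Carrier → Carrier → Set ℓ
    Conjugate ρ η w w′ = δ ρ * w ≈ α ρ + β ρ * η × δ ρ * w′ ≈ α ρ + β ρ * - η × ¬ δ ρ ≈ 0# × ¬ η ≈ 0#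

    conjugates : Generically f λ ρ η → Conjugate ρ η (ω ρ η) (ω ρ (- η))
    conjugates = cofinitely-map (λ (eq , δρ≉0 , ≉0) η η² → eq η η² , eq (- η) (neg² η²) , δρ≉0 , ≉0 η η²)
      (cofinitely-∩ ω-eq (cofinitely-∩ (cofinitely-≉0 δ-factored) η≉0))

    -- If β were 0, both u and w would take the same values at (ρ , η) and (ρ , -η). So would y,
    -- which is a function of u and w; but y changes sign.
    β-is-factored : Factored β
    β-is-factored = factored β-poly λ β≈0 → impossible (cofinitely-map
      (λ {ρ} (conj , even , pre , Dm≉0) η η² → at β≈0 (conj η η²) (even η η²) (pre η η²) (pre (- η) (neg² η²))
        (Dm≉0 η η²))
      (cofinitely-∩ conjugates (cofinitely-∩ μ-even (cofinitely-∩ y-preimage (μ-avoids Dʸ-factored)))))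
      where
      at : (∀ x → β x ≈ 0#) → ∀ {ρ η m m′ w w′} →
        Conjugate ρ η w w′ → m′ ≈ m →
        Dʸ m * η ≈ Aʸ m + Bʸ m * w → Dʸ m′ * - η ≈ Aʸ m′ + Bʸ m′ * w′ → ¬ Dʸ m ≈ 0# → ⊥
      at β≈0 {ρ} {η} {m} {m′} {w} {w′} (eq , eq′ , δ≉0 , η≉0) m′≈m pre pre′ Dm≉0 =
        η≉0 (y≈-y⇒y≈0 (*-cancelˡ Dm≉0 (begin
          Dʸ m * η            ≈⟨ pre ⟩
          Aʸ m + Bʸ m * w     ≈⟨ +-cong (poly-cong Aʸ-poly (sym m′≈m)) (*-cong (poly-cong Bʸ-poly (sym m′≈m)) w≈w′) ⟩
          Aʸ m′ + Bʸ m′ * w′  ≈⟨ pre′ ⟨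
          Dʸ m′ * - η         ≈⟨ *-congʳ (poly-cong Dʸ-poly m′≈m) ⟩
          Dʸ m * - η          ∎)))
        where
        w≈w′ : w ≈ w′
        w≈w′ = *-cancelˡ δ≉0 (trans (trans eq (+-congˡ (trans (*-congʳ (β≈0 ρ)) (zeroˡ η))))
          (sym (trans eq′ (+-congˡ (trans (*-congʳ (β≈0 ρ)) (zeroˡ (- η)))))))

    -- Both x and u are unchanged by η ↦ -η. If Bˣ were not 0, then w could be solved for in terms
    -- of x and u and would be unchanged too, against β ≠ 0.
    Bˣ≈0 : ∀ x → Bˣ x ≈ 0#
    Bˣ≈0 = poly-dichotomy Bˣ-poly λ Bˣ-factored → ⊥-elim (impossible (cofinitely-map
      (λ {ρ} (conj , even , pre , Bm≉0 , βρ≉0) η η² → at βρ≉0 (conj η η²) (even η η²) (pre η η²)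
        (pre (- η) (neg² η²)) (Bm≉0 η η²))
      (cofinitely-∩ conjugates (cofinitely-∩ μ-even
        (cofinitely-∩ x-preimage (cofinitely-∩ (μ-avoids Bˣ-factored) (cofinitely-≉0 β-is-factored)))))))
      where
      at : ∀ {ρ η m m′ w w′} → ¬ β ρ ≈ 0# →
        Conjugate ρ η w w′ → m′ ≈ m →
        Dˣ m * ρ ≈ Aˣ m + Bˣ m * w → Dˣ m′ * ρ ≈ Aˣ m′ + Bˣ m′ * w′ → ¬ Bˣ m ≈ 0# → ⊥
      at {ρ} {η} {m} {m′} {w} {w′} βρ≉0 (eq , eq′ , δ≉0 , η≉0) m′≈m pre pre′ Bm≉0 =
        η≉0 (y≈-y⇒y≈0 (*-cancelˡ βρ≉0 (+-cancelˡ (α ρ) _ _ (trans (sym eq) (trans (*-congˡ w≈w′) eq′)))))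
        where
        w≈w′ : w ≈ w′
        w≈w′ = *-cancelˡ Bm≉0 (+-cancelˡ (Aˣ m) _ _ (begin
          Aˣ m + Bˣ m * w     ≈⟨ pre ⟨
          Dˣ m * ρ            ≈⟨ *-congʳ (poly-cong Dˣ-poly (sym m′≈m)) ⟩
          Dˣ m′ * ρ           ≈⟨ pre′ ⟩
          Aˣ m′ + Bˣ m′ * w′  ≈⟨ +-cong (poly-cong Aˣ-poly m′≈m) (*-congʳ (poly-cong Bˣ-poly m′≈m)) ⟩
          Aˣ m + Bˣ m * w′    ∎))

    -- As w² = h(u) is even in η, so is (α + βη)², and the odd part 2αβη of this square must vanish.
    α≈0 : ∀ x → α x ≈ 0#
    α≈0 = vanishing α-poly (cofinitely-map (λ {ρ} (conj , even , cur , βρ≉0) → at-root βρ≉0 conj even cur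
      (square-root (f ρ)))
      (cofinitely-∩ conjugates (cofinitely-∩ μ-even (cofinitely-∩ curve (cofinitely-≉0 β-is-factored)))))
      where
      at : ∀ {ρ η m m′ w w′} → ¬ β ρ ≈ 0# →
        Conjugate ρ η w w′ → m′ ≈ m →
        w * w ≈ h m → w′ * w′ ≈ h m′ → α ρ ≈ 0#
      at {ρ} {η} {m} {m′} {w} {w′} βρ≉0 (eq , eq′ , δ≉0 , η≉0) m′≈m cur cur′ =
        *-nonzero (*≉0 (*≉0 2≉0 2≉0) (*≉0 βρ≉0 η≉0)) (begin
          (2# * 2#) * (β ρ * η) * α ρ
            ≈⟨ solve 3 (λ a b y → (:2 :* :2) :* (b :* y) :* a :=
                 (a :+ b :* y) :* (a :+ b :* y) :- (a :+ b :* :- y) :* (a :+ b :* :- y)) refl (α ρ) (β ρ) η ⟩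
          (α ρ + β ρ * η) * (α ρ + β ρ * η) - (α ρ + β ρ * - η) * (α ρ + β ρ * - η)
            ≈⟨ -‿cong₂ (*-cong eq eq) (*-cong eq′ eq′) ⟨
          (δ ρ * w) * (δ ρ * w) - (δ ρ * w′) * (δ ρ * w′)
            ≈⟨ solve 3 (λ d w v → (d :* w) :* (d :* w) :- (d :* v) :* (d :* v) := d :* d :* (w :* w :- v :* v)) refl
              (δ ρ) w w′ ⟩
          δ ρ * δ ρ * (w * w - w′ * w′)
            ≈⟨ *-congˡ (x≈y⇒x-y≈0 (trans cur (trans (poly-cong h-poly (sym m′≈m)) (sym cur′)))) ⟩
          δ ρ * δ ρ * 0#
            ≈⟨ zeroʳ _ ⟩
          0# ∎)

      at-root : ∀ {ρ} → ¬ β ρ ≈ 0# →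
        (∀ η → η * η ≈ f ρ → Conjugate ρ η (ω ρ η) (ω ρ (- η))) →
        (∀ η → η * η ≈ f ρ → μ ρ (- η) ≈ μ ρ η) → (∀ η → η * η ≈ f ρ → ω ρ η * ω ρ η ≈ h (μ ρ η)) →
        ∃[ η ] η * η ≈ f ρ → α ρ ≈ 0#
      at-root βρ≉0 conj even cur (η , η²) = at βρ≉0 (conj η η²) (even η η²) (cur η η²) (cur (- η) (neg² η²))

    linear-in-x : Carrier → Carrier → Carrier
    linear-in-x x τ = x * Dˣ τ + - 1# * Aˣ τ

    linear-in-x-divides : Divides linear-in-x
    linear-in-x-divides = divides-+ (divides-* identityᵖ (divides-poly Dˣ-poly))
      (divides-* (constantᵖ (- 1#)) (divides-poly Aˣ-poly))

    linear-in-x-vanishes : Generically f λ ρ η → linear-in-x ρ (μ ρ η) ≈ 0#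
    linear-in-x-vanishes = cofinitely-map (λ {ρ} pre η η² → begin
      ρ * Dˣ (μ ρ η) + - 1# * Aˣ (μ ρ η)
        ≈⟨ solve 3 (λ x D A → x :* D :+ (:- :1) :* A := D :* x :- A) refl ρ (Dˣ (μ ρ η)) (Aˣ (μ ρ η)) ⟩
      Dˣ (μ ρ η) * ρ - Aˣ (μ ρ η)
        ≈⟨ x≈y⇒x-y≈0 (trans (pre η η²) (trans (+-congˡ (trans (*-congʳ (Bˣ≈0 _)) (zeroˡ _))) (+-identityʳ _))) ⟩
      0# ∎) x-preimage

    -- With B = 0 the divisor τD - A does not involve y, so averaging the cofactor identity over y
    -- and -y removes the term Hy and leaves G.
    linear-norm-divides : ∀ τ → (λ x → τ * D x - A x) ∣ᵖ (λ x → proj₁ linear-in-x-divides x * linear-in-x x τ)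
    linear-norm-divides τ = go (proj₂ (proj₂ (proj₂ linear-in-x-divides)) τ)
      where
      s = proj₁ linear-in-x-divides

      go : Cofactor linear-in-x s τ → (λ x → τ * D x - A x) ∣ᵖ (λ x → s x * linear-in-x x τ)
      go (G , H , pG , pH , eq) = G , pG , agree
        (proj₁ (proj₂ (proj₂ linear-in-x-divides)) *ᵖ
          (identityᵖ *ᵖ constantᵖ (Dˣ τ) +ᵖ constantᵖ (- 1#) *ᵖ constantᵖ (Aˣ τ)))
        ((constantᵖ τ *ᵖ D-poly -ᵖ A-poly) *ᵖ pG)
        (cofinitely-map (λ {x} (θ≈0 , μ≈) → at x θ≈0 μ≈ (square-root (f x))) (cofinitely-∩ linear-in-x-vanishes μ-eq))
        where
        average : ∀ {k q G H y} → k ≈ q * (G + H * y) → k ≈ q * (G + H * - y) → k ≈ q * G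
        average {k} {q} {G} {H} {y} eq₁ eq₂ = *-cancelˡ 2≉0 (begin
          2# * k                                 ≈⟨ solve 1 (λ k → :2 :* k := k :+ k) refl k ⟩
          k + k                                  ≈⟨ +-cong eq₁ eq₂ ⟩
          q * (G + H * y) + q * (G + H * - y)    ≈⟨ solve 4
            (λ q G H y → q :* (G :+ H :* y) :+ q :* (G :+ H :* :- y) :=
                                                      :2 :* (q :* G)) refl q G H y ⟩
          2# * (q * G)                           ∎)

        at : ∀ x → (∀ η → η * η ≈ f x → linear-in-x x (μ x η) ≈ 0#) →
          (∀ η → η * η ≈ f x → D x * μ x η ≈ A x + B x * η) →
          ∃[ η ] η * η ≈ f x → s x * linear-in-x x τ ≈ (τ * D x - A x) * G x
        at x θ≈0 μ≈ (η , η²) = average (at-root η η²) (at-root (- η) (neg² η²))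
          where
          at-root : ∀ y → y * y ≈ f x → s x * linear-in-x x τ ≈ (τ * D x - A x) * (G x + H x * y)
          at-root y y² = trans (*-congˡ (trans (sym (x-0≈x _)) (+-congˡ (-‿cong (sym (θ≈0 y y²))))))
            (trans (eq x y (μ x y) y² (μ≈ y y²))
              (*-congʳ (+-congˡ (-‿cong (trans (+-congˡ (trans (*-congʳ (B≈0 x)) (zeroˡ y))) (+-identityʳ _))))))

    möbius : Möbius f h
    -- The third argument is a placeholder: its reduced form `r′` is 0 as well, so `coprime` says
    -- that D and A have no common zero after reduction.
    möbius = reduced (reduce D-factored A-poly (constantᵖ 0#))
      where
      reduced : Reduced D A (λ _ → 0#) → Möbius f h
      -- The linear polynomial `p′`τ - `q′` is passed as a quadratic one with leading coefficient 0.
      -- The equation of x over K(u) is now linear in x, which yields degree at most 1.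
      reduced R = linear (gauss-degree (proj₁ (proj₂ linear-in-x-divides)) (constantᵖ 0#) p′-poly
        (constantᵖ (- 1#) *ᵖ q′-poly)
        (λ x _ p′≈0 -q′≈0 → coprime x p′≈0 (*-nonzero -1≉0 -q′≈0) (r′≈0 x)) family)
        where
        open Reduced R
        s = proj₁ linear-in-x-divides

        p′-poly : IsPoly p′
        p′-poly = factored-poly p′-factored

        r′≈0 : ∀ x → r′ x ≈ 0#
        r′≈0 = cancel κ-factored r′-poly (constantᵖ 0#) λ x → trans (sym (r≈ x)) (sym (zeroʳ _))

        family : Cofinitely (λ τ → ∃[ P ] DegreeAtMost 1 P × ¬ (∀ x → P x ≈ 0#) ×
          (λ x → quadratic 0# (p′ x) (- 1# * q′ x) τ) ∣ᵖ (λ x → s x * P x))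
        family = cofinitely-map (λ {τ} Dτ≉0 → member τ Dτ≉0 (linear-norm-divides τ)) (cofinitely-≉0 Dˣ-factored)
          where
          member : ∀ τ → ¬ Dˣ τ ≈ 0# → (λ x → τ * D x - A x) ∣ᵖ (λ x → s x * linear-in-x x τ) →
            ∃[ P ] DegreeAtMost 1 P × ¬ (∀ x → P x ≈ 0#) ×
              (λ x → quadratic 0# (p′ x) (- 1# * q′ x) τ) ∣ᵖ (λ x → s x * P x)
          member τ Dτ≉0 (H , pH , eq) = (λ x → linear-in-x x τ) ,
            (list , ℕ.≤-refl , list-eval) ,
            (λ P≈0 → Dτ≉0 (eval-zero⇒≈ₚ0 list (λ x → trans (sym (list-eval x)) (P≈0 x)) 1)) ,
            (λ x → κ x * H x) , factored-poly κ-factored *ᵖ pH , λ x → trans (eq x)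
              (trans (*-congʳ (-‿cong₂ (*-congˡ (p≈ x)) (q≈ x)))
              (solve 5 (λ τ k p q H → (τ :* (k :* p) :- k :* q) :* H :=
                (:0 :* (τ :* τ) :+ (p :* τ :+ (:- :1) :* q)) :* (k :* H)) refl τ (κ x) (p′ x) (q′ x) (H x)))
            where
            list = - 1# * Aˣ τ ∷ Dˣ τ ∷ []

            list-eval : ∀ x → linear-in-x x τ ≈ eval list x
            list-eval x = solve 3 (λ x D A → x :* D :+ A := A :+ x :* (D :+ x :* :0)) refl x (Dˣ τ) (- 1# * Aˣ τ)

        linear : DegreeAtMost 1 (λ _ → 0#) × DegreeAtMost 1 p′ × DegreeAtMost 1 (λ x → - 1# * q′ x) → Möbius f h
        linear (_ , dp , dq) = coefficients (linear-coefficients dp)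
          (linear-coefficients (degree-resp (λ x → solve 1 (λ q → (:- :1) :* ((:- :1) :* q) := q) refl (q′ x))
            (degree-scale (- 1#) dq)))
          where
          coefficients : ∃[ m₃ ] ∃[ m₄ ] (∀ x → p′ x ≈ m₃ * x + m₄) → ∃[ m₁ ] ∃[ m₂ ] (∀ x → q′ x ≈ m₁ * x + m₂) →
            Möbius f h
          coefficients (m₃ , m₄ , p′≈) (m₁ , m₂ , q′≈) = record
            { m₁ = m₁ ; m₂ = m₂ ; m₃ = m₃ ; m₄ = m₄
            ; det≉0 = nonconstant
            ; β = β ; δ = δ ; β-poly = β-poly ; δ-poly = δ-poly
            ; β-factored = β-is-factored ; δ-factored = δ-factored
            ; points = cofinitely-map (λ {ρ} (m , conj , cur) → point (m , conj , cur) (square-root (f ρ)))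
                (cofinitely-∩ möbius-eq (cofinitely-∩ conjugates curve))
            }
            where
            möbius-eq : Generically f λ ρ η → (m₃ * ρ + m₄) * μ ρ η ≈ m₁ * ρ + m₂
            möbius-eq = cofinitely-map (λ {ρ} (eq , κ≉0) η η² → *-cancelˡ κ≉0 (begin
              κ ρ * ((m₃ * ρ + m₄) * μ ρ η)  ≈⟨ *-assoc _ _ _ ⟨
              κ ρ * (m₃ * ρ + m₄) * μ ρ η    ≈⟨ *-congʳ (trans (*-congˡ (sym (p′≈ ρ))) (sym (p≈ ρ))) ⟩
              D ρ * μ ρ η                    ≈⟨ eq η η² ⟩
              A ρ                            ≈⟨ trans (q≈ ρ) (*-congˡ (q′≈ ρ)) ⟩
              κ ρ * (m₁ * ρ + m₂)            ∎)) (cofinitely-∩ μ≈A/D (cofinitely-≉0 κ-factored))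

            point : ∀ {ρ} → (∀ η → η * η ≈ f ρ → (m₃ * ρ + m₄) * μ ρ η ≈ m₁ * ρ + m₂) ×
              (∀ η → η * η ≈ f ρ → Conjugate ρ η (ω ρ η) (ω ρ (- η))) ×
              (∀ η → η * η ≈ f ρ → ω ρ η * ω ρ η ≈ h (μ ρ η)) → ∃[ η ] η * η ≈ f ρ →
              ∃[ μ ] (m₃ * ρ + m₄) * μ ≈ m₁ * ρ + m₂ × β ρ * β ρ * f ρ ≈ δ ρ * δ ρ * h μ
            point {ρ} (m , conj , cur) (η , η²) = μ ρ η , m η η² , (begin
              β ρ * β ρ * f ρ
                ≈⟨ *-congˡ η² ⟨
              β ρ * β ρ * (η * η)
                ≈⟨ solve 2 (λ b y → b :* b :* (y :* y) := (:0 :+ b :* y) :* (:0 :+ b :* y)) refl (β ρ) η ⟩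
              (0# + β ρ * η) * (0# + β ρ * η)
                ≈⟨ *-cong (trans (+-congʳ (sym (α≈0 ρ))) (sym (proj₁ (conj η η²))))
                  (trans (+-congʳ (sym (α≈0 ρ))) (sym (proj₁ (conj η η²)))) ⟩
              (δ ρ * ω ρ η) * (δ ρ * ω ρ η)
                ≈⟨ solve 2 (λ d w → (d :* w) :* (d :* w) := d :* d :* (w :* w)) refl (δ ρ) (ω ρ η) ⟩
              δ ρ * δ ρ * (ω ρ η * ω ρ η)
                ≈⟨ *-congˡ (cur η η²) ⟩
              δ ρ * δ ρ * h (μ ρ η) ∎)

            -- With determinant 0 the image of x would be a constant k, which `transcendental k`
            -- rules out.
            nonconstant : ¬ m₁ * m₄ - m₂ * m₃ ≈ 0#
            nonconstant det≈0 = not-constant (proportional p′≢0 det≈0)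
              where
              p′≢0 : ¬ (m₃ ≈ 0# × m₄ ≈ 0#)
              p′≢0 (m₃≈0 , m₄≈0) = factored≢0 p′-factored λ x →
                trans (p′≈ x) (trans (+-cong (trans (*-congʳ m₃≈0) (zeroˡ x)) m₄≈0) (+-identityˡ 0#))

              not-constant : ¬ (∃[ k ] k * m₃ ≈ m₁ × k * m₄ ≈ m₂)
              not-constant (k , km₃ , km₄) = impossible (cofinitely-map
                (λ {ρ} (eq , p′ρ≉0 , μ≉k) η η² → μ≉k η η² (*-cancelˡ (p′ρ≉0 ∘ trans (p′≈ ρ)) (begin
                  (m₃ * ρ + m₄) * μ ρ η   ≈⟨ eq η η² ⟩
                  m₁ * ρ + m₂             ≈⟨ +-cong (*-congʳ km₃) km₄ ⟨
                  k * m₃ * ρ + k * m₄     ≈⟨ solve 4 (λ k c d x → k :* c :* x :+ k :* d := (c :* x :+ d) :* k) refl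
                    k m₃ m₄ ρ ⟩
                  (m₃ * ρ + m₄) * k       ∎)))
                (cofinitely-∩ möbius-eq (cofinitely-∩ (cofinitely-≉0 p′-factored) (transcendental k))))

  -- Binary forms

  open RawSemiringDefs (Semiring.rawSemiring semiring) public using (_^_) renaming (_×_ to _·_)
  open Exponentiation commutativeSemiring public using (^-congˡ; ^-homo-*; ^-assocʳ; ^-distrib-*)

  ^≉0 : ∀ {x} → ¬ x ≈ 0# → ∀ n → ¬ x ^ n ≈ 0#
  ^≉0 x≉0 zero    = 1≉0
  ^≉0 x≉0 (suc n) = *≉0 x≉0 (^≉0 x≉0 n)

  Point : Set c
  Point = Carrier × Carrier

  infix 4 _≈²_
  _≈²_ : Point → Point → Set ℓ
  (x , z) ≈² (x′ , z′) = x ≈ x′ × z ≈ z′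

  infixr 7 _*²_
  _*²_ : Carrier → Point → Point
  k *² (x , z) = k * x , k * z

  NonzeroPoint : Point → Set ℓ
  NonzeroPoint (x , z) = ¬ (x ≈ 0# × z ≈ 0#)

  -- As a function of X this is the linear form with zero P; between two points it is the
  -- homogeneous counterpart of a difference of roots.
  det : Point → Point → Carrier
  det (x , z) (x′ , z′) = x * z′ - z * x′

  det-cong : ∀ {X X′ P} → X ≈² X′ → det X P ≈ det X′ P
  det-cong (x≈ , z≈) = -‿cong₂ (*-congʳ x≈) (*-congʳ z≈)

  det-congʳ : ∀ {X P P′} → P ≈² P′ → det X P ≈ det X P′
  det-congʳ (x≈ , z≈) = -‿cong₂ (*-congˡ z≈) (*-congˡ x≈)

  det-scale : ∀ k X P → det (k *² X) P ≈ k * det X P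
  det-scale k (x , z) (x′ , z′) =
    solve 5 (λ k x z x′ z′ → k :* x :* z′ :- k :* z :* x′ := k :* (x :* z′ :- z :* x′)) refl k x z x′ z′

  det-scaleʳ : ∀ k X P → det X (k *² P) ≈ k * det X P
  det-scaleʳ k (x , z) (x′ , z′) =
    solve 5 (λ k x z x′ z′ → x :* (k :* z′) :- z :* (k :* x′) := k :* (x :* z′ :- z :* x′)) refl k x z x′ z′

  det-self : ∀ X → det X X ≈ 0#
  det-self (x , z) = solve 2 (λ x z → x :* z :- z :* x := :0) refl x z

  det²-swap : ∀ X P → det X P * det X P ≈ det P X * det P X
  det²-swap (x , z) (x′ , z′) =
    solve 4 (λ x z x′ z′ → (x :* z′ :- z :* x′) :* (x :* z′ :- z :* x′) := (x′ :* z :- z′ :* x) :*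
      (x′ :* z :- z′ :* x)) refl x z x′ z′

  det≈0⇒proportional : ∀ {X P} → NonzeroPoint P → det X P ≈ 0# → ∃[ k ] X ≈² k *² P
  det≈0⇒proportional P≢0 det≈0 = flip (proportional P≢0 det≈0)
    where
    flip : ∀ {x z x′ z′} → ∃[ k ] k * x ≈ x′ × k * z ≈ z′ → ∃[ k ] (x′ , z′) ≈² k *² (x , z)
    flip (k , x≈ , z≈) = k , sym x≈ , sym z≈

  detProduct : List Point → Point → Carrier
  detProduct Ps X = foldr (λ P acc → det X P * acc) 1# Ps

  form : Carrier → List Point → Point → Carrier
  form k Ps X = k * detProduct Ps X

  discriminantOf : List Point → Carrier
  discriminantOf []       = 1#
  discriminantOf (P ∷ Ps) = detProduct Ps P * detProduct Ps P * discriminantOf Ps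

  detProduct-cong : ∀ Ps {X X′} → X ≈² X′ → detProduct Ps X ≈ detProduct Ps X′
  detProduct-cong []       X≈X′ = refl
  detProduct-cong (P ∷ Ps) X≈X′ = *-cong (det-cong {P = P} X≈X′) (detProduct-cong Ps X≈X′)

  detProduct-scale : ∀ Ps k X → detProduct Ps (k *² X) ≈ k ^ length Ps * detProduct Ps X
  detProduct-scale []       k X = sym (*-identityˡ 1#)
  detProduct-scale (P ∷ Ps) k X = trans (*-cong (det-scale k X P) (detProduct-scale Ps k X))
    (solve 4 (λ k d n p → (k :* d) :* (n :* p) := (k :* n) :* (d :* p)) refl k (det X P) (k ^ length Ps)
      (detProduct Ps X))

  -- Proved by restriction to lines, on which forms are polynomial functions.
  forms-agree : ∀ {k l} Ps Qs Q → NonzeroPoint Q → (∀ X → ¬ det X Q ≈ 0# → form k Ps X ≈ form l Qs X) →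
    ∀ X → form k Ps X ≈ form l Qs X
  forms-agree {k} {l} Ps Qs Q@(q₁ , q₂) Q≢0 eq X@(x , z) = go (q₂ ≟ 0#)
    where
    line : Point → Carrier → Point
    line (v , w) t = x + t * v , z + t * w

    det-line : ∀ V P t → det (line V t) P ≈ det X P + t * det V P
    det-line (v , w) (p , q) t = solve 7 (λ x z v w p q t →
      (x :+ t :* v) :* q :- (z :+ t :* w) :* p := (x :* q :- z :* p) :+ t :* (v :* q :- w :* p)) refl x z v w p q t

    line-poly : ∀ V k Ps → IsPoly (λ t → form k Ps (line V t))
    line-poly V k Ps = constantᵖ k *ᵖ product Ps
      where
      product : ∀ Ps → IsPoly (λ t → detProduct Ps (line V t))
      product []       = constantᵖ 1#
      product (P ∷ Ps) =
        poly-resp (λ t → sym (det-line V P t)) (constantᵖ (det X P) +ᵖ identityᵖ *ᵖ constantᵖ (det V P)) *ᵖ product Ps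

    along : ∀ V → ¬ det V Q ≈ 0# → form k Ps X ≈ form l Qs X
    along V VQ≉0 = trans (trans (*-congˡ (detProduct-cong Ps at-0)) (agree (line-poly V k Ps) (line-poly V l Qs)
      (cofinitely-map (λ {t} ≉0 → eq (line V t) (≉0 ∘ trans (trans
        (solve 3 (λ a b t → a :+ t :* (b :+ t :* :0) := a :+ t :* b) refl (det X Q) (det V Q) t)
          (sym (det-line V Q t)))))
        (cofinitely-≉0 (factored-of-≉ (det X Q ∷ det V Q ∷ []) (λ p≈0 → VQ≉0 (p≈0 1)))))
      0#)) (*-congˡ (detProduct-cong Qs (sym (proj₁ at-0) , sym (proj₂ at-0))))
      where
      at-0 : X ≈² line V 0#
      at-0 = sym (trans (+-congˡ (zeroˡ _)) (+-identityʳ x)) , sym (trans (+-congˡ (zeroˡ _)) (+-identityʳ z))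

    -- A line through X in a direction not proportional to Q meets the excluded set det X Q = 0 in
    -- at most one point. One of the coordinate directions always qualifies.
    go : Dec (q₂ ≈ 0#) → form k Ps X ≈ form l Qs X
    go (no q₂≉0)  = along (1# , 0#) λ eq → q₂≉0 (trans
      (solve 2 (λ q₁ q₂ → q₂ := :1 :* q₂ :- :0 :* q₁) refl q₁ q₂) eq)
    go (yes q₂≈0) = along (0# , 1#) λ eq → Q≢0 ((trans
      (solve 2 (λ q₁ q₂ → q₁ := :- (:0 :* q₂ :- :1 :* q₁)) refl q₁ q₂) (trans (-‿cong eq) -0#≈0#)) , q₂≈0)

  record Selection (Ps : List Point) (X : Point) : Set (c ⊔ ℓ) where
    field
      P     : Point
      Qs    : List Point
      det≈0 : det X P ≈ 0#
      size  : length Ps ≡ suc (length Qs)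
      product≈      : ∀ Y → detProduct Ps Y ≈ det Y P * detProduct Qs Y
      discriminant≈ : discriminantOf Ps ≈ discriminantOf (P ∷ Qs)
      nonzero       : All NonzeroPoint Ps → All NonzeroPoint (P ∷ Qs)

  -- A product of linear forms vanishes at X only if one of them does. Moving its point to the front
  -- does not change the discriminant, because determinants enter it squared.
  select : ∀ Ps X → detProduct Ps X ≈ 0# → Selection Ps X
  select []       X 1≈0 = contradiction 1≈0 1≉0
  select (R ∷ Ps) X eq  = go (integral eq)
    where
    go : det X R ≈ 0# ⊎ detProduct Ps X ≈ 0# → Selection (R ∷ Ps) X
    go (inj₁ det≈0) = record
      { P = R ; Qs = Ps ; det≈0 = det≈0 ; size = ≡.refl ; product≈ = λ _ → refl ; discriminant≈ = refl ; nonzero =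
        λ ps → ps }
    go (inj₂ eq′) = record
      { P = P ; Qs = R ∷ Qs ; det≈0 = det≈0 ; size = ≡.cong suc size
      ; product≈ = λ Y → trans (*-congˡ (product≈ Y))
        (solve 3 (λ a b q → a :* (b :* q) := b :* (a :* q)) refl (det Y R) (det Y P) (detProduct Qs Y))
      ; discriminant≈ = begin
          detProduct Ps R * detProduct Ps R * discriminantOf Ps
            ≈⟨ *-cong (*-cong (product≈ R) (product≈ R)) discriminant≈ ⟩
          (det R P * Q R) * (det R P * Q R) * (Q P * Q P * discriminantOf Qs)
            ≈⟨ solve 4 (λ d a b e → (d :* a) :* (d :* a) :* (b :* b :* e) := (d :* d) :* (b :* b) :* (a :* a :* e))
              refl
                 (det R P) (Q R) (Q P) (discriminantOf Qs) ⟩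
          (det R P * det R P) * (Q P * Q P) * (Q R * Q R * discriminantOf Qs)
            ≈⟨ *-congʳ (*-congʳ (det²-swap R P)) ⟩
          (det P R * det P R) * (Q P * Q P) * (Q R * Q R * discriminantOf Qs)
            ≈⟨ *-congʳ (solve 2 (λ d b → (d :* d) :* (b :* b) := (d :* b) :* (d :* b)) refl (det P R) (Q P)) ⟩
          (det P R * Q P) * (det P R * Q P) * (Q R * Q R * discriminantOf Qs) ∎
      ; nonzero = λ { (r ∷ ps) → swap r (nonzero ps) }
      }
      where
      open Selection (select Ps X eq′)
      Q = detProduct Qs

      swap : NonzeroPoint R → All NonzeroPoint (P ∷ Qs) → All NonzeroPoint (P ∷ R ∷ Qs)
      swap r (p ∷ qs) = p ∷ r ∷ qs

  -- k^{2n} ∏_{i<j} det(Pᵢ, Pⱼ)² depends only on the form k ∏ det(X, Pᵢ) of degree n + 1.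
  discriminant-invariant : ∀ n {k l} Ps Qs → length Ps ≡ suc n → length Qs ≡ suc n → ¬ k ≈ 0# → ¬ l ≈ 0# →
    All NonzeroPoint Ps → All NonzeroPoint Qs → (∀ X → form k Ps X ≈ form l Qs X) →
    (k * k) ^ n * discriminantOf Ps ≈ (l * l) ^ n * discriminantOf Qs
  discriminant-invariant zero    (_ ∷ [])    (_ ∷ [])    _ _ _ _ _ _ _ = refl
  discriminant-invariant (suc n) {k} {l} (P ∷ Ps) Qs len len′ k≉0 l≉0 (P≢0 ∷ Ps≢0) Qs≢0 eq =
    -- P is a zero of the left-hand form, hence of the right-hand one, so it is proportional to one
    -- of the `Qs`.
    go (select Qs P (*-nonzero l≉0 (trans (sym (eq P))
      (trans (*-congˡ (trans (*-congʳ (det-self P)) (zeroˡ _))) (zeroʳ k)))))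
    where
    go : Selection Qs P → (k * k) ^ suc n * discriminantOf (P ∷ Ps) ≈ (l * l) ^ suc n * discriminantOf Qs
    go S = scaled (nonzero Qs≢0)
      where
      open Selection S renaming (P to Q; Qs to Rs)

      scaled : All NonzeroPoint (Q ∷ Rs) → (k * k) ^ suc n * discriminantOf (P ∷ Ps) ≈ (l * l) ^ suc n *
        discriminantOf Qs
      scaled (Q≢0 ∷ Rs≢0) = ratio (det≈0⇒proportional Q≢0 det≈0)
        where
        ratio : ∃[ λ′ ] P ≈² λ′ *² Q → (k * k) ^ suc n * discriminantOf (P ∷ Ps) ≈ (l * l) ^ suc n * discriminantOf Qs
        ratio (r , P≈rQ) = begin
          (k * k) * (k * k) ^ n * (p P * p P * E)
            ≈⟨ *-congˡ (*-congʳ (*-cong pP≈ pP≈)) ⟩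
          (k * k) * (k * k) ^ n * ((r * r ^ n * p Q) * (r * r ^ n * p Q) * E)
            ≈⟨ solve 6 (λ k K r R p E → (k :* k) :* K :* ((r :* R :* p) :* (r :* R :* p) :* E) :=
                 (K :* (R :* R) :* E) :* ((k :* r :* p) :* (k :* r :* p))) refl k ((k * k) ^ n) r (r ^ n) (p Q) E ⟩
          ((k * k) ^ n * (r ^ n * r ^ n) * E) * (form (k * r) Ps Q * form (k * r) Ps Q)
            ≈⟨ *-cong (*-congʳ powers) (*-cong (eq′ Q) (eq′ Q)) ⟩
          (((k * r) * (k * r)) ^ n * E) * (form l Rs Q * form l Rs Q)
            ≈⟨ *-congʳ (discriminant-invariant n Ps Rs (ℕ.suc-injective len)
              (ℕ.suc-injective (≡.trans (≡.sym size) len′))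
                 (*≉0 k≉0 r≉0) l≉0 Ps≢0 Rs≢0 eq′) ⟩
          ((l * l) ^ n * discriminantOf Rs) * ((l * detProduct Rs Q) * (l * detProduct Rs Q))
            ≈⟨ solve 4 (λ l L E q → (L :* E) :* ((l :* q) :* (l :* q)) := (l :* l) :* L :* (q :* q :* E)) refl
                 l ((l * l) ^ n) (discriminantOf Rs) (detProduct Rs Q) ⟩
          (l * l) * (l * l) ^ n * discriminantOf (Q ∷ Rs)
            ≈⟨ *-congˡ discriminant≈ ⟨
          (l * l) * (l * l) ^ n * discriminantOf Qs ∎
          where
          p = detProduct Ps
          E = discriminantOf Ps

          r≉0 : ¬ r ≈ 0#
          r≉0 r≈0 = P≢0 (vanish (proj₁ P≈rQ) , vanish (proj₂ P≈rQ))
            where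
            vanish : ∀ {x y} → x ≈ r * y → x ≈ 0#
            vanish x≈ = trans x≈ (trans (*-congʳ r≈0) (zeroˡ _))

          pP≈ : p P ≈ r * r ^ n * p Q
          pP≈ = trans (detProduct-cong Ps P≈rQ) (trans (detProduct-scale Ps r Q)
            (*-congʳ (reflexive (≡.cong (r ^_) (ℕ.suc-injective len)))))

          powers : (k * k) ^ n * (r ^ n * r ^ n) ≈ ((k * r) * (k * r)) ^ n
          powers = trans (*-congˡ (sym (^-distrib-* r r n))) (trans (sym (^-distrib-* (k * k) (r * r) n))
            (^-congˡ n (solve 2 (λ k r → (k :* k) :* (r :* r) := (k :* r) :* (k :* r)) refl k r)))

          eq′ : ∀ X → form (k * r) Ps X ≈ form l Rs X
          -- With P = rQ, the ratio r joins the constant k. The common factor det X Q can be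
          -- cancelled only where it is nonzero; `forms-agree` supplies the remaining points.
          eq′ = forms-agree Ps Rs Q Q≢0 λ X XQ≉0 → *-cancelˡ XQ≉0 (begin
            det X Q * (k * r * p X)        ≈⟨ solve 4 (λ d k r p → d :* (k :* r :* p) := k :* ((r :* d) :* p)) refl
              (det X Q) k r (p X) ⟩
            k * ((r * det X Q) * p X)      ≈⟨ *-congˡ
              (*-congʳ (trans (sym (det-scaleʳ r X Q)) (det-congʳ {X} (sym (proj₁ P≈rQ) , sym (proj₂ P≈rQ))))) ⟩
            k * (det X P * p X)            ≈⟨ eq X ⟩
            l * detProduct Qs X            ≈⟨ *-congˡ (product≈ X) ⟩
            l * (det X Q * detProduct Rs X) ≈⟨ solve 3 (λ l d q → l :* (d :* q) := d :* (l :* q)) refl l (det X Q)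
              (detProduct Rs X) ⟩
            det X Q * (l * detProduct Rs X) ∎)

  record Matrix : Set c where
    constructor matrix
    field
      m₁ m₂ m₃ m₄ : Carrier

    determinant : Carrier
    determinant = m₁ * m₄ - m₂ * m₃

    infixr 7 _·²_
    _·²_ : Point → Point
    _·²_ (x , z) = m₁ * x + m₂ * z , m₃ * x + m₄ * z

  open Matrix public using (determinant; _·²_)

  -- Stands in for the inverse matrix, from which it differs by the factor `determinant M`, so that
  -- no division is involved.
  adjugate : Matrix → Matrix
  adjugate (matrix a b c d) = matrix d (- b) (- c) a

  det-transform : ∀ M P Q → det (M ·² P) (M ·² Q) ≈ determinant M * det P Q
  det-transform (matrix a b c d) (x , z) (x′ , z′) = solve 8 (λ a b c d x z x′ z′ →
    (a :* x :+ b :* z) :* (c :* x′ :+ d :* z′) :- (c :* x :+ d :* z) :* (a :* x′ :+ b :* z′) :=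
    (a :* d :- b :* c) :* (x :* z′ :- z :* x′)) refl a b c d x z x′ z′

  det-adjoint : ∀ M X P → det (M ·² X) P ≈ det X (adjugate M ·² P)
  det-adjoint (matrix a b c d) (x , z) (x′ , z′) = solve 8 (λ a b c d x z x′ z′ →
    (a :* x :+ b :* z) :* z′ :- (c :* x :+ d :* z) :* x′ :=
    x :* (:- c :* x′ :+ a :* z′) :- z :* (d :* x′ :+ :- b :* z′)) refl a b c d x z x′ z′

  det-adjointʳ : ∀ M X P → det (adjugate M ·² X) P ≈ det X (M ·² P)
  det-adjointʳ (matrix a b c d) (x , z) (x′ , z′) = solve 8 (λ a b c d x z x′ z′ →
    (d :* x :+ :- b :* z) :* z′ :- (:- c :* x :+ a :* z) :* x′ :=
    x :* (c :* x′ :+ d :* z′) :- z :* (a :* x′ :+ b :* z′)) refl a b c d x z x′ z′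

  adjugate-inverse : ∀ M X → M ·² adjugate M ·² X ≈² determinant M *² X
  adjugate-inverse (matrix a b c d) (x , z) =
    solve 6 (λ a b c d x z → a :* (d :* x :+ :- b :* z) :+ b :* (:- c :* x :+ a :* z) := (a :* d :- b :* c) :* x)
      refl a b c d x z ,
    solve 6 (λ a b c d x z → c :* (d :* x :+ :- b :* z) :+ d :* (:- c :* x :+ a :* z) := (a :* d :- b :* c) :* z)
      refl a b c d x z

  inverse-adjugate : ∀ M X → adjugate M ·² M ·² X ≈² determinant M *² X
  inverse-adjugate (matrix a b c d) (x , z) =
    solve 6 (λ a b c d x z → d :* (a :* x :+ b :* z) :+ :- b :* (c :* x :+ d :* z) := (a :* d :- b :* c) :* x) refl
      a b c d x z ,
    solve 6 (λ a b c d x z → :- c :* (a :* x :+ b :* z) :+ a :* (c :* x :+ d :* z) := (a :* d :- b :* c) :* z) refl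
      a b c d x z

  -- `N` is the adjoint of `φ` for the pairing `det`. This moves a linear substitution from the
  -- variable of a form to its zeros.
  detProduct-map : ∀ {N} (φ : Point → Point) → (∀ X P → det (φ X) P ≈ det X (N ·² P)) → ∀ Ps X →
    detProduct Ps (φ X) ≈ detProduct (map (N ·²_) Ps) X
  detProduct-map φ adj []       X = refl
  detProduct-map φ adj (P ∷ Ps) X = *-cong (adj X P) (detProduct-map φ adj Ps X)

  -- The number n(n - 1)/2 of pairs among n points, not n(n + 1)/2.
  triangular : ℕ → ℕ
  triangular zero    = zero
  triangular (suc n) = n ℕ.+ triangular n

  discriminant-map : ∀ M Ps → discriminantOf (map (M ·²_) Ps) ≈ (determinant M * determinant M) ^ triangular
    (length Ps) * discriminantOf Ps
  discriminant-map M []       = sym (*-identityˡ 1#)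
  discriminant-map M (P ∷ Ps) = begin
    detProduct (map (M ·²_) Ps) (M ·² P) * detProduct (map (M ·²_) Ps) (M ·² P) * discriminantOf (map (M ·²_) Ps)
      ≈⟨ *-cong (*-cong (product Ps) (product Ps)) (discriminant-map M Ps) ⟩
    (δ ^ n * p) * (δ ^ n * p) * ((δ * δ) ^ triangular n * discriminantOf Ps)
      ≈⟨ solve 4 (λ a p b e → (a :* p) :* (a :* p) :* (b :* e) := ((a :* a) :* b) :* (p :* p :* e)) refl (δ ^ n) p
        ((δ * δ) ^ triangular n) (discriminantOf Ps) ⟩
    ((δ ^ n * δ ^ n) * (δ * δ) ^ triangular n) * (p * p * discriminantOf Ps)
      ≈⟨ *-congʳ (trans (*-congʳ (sym (^-distrib-* δ δ n))) (sym (^-homo-* (δ * δ) n (triangular n)))) ⟩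
    (δ * δ) ^ (n ℕ.+ triangular n) * (p * p * discriminantOf Ps) ∎
    where
    δ = determinant M
    n = length Ps
    p = detProduct Ps P

    product : ∀ Qs → detProduct (map (M ·²_) Qs) (M ·² P) ≈ δ ^ length Qs * detProduct Qs P
    product []       = sym (*-identityˡ 1#)
    product (Q ∷ Qs) = trans (*-cong (det-transform M P Q) (product Qs))
      (solve 4 (λ a b e q → (a :* b) :* (e :* q) := (a :* e) :* (b :* q)) refl δ (det P Q) (δ ^ length Qs)
        (detProduct Qs P))

  -- Projective roots

  -- The sign is chosen so that det (x , z) ∞ = z.
  ∞ : Point
  ∞ = - 1# , 0#

  affine : List Carrier → List Point
  affine = map (_, 1#)

  -- The zeros on the projective line of a form of degree length rs or length rs + 1.
  data ProjectiveRoots (rs : List Carrier) : List Point → Set c where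
    finite   : ProjectiveRoots rs (affine rs)
    infinite : ProjectiveRoots rs (∞ ∷ affine rs)

  detProduct-affine : ∀ rs μ z → detProduct (affine rs) (μ * z , z) ≈ z ^ length (affine rs) * rootProduct rs μ
  detProduct-affine []       μ z = sym (*-identityˡ 1#)
  detProduct-affine (r ∷ rs) μ z = trans (*-congˡ (detProduct-affine rs μ z))
    (solve 5 (λ r μ z n p → (μ :* z :* :1 :- z :* r) :* (n :* p) := (z :* n) :* ((μ :- r) :* p)) refl
      r μ z (z ^ length (affine rs)) (rootProduct rs μ))

  detProduct-projective : ∀ {rs Ps} → ProjectiveRoots rs Ps → ∀ μ z → detProduct Ps (μ * z , z) ≈ z ^ length Ps *
    rootProduct rs μ
  detProduct-projective {rs} finite   μ z = detProduct-affine rs μ z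
  detProduct-projective {rs} infinite μ z = trans (*-congˡ (detProduct-affine rs μ z))
    (solve 4 (λ μ z n p → (μ :* z :* :0 :- z :* (:- :1)) :* (n :* p) := (z :* n) :* p) refl
      μ z (z ^ length (affine rs)) (rootProduct rs μ))

  discriminant-affine : ∀ rs → discriminantOf (affine rs) ≈ rootDiscriminant rs
  discriminant-affine []       = refl
  discriminant-affine (r ∷ rs) = *-cong (go rs) (discriminant-affine rs)
    where
    go : ∀ ss → detProduct (affine ss) (r , 1#) * detProduct (affine ss) (r , 1#) ≈
      foldr (λ s acc → (r - s) * (r - s) * acc) 1# ss
    go []       = *-identityˡ 1#
    go (s ∷ ss) = trans (solve 3 (λ r s p → ((r :* :1 :- :1 :* s) :* p) :* ((r :* :1 :- :1 :* s) :* p)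
      := (r :- s) :* (r :- s) :* (p :* p)) refl r s (detProduct (affine ss) (r , 1#))) (*-congˡ (go ss))

  -- The point ∞ contributes only squares of ±1, so one formula serves for both parities of the
  -- degree.
  discriminant-projective : ∀ {rs Ps} → ProjectiveRoots rs Ps → discriminantOf Ps ≈ rootDiscriminant rs
  discriminant-projective {rs} finite   = discriminant-affine rs
  discriminant-projective {rs} infinite = trans (*-cong (go rs) (discriminant-affine rs)) (*-identityˡ _)
    where
    go : ∀ ss → detProduct (affine ss) ∞ * detProduct (affine ss) ∞ ≈ 1#
    go []       = *-identityˡ 1#
    go (s ∷ ss) = trans (solve 2 (λ s p → (((:- :1) :* :1 :- :0 :* s) :* p) :* (((:- :1) :* :1 :- :0 :* s) :* p)
      := p :* p) refl s (detProduct (affine ss) ∞)) (go ss)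

  nonzero-affine : ∀ rs → All NonzeroPoint (affine rs)
  nonzero-affine []       = []
  nonzero-affine (r ∷ rs) = (λ (_ , 1≈0) → 1≉0 1≈0) ∷ nonzero-affine rs

  nonzero-projective : ∀ {rs Ps} → ProjectiveRoots rs Ps → All NonzeroPoint Ps
  nonzero-projective {rs} finite   = nonzero-affine rs
  nonzero-projective {rs} infinite = (λ (-1≈0 , _) → -1≉0 -1≈0) ∷ nonzero-affine rs

  length-projective : ∀ {rs Ps} → ProjectiveRoots rs Ps → length Ps ≤ suc (length rs)
  length-projective {rs} finite   = ℕ.≤-trans (ℕ.≤-reflexive (List.length-map _ rs)) (ℕ.n≤1+n _)
  length-projective {rs} infinite = s≤s (ℕ.≤-reflexive (List.length-map _ rs))

  detProduct-polynomial : ∀ M Ps → DegreeAtMost (length Ps) (λ x → detProduct Ps (M ·² (x , 1#)))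
  detProduct-polynomial M []       = degree-rootProduct []
  detProduct-polynomial M@(matrix a b c d) ((x′ , z′) ∷ Ps) = degree-*
    (degree-resp (λ x → solve 7 (λ a b c d x x′ z′ → (a :* z′ :- c :* x′) :* x :+ (b :* z′ :- d :* x′) :=
      (a :* x :+ b :* :1) :* z′ :- (c :* x :+ d :* :1) :* x′) refl a b c d x x′ z′)
      (degree-linear (a * z′ - c * x′) (b * z′ - d * x′))) (detProduct-polynomial M Ps)

  ^-poly : ∀ {a} → IsPoly a → ∀ n → IsPoly (λ x → a x ^ n)
  ^-poly pa zero    = constantᵖ 1#
  ^-poly pa (suc n) = pa *ᵖ ^-poly pa n

  ^-factored : ∀ {a} → Factored a → ∀ n → Factored (λ x → a x ^ n)
  ^-factored fa zero    = factored-const 1≉0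
  ^-factored fa (suc n) = factored-* fa (^-factored fa n)

  ·²-scale : ∀ M μ z → M ·² (μ * z , z) ≈² z *² M ·² (μ , 1#)
  ·²-scale (matrix a b c d) μ z =
    solve 4 (λ a b μ z → a :* (μ :* z) :+ b :* z := z :* (a :* μ :+ b :* :1)) refl a b μ z ,
    solve 4 (λ c d μ z → c :* (μ :* z) :+ d :* z := z :* (c :* μ :+ d :* :1)) refl c d μ z

  -- Equivalence of the binary forms of f and h.

  module _
    {f h : Carrier → Carrier} {cf ch : Carrier} {rs ss : List Carrier} {Ps Qs : List Point} {k : ℕ}
    (f-poly : IsPoly f) (f-squarefree : Squarefree f) (cf≉0 : ¬ cf ≈ 0#)
    (f≈ : ∀ x → f x ≈ cf * rootProduct rs x) (h≈ : ∀ x → h x ≈ ch * rootProduct ss x)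
    (rs-Ps : ProjectiveRoots rs Ps) (ss-Qs : ProjectiveRoots ss Qs)
    (length-Ps : length Ps ≡ k ℕ.+ k) (length-Qs : length Qs ≡ k ℕ.+ k) (m : Möbius f h) where
    open Möbius m

    private
      M : Matrix
      M = matrix m₁ m₂ m₃ m₄

      -- `Z` is the denominator of the Möbius transformation. The form of h has even degree 2k, so
      -- its denominator Z^(2k) is a square, and its root Z^k can be absorbed into β to form `s`.
      Z G s : Carrier → Carrier
      Z x = m₃ * x + m₄
      G x = form ch Qs (M ·² (x , 1#))
      s x = β x * Z x ^ k

      Z-poly : IsPoly Z
      Z-poly = isPoly (degree-linear m₃ m₄)

      Z-factored : Factored Z
      Z-factored = factored Z-poly λ Z≈0 →
        let m₄≈0 = trans (sym (trans (+-congʳ (zeroʳ m₃)) (+-identityˡ m₄))) (Z≈0 0#)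
            m₃≈0 = trans (sym (trans (+-congˡ m₄≈0) (trans (+-identityʳ _) (*-identityʳ m₃)))) (Z≈0 1#)
        in det≉0 (trans (-‿cong₂ (trans (*-congˡ m₄≈0) (zeroʳ m₁)) (trans (*-congˡ m₃≈0) (zeroʳ m₂))) (-‿inverseʳ 0#))

      G-degree : DegreeAtMost (k ℕ.+ k) G
      G-degree = ≡.subst (λ n → DegreeAtMost n G) length-Qs (degree-scale ch (detProduct-polynomial M Qs))

      at-point : ∀ {x μ} → Z x * μ ≈ m₁ * x + m₂ → β x * β x * f x ≈ δ x * δ x * h μ →
        s x * s x * f x ≈ δ x * δ x * G x
      at-point {x} {μ} Zμ eq = begin
        (β x * Zᵏ) * (β x * Zᵏ) * f x
          ≈⟨ solve 3 (λ b z f → (b :* z) :* (b :* z) :* f := (b :* b :* f) :* (z :* z)) refl (β x) Zᵏ (f x) ⟩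
        (β x * β x * f x) * (Zᵏ * Zᵏ)
          ≈⟨ *-cong (trans eq (*-congˡ (h≈ μ))) (trans (sym (^-homo-* (Z x) k k))
            (reflexive (≡.cong (Z x ^_) (≡.sym length-Qs)))) ⟩
        (δ x * δ x * (ch * rootProduct ss μ)) * Z x ^ length Qs
          ≈⟨ solve 4 (λ d c p z → (d :* d :* (c :* p)) :* z := d :* d :* (c :* (z :* p))) refl (δ x) ch
            (rootProduct ss μ) (Z x ^ length Qs) ⟩
        δ x * δ x * (ch * (Z x ^ length Qs * rootProduct ss μ))
          ≈⟨ *-congˡ (*-congˡ (trans (sym (detProduct-projective ss-Qs μ (Z x))) (detProduct-cong Qs
               (trans (*-comm μ (Z x)) (trans Zμ (+-congˡ (sym (*-identityʳ m₂)))) , +-congˡ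
                 (sym (*-identityʳ m₄)))))) ⟩
        δ x * δ x * G x ∎
        where
        Zᵏ = Z x ^ k

      s²f≈δ²G : ∀ x → s x * s x * f x ≈ δ x * δ x * G x
      s²f≈δ²G = agree (s-poly *ᵖ s-poly *ᵖ f-poly) (δ-poly *ᵖ δ-poly *ᵖ isPoly G-degree)
        (cofinitely-map (λ (_ , Zμ , eq) → at-point Zμ eq) points)
        where
        s-poly : IsPoly s
        s-poly = β-poly *ᵖ ^-poly Z-poly k

      Similar : Set (c ⊔ ℓ)
      Similar = ∃[ M ] ∃[ e ] ¬ determinant M ≈ 0# × ¬ e ≈ 0# × ∀ X → form (e * e * cf) Ps X ≈ form ch Qs (M ·² X)

      module _ {e : Carrier} (e²f≈G : ∀ x → e * e * f x ≈ G x) where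

        on-chart : ∀ μ z → form (e * e * cf) Ps (μ * z , z) ≈ form ch Qs (M ·² (μ * z , z))
        on-chart μ z = begin
          e * e * cf * detProduct Ps (μ * z , z)
            ≈⟨ *-congˡ (detProduct-projective rs-Ps μ z) ⟩
          e * e * cf * (z ^ length Ps * rootProduct rs μ)
            ≈⟨ solve 4 (λ e c z p → e :* e :* c :* (z :* p) := z :* (e :* e :* (c :* p))) refl e cf (z ^ length Ps)
              (rootProduct rs μ) ⟩
          z ^ length Ps * (e * e * (cf * rootProduct rs μ))
            ≈⟨ *-cong (reflexive (≡.cong (z ^_) (≡.trans length-Ps (≡.sym length-Qs))))
              (trans (*-congˡ (sym (f≈ μ))) (e²f≈G μ)) ⟩
          z ^ length Qs * (ch * detProduct Qs (M ·² (μ , 1#)))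
            ≈⟨ solve 3 (λ z c p → z :* (c :* p) := c :* (z :* p)) refl (z ^ length Qs) ch
              (detProduct Qs (M ·² (μ , 1#))) ⟩
          ch * (z ^ length Qs * detProduct Qs (M ·² (μ , 1#)))
            ≈⟨ *-congˡ (trans (sym (detProduct-scale Qs z (M ·² (μ , 1#))))
              (detProduct-cong Qs (sym (proj₁ (·²-scale M μ z)) , sym (proj₂ (·²-scale M μ z))))) ⟩
          form ch Qs (M ·² (μ * z , z)) ∎

        everywhere : ∀ X → form (e * e * cf) Ps X ≈ form ch Qs (M ·² X)
        -- The chart z ≠ 0 consists of the points with det X (1 , 0) ≠ 0, so `forms-agree` extends
        -- the identity to z = 0.
        everywhere X = trans (forms-agree Ps (map (adjugate M ·²_) Qs) (1# , 0#) (λ (1≈0 , _) → 1≉0 1≈0) off-∞ X)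
          (*-congˡ (sym (detProduct-map {adjugate M} (M ·²_) (det-adjoint M) Qs X)))
          where
          off-∞ : ∀ X → ¬ det X (1# , 0#) ≈ 0# → form (e * e * cf) Ps X ≈ form ch (map (adjugate M ·²_) Qs) X
          off-∞ (x , z) ≉0 = scaled (inverse z λ z≈0 → ≉0 (trans
            (solve 2 (λ x z → x :* :0 :- z :* :1 := :- z) refl x z) (trans (-‿cong z≈0) -0#≈0#)))
            where
            scaled : ∃[ i ] z * i ≈ 1# → form (e * e * cf) Ps (x , z) ≈ form ch (map (adjugate M ·²_) Qs) (x , z)
            scaled (i , zi≈1) = begin
              form (e * e * cf) Ps (x , z)             ≈⟨ *-congˡ (detProduct-cong Ps X≈) ⟩
              form (e * e * cf) Ps (x * i * z , z)     ≈⟨ on-chart (x * i) z ⟩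
              form ch Qs (M ·² (x * i * z , z))       
                ≈⟨ *-congˡ (detProduct-map {adjugate M} (M ·²_) (det-adjoint M) Qs (x * i * z , z)) ⟩
              form ch (map (adjugate M ·²_) Qs) (x * i * z , z)
                ≈⟨ *-congˡ (detProduct-cong (map (adjugate M ·²_) Qs) X≈) ⟨
              form ch (map (adjugate M ·²_) Qs) (x , z) ∎
              where
              X≈ : (x , z) ≈² (x * i * z , z)
              X≈ = sym (trans (*-assoc x i z) (trans (*-congˡ (trans (*-comm i z) zi≈1)) (*-identityʳ x))) , refl

      -- f has degree at least 2k - 1, while every element of `ts` adds 2 to a sum that is at most
      -- 2k.
      no-factors : ∀ (ts : List Carrier) → length ts ℕ.+ (length ts ℕ.+ length rs) ≤ k ℕ.+ k → ts ≡ []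
      no-factors []       _   = ≡.refl
      no-factors (t ∷ ts) len = contradiction (ℕ.≤-trans
        (ℕ.≤-trans (ℕ.+-monoʳ-≤ 1 (s≤s (ℕ.m≤n+m (length rs) (length ts))))
        (ℕ.≤-trans (ℕ.+-monoʳ-≤ 1 (ℕ.m≤n+m _ (length ts))) len))
          (ℕ.≤-trans (ℕ.≤-reflexive (≡.sym length-Ps)) (length-projective rs-Ps))) (ℕ.<-irrefl ≡.refl)

    -- Once the squares are cancelled and `ts` is known to be empty, l²f = κ²G with constants l and
    -- κ; hence e = l/κ.
    forms-similar : Similar
    forms-similar = go (squarefree-degree {s = s} {δ = δ} (cf , rs , cf≉0 , f≈)
      (factored-* β-factored (^-factored Z-factored k)) δ-factored
      (β-poly *ᵖ ^-poly Z-poly k) f-poly G-degree f-squarefree s²f≈δ²G)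
      where
      go : ∃[ l ] ∃[ ts ] ∃[ κ ] ¬ l ≈ 0# × ¬ κ ≈ 0# ×
        (∀ x → (l * rootProduct ts x) * (l * rootProduct ts x) * f x ≈ κ * κ * G x) × length ts ℕ.+
          (length ts ℕ.+ length rs) ≤ k ℕ.+ k → Similar
      go (l , ts , κ , l≉0 , κ≉0 , eq , len) with no-factors ts len
      ... | ≡.refl = divide (inverse κ κ≉0)
        where
        divide : ∃[ i ] κ * i ≈ 1# → Similar
        divide (i , κi≈1) = M , l * i , det≉0 , *≉0 l≉0 i≉0 , everywhere λ x → begin
          (l * i) * (l * i) * f x
            ≈⟨ solve 3 (λ l i f → (l :* i) :* (l :* i) :* f := (i :* i) :* ((l :* :1) :* (l :* :1) :* f)) refl l i
              (f x) ⟩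
          (i * i) * ((l * 1#) * (l * 1#) * f x)
            ≈⟨ *-congˡ (eq x) ⟩
          (i * i) * (κ * κ * G x)
            ≈⟨ solve 3 (λ k i g → (i :* i) :* (k :* k :* g) := (k :* i) :* (k :* i) :* g) refl κ i (G x) ⟩
          (κ * i) * (κ * i) * G x
            ≈⟨ *-congʳ (trans (*-cong κi≈1 κi≈1) (*-identityˡ 1#)) ⟩
          1# * G x
            ≈⟨ *-identityˡ (G x) ⟩
          G x ∎
          where
          i≉0 : ¬ i ≈ 0#
          i≉0 i≈0 = 1≉0 (trans (sym κi≈1) (trans (*-congˡ i≈0) (zeroʳ κ)))

  determinant-adjugate : ∀ M → determinant (adjugate M) ≈ determinant M
  determinant-adjugate (matrix a b c d) = solve 4 (λ a b c d → d :* a :- (:- b) :* (:- c) := a :* d :- b :* c) refl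
    a b c d

  ·²-nonzero : ∀ M → ¬ determinant M ≈ 0# → ∀ {P} → NonzeroPoint P → NonzeroPoint (M ·² P)
  ·²-nonzero M det≉0 {P} P≢0 (x≈0 , z≈0) = P≢0
    (*-nonzero det≉0 (trans (sym (proj₁ (inverse-adjugate M P)))
      (vanish (Matrix.m₁ (adjugate M)) (Matrix.m₂ (adjugate M)))) ,
     *-nonzero det≉0 (trans (sym (proj₂ (inverse-adjugate M P)))
       (vanish (Matrix.m₃ (adjugate M)) (Matrix.m₄ (adjugate M)))))
    where
    vanish : ∀ a b → a * proj₁ (M ·² P) + b * proj₂ (M ·² P) ≈ 0#
    vanish a b = trans (+-cong (trans (*-congˡ x≈0) (zeroʳ a)) (trans (*-congˡ z≈0) (zeroʳ b))) (+-identityˡ 0#)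

  module _
    {k l e : Carrier} {Ps Qs : List Point} (M : Matrix)
    (similar : ∀ X → form (e * e * k) Ps X ≈ form l Qs (M ·² X)) where
    private
      d = determinant M

    -- Substituting the adjugate of M applied to X frees the argument of the form of h, so that its
    -- integrality can be used at any integral point. The power of d arises because M times its
    -- adjugate is multiplication by d.
    similar-values : ∀ X → d ^ length Qs * form l Qs X ≈ e * e * k * detProduct (map (M ·²_) Ps) X
    similar-values X = begin
      d ^ length Qs * (l * detProduct Qs X)
        ≈⟨ solve 3 (λ d l p → d :* (l :* p) := l :* (d :* p)) refl (d ^ length Qs) l (detProduct Qs X) ⟩
      l * (d ^ length Qs * detProduct Qs X)
        ≈⟨ *-congˡ (detProduct-scale Qs d X) ⟨
      l * detProduct Qs (d *² X)
        ≈⟨ *-congˡ (detProduct-cong Qs (adjugate-inverse M X)) ⟨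
      form l Qs (M ·² adjugate M ·² X)
        ≈⟨ similar (adjugate M ·² X) ⟨
      form (e * e * k) Ps (adjugate M ·² X)
        ≈⟨ *-congˡ (detProduct-map {M} (adjugate M ·²_) (det-adjointʳ M) Ps X) ⟩
      e * e * k * detProduct (map (M ·²_) Ps) X ∎

    -- The constant e²k enters the discriminant with exponent 2n, whence e^(4n); the substitution
    -- contributes d² for each pair of zeros.
    similar-discriminants : ∀ n → length Ps ≡ suc n → length Qs ≡ suc n → ¬ e ≈ 0# → ¬ k ≈ 0# → ¬ l ≈ 0# → ¬ d ≈ 0# →
      All NonzeroPoint Ps → All NonzeroPoint Qs →
      ((e * e) * (e * e)) ^ n * ((k * k) ^ n * discriminantOf Ps) ≈ (d * d) ^ triangular (suc n) *
        ((l * l) ^ n * discriminantOf Qs)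
    similar-discriminants n len len′ e≉0 k≉0 l≉0 d≉0 Ps≢0 Qs≢0 = begin
      ((e * e) * (e * e)) ^ n * ((k * k) ^ n * discriminantOf Ps)
        ≈⟨ *-assoc _ _ _ ⟨
      ((e * e) * (e * e)) ^ n * (k * k) ^ n * discriminantOf Ps
        ≈⟨ *-congʳ (trans (sym (^-distrib-* ((e * e) * (e * e)) (k * k) n))
             (^-congˡ n (solve 2 (λ a k → (a :* a) :* (k :* k) := (a :* k) :* (a :* k)) refl (e * e) k))) ⟩
      ((e * e * k) * (e * e * k)) ^ n * discriminantOf Ps
        ≈⟨ discriminant-invariant n Ps (map (adjugate M ·²_) Qs) len (≡.trans (List.length-map _ Qs) len′)
             (*≉0 (*≉0 e≉0 e≉0) k≉0) l≉0 Ps≢0 (All.map⁺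
               (All.map (λ {P} → ·²-nonzero (adjugate M) (d≉0 ∘ trans (sym (determinant-adjugate M))) {P}) Qs≢0))
             (λ X → trans (similar X) (*-congˡ (detProduct-map {adjugate M} (M ·²_) (det-adjoint M) Qs X))) ⟩
      (l * l) ^ n * discriminantOf (map (adjugate M ·²_) Qs)
        ≈⟨ *-congˡ (discriminant-map (adjugate M) Qs) ⟩
      (l * l) ^ n * ((determinant (adjugate M) * determinant (adjugate M)) ^ triangular (length Qs) * discriminantOf
        Qs)
        ≈⟨ *-congˡ (*-congʳ (trans (^-congˡ (triangular (length Qs))
          (*-cong (determinant-adjugate M) (determinant-adjugate M)))
             (reflexive (≡.cong (λ m → (d * d) ^ triangular m) len′)))) ⟩
      (l * l) ^ n * ((d * d) ^ triangular (suc n) * discriminantOf Qs)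
        ≈⟨ solve 3 (λ a b c → a :* (b :* c) := b :* (a :* c)) refl ((l * l) ^ n) ((d * d) ^ triangular (suc n))
          (discriminantOf Qs) ⟩
      (d * d) ^ triangular (suc n) * ((l * l) ^ n * discriminantOf Qs) ∎

-- Order and addition on ℚ ∪ {∞}.

module Values where
  open RawMonoidDefs ℚ.+-0-rawMonoid public using () renaming (_×_ to _⊗_)

  ≤∞-refl : ∀ {a} → a ≤⁺ a
  ≤∞-refl {[ _ ]} = NonStrict.[ ℚ.≤-refl ]
  ≤∞-refl {⊤⁺}    = ⊤⁺ ≤⊤⁺

  ≤∞-reflexive : ∀ {a b} → a ≡ b → a ≤⁺ b
  ≤∞-reflexive ≡.refl = ≤∞-refl

  ≤∞-trans : ∀ {a b d} → a ≤⁺ b → b ≤⁺ d → a ≤⁺ d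
  ≤∞-trans = ≤⁺-trans ℚ.≤-trans

  _≤∞?_ : Decidable _≤⁺_
  _≤∞?_ = ≤⁺-dec ℚ._≤?_

  _≟∞_ : Decidable (_≡_ {A = ℚ∞})
  _≟∞_ = ≡-dec ℚ._≟_

  +∞-identityˡ : ∀ a → 0∞ +∞ a ≡ a
  +∞-identityˡ [ q ] = ≡.cong [_] (ℚ.+-identityˡ q)
  +∞-identityˡ ⊤⁺    = ≡.refl

  +∞-identityʳ : ∀ a → a +∞ 0∞ ≡ a
  +∞-identityʳ [ q ] = ≡.cong [_] (ℚ.+-identityʳ q)
  +∞-identityʳ ⊤⁺    = ≡.refl

  +∞-mono : ∀ {a b d e} → a ≤⁺ b → d ≤⁺ e → a +∞ d ≤⁺ b +∞ e
  +∞-mono NonStrict.[ p ] NonStrict.[ q ] = NonStrict.[ ℚ.+-mono-≤ p q ]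
  +∞-mono {b = [ _ ]} _   (_ ≤⊤⁺)         = _ ≤⊤⁺
  +∞-mono (_ ≤⊤⁺)         _               = _ ≤⊤⁺

  ⊓∞-glb : ∀ {a b d} → a ≤⁺ b → a ≤⁺ d → a ≤⁺ b ⊓∞ d
  ⊓∞-glb {b = [ _ ]} {[ _ ]} NonStrict.[ p ] NonStrict.[ q ] = NonStrict.[ ℚ.⊓-glb p q ]
  ⊓∞-glb {b = [ _ ]} {⊤⁺}    p _ = p
  ⊓∞-glb {b = ⊤⁺}            _ q = q

  ⊓∞-glb-< : ∀ {a b d} → a <⁺ b → a <⁺ d → a <⁺ b ⊓∞ d
  ⊓∞-glb-< {b = [ p ]} {[ q ]} Strict.[ a<p ] Strict.[ a<q ] with ℚ.⊓-sel p q
  ... | inj₁ eq = Strict.[ ≡.subst (_ ℚ.<_) (≡.sym eq) a<p ]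
  ... | inj₂ eq = Strict.[ ≡.subst (_ ℚ.<_) (≡.sym eq) a<q ]
  ⊓∞-glb-< {b = [ _ ]} {⊤⁺}    p _ = p
  ⊓∞-glb-< {b = ⊤⁺}            _ q = q

  <-≤∞-trans : ∀ {a b d} → a <⁺ b → b ≤⁺ d → a <⁺ d
  <-≤∞-trans Strict.[ p ] NonStrict.[ q ] = Strict.[ ℚ.<-≤-trans p q ]
  <-≤∞-trans Strict.[ _ ] (_ ≤⊤⁺)         = Strict.[ _ ]<⊤⁺
  <-≤∞-trans [ _ ]<⊤⁺     (_ ≤⊤⁺)         = Strict.[ _ ]<⊤⁺

  ≤-<∞-trans : ∀ {a b d} → a ≤⁺ b → b <⁺ d → a <⁺ d
  ≤-<∞-trans NonStrict.[ p ] Strict.[ q ] = Strict.[ ℚ.≤-<-trans p q ]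
  ≤-<∞-trans NonStrict.[ p ] [ _ ]<⊤⁺     = Strict.[ _ ]<⊤⁺

  <∞⇒≤∞ : ∀ {a b} → a <⁺ b → a ≤⁺ b
  <∞⇒≤∞ Strict.[ p ] = NonStrict.[ ℚ.<⇒≤ p ]
  <∞⇒≤∞ [ _ ]<⊤⁺     = _ ≤⊤⁺

  <∞⇒≢ : ∀ {a b} → a <⁺ b → ¬ b ≡ a
  <∞⇒≢ Strict.[ p ] eq = ℚ.<⇒≢ p (≡.sym ([]-injective eq))
  <∞⇒≢ [ _ ]<⊤⁺     ()

  ≤∞∧≢⇒<∞ : ∀ {a b} → [ a ] ≤⁺ b → ¬ b ≡ [ a ] → [ a ] <⁺ b
  ≤∞∧≢⇒<∞ NonStrict.[ p ] ≢a = Strict.[ ℚ.≰⇒> (λ q → ≢a (≡.cong [_] (ℚ.≤-antisym q p))) ]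
  ≤∞∧≢⇒<∞ (_ ≤⊤⁺)         _  = Strict.[ _ ]<⊤⁺

  ≰∞⇒>∞ : ∀ {a b} → ¬ a ≤⁺ [ b ] → [ b ] <⁺ a
  ≰∞⇒>∞ {[ _ ]} ≰b = Strict.[ ℚ.≰⇒> (≰b ∘ NonStrict.[_]) ]
  ≰∞⇒>∞ {⊤⁺}    _  = Strict.[ _ ]<⊤⁺

  +-cancelˡ-≤ : ∀ p {q r} → p ℚ.+ q ℚ.≤ p ℚ.+ r → q ℚ.≤ r
  +-cancelˡ-≤ p {q} {r} le = ≡.subst₂ ℚ._≤_ (undo q) (undo r) (ℚ.+-monoʳ-≤ (ℚ.- p) le)
    where
    undo : ∀ q → ℚ.- p ℚ.+ (p ℚ.+ q) ≡ q
    undo q = ≡.trans (≡.sym (ℚ.+-assoc (ℚ.- p) p q)) (≡.trans (≡.cong (ℚ._+ q) (ℚ.+-inverseˡ p)) (ℚ.+-identityˡ q))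

  interchange : ∀ p q r s → (p ℚ.+ q) ℚ.+ (r ℚ.+ s) ≡ (p ℚ.+ r) ℚ.+ (q ℚ.+ s)
  interchange p q r s = ≡.trans (ℚ.+-assoc p q (r ℚ.+ s)) (≡.trans (≡.cong (p ℚ.+_)
    (≡.trans (≡.sym (ℚ.+-assoc q r s)) (≡.trans (≡.cong (ℚ._+ s) (ℚ.+-comm q r)) (ℚ.+-assoc r q s))))
      (≡.sym (ℚ.+-assoc p r (q ℚ.+ s))))

  -- Of 2k numbers at most k equal τ, and the others equal σ ≤ τ.
  majority : ∀ {σ τ} → σ ℚ.≤ τ → ∀ k m n → m ℕ.≤ k → m ℕ.+ n ≡ k ℕ.+ k → m ⊗ τ ℚ.+ n ⊗ σ ℚ.≤ k ⊗ (τ ℚ.+ σ)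
  majority         σ≤τ zero    zero    zero    _         _  = ℚ.≤-reflexive (ℚ.+-identityˡ 0ℚ)
  majority {σ} {τ} σ≤τ (suc k) zero    n       m≤k       eq = ℚ.≤-trans
    (ℚ.≤-reflexive (≡.trans (ℚ.+-identityˡ _) (≡.trans (≡.cong (_⊗ σ) (≡.trans eq (≡.cong suc (ℕ.+-suc k k))))
      (≡.trans (≡.sym (ℚ.+-assoc σ σ _)) (≡.cong ((σ ℚ.+ σ) ℚ.+_) (≡.sym (ℚ.+-identityˡ _)))))))
    (ℚ.+-mono-≤ (ℚ.+-monoˡ-≤ σ σ≤τ) (majority σ≤τ k 0 (k ℕ.+ k) z≤n ≡.refl))
  majority         σ≤τ (suc k) (suc m) zero    (s≤s m≤k) eq = contradiction
    (ℕ.≤-trans (s≤s (ℕ.m≤n+m (suc k) k)) (ℕ.≤-trans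
      (ℕ.≤-reflexive (≡.sym (≡.trans (≡.sym (ℕ.+-identityʳ (suc m))) eq))) (s≤s m≤k)))
    (ℕ.<-irrefl ≡.refl)
  majority {σ} {τ} σ≤τ (suc k) (suc m) (suc n) (s≤s m≤k) eq = ℚ.≤-trans
    (ℚ.≤-reflexive (interchange τ (m ⊗ τ) σ (n ⊗ σ)))
    (ℚ.+-monoʳ-≤ (τ ℚ.+ σ) (majority σ≤τ k m n m≤k (ℕ.suc-injective (ℕ.suc-injective
      (≡.trans (≡.sym (≡.cong suc (ℕ.+-suc m n))) (≡.trans eq (≡.cong suc (ℕ.+-suc k k))))))))

-- Algebraically closed valued fields.

module ValuedField
  {c ℓ} (F : Field c ℓ) (v : Field.Carrier F → ℚ∞) (isValuation : IsValuation F v)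
  (closed : Polynomials.AlgebraicallyClosed F) where
  open IsValuation isValuation
  open Values public

  -- The valuation decides equality, since it is visible whether v(x - y) is ∞. All case
  -- distinctions on elements of the closure rest on this.
  v-decide : Decidable (Field._≈_ F)
  v-decide x y with v (Field._-_ F x y) in eq
  ... | ⊤⁺    = yes (GroupProperties.x∙y⁻¹≈ε⇒x≈y (Field.+-group F) x y (Equivalence.to (v-∞ _) eq))
  ... | [ q ] = no λ x≈y → finite≢⊤ (≡.trans (≡.sym eq)
    (Equivalence.from (v-∞ _) (GroupProperties.x≈y⇒x∙y⁻¹≈ε (Field.+-group F) x≈y)))
    where
    finite≢⊤ : ¬ [ q ] ≡ ⊤⁺
    finite≢⊤ ()

  open PolynomialFunctions F v-decide closed public

  -- The value at `⊤⁺` is arbitrary; `v-ord` recovers v from `ord` for nonzero elements.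
  finite-part : ℚ∞ → ℚ
  finite-part [ q ] = q
  finite-part ⊤⁺    = 0ℚ

  ord : Carrier → ℚ
  ord x = finite-part (v x)

  v-ord : ∀ {x} → ¬ x ≈ 0# → v x ≡ [ ord x ]
  v-ord {x} x≉0 with v x in eq
  ... | [ q ] = ≡.refl
  ... | ⊤⁺    = contradiction (Equivalence.to (v-∞ x) eq) x≉0

  ord-unique : ∀ {x q} → v x ≡ [ q ] → ord x ≡ q
  ord-unique eq = ≡.cong finite-part eq

  v-finite⇒≉0 : ∀ {x q} → v x ≡ [ q ] → ¬ x ≈ 0#
  v-finite⇒≉0 {x} vx x≈0 with ≡.trans (≡.sym vx) (Equivalence.from (v-∞ x) x≈0)
  ... | ()

  v-0 : ∀ {x} → x ≈ 0# → v x ≡ ⊤⁺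
  v-0 = Equivalence.from (v-∞ _)

  ord-cong : ∀ {x y} → x ≈ y → ord x ≡ ord y
  ord-cong x≈y = ≡.cong finite-part (v-cong x≈y)

  ord-* : ∀ {x y} → ¬ x ≈ 0# → ¬ y ≈ 0# → ord (x * y) ≡ ord x ℚ.+ ord y
  ord-* x≉0 y≉0 = ord-unique (≡.trans (v-* _ _) (≡.cong₂ _+∞_ (v-ord x≉0) (v-ord y≉0)))

  ord-1 : ord 1# ≡ 0ℚ
  ord-1 = GroupProperties.∙-cancelˡ ℚ.+-0-group (ord 1#) (ord 1#) 0ℚ
    (≡.trans (≡.sym (ord-* 1≉0 1≉0)) (≡.trans (ord-cong (*-identityˡ 1#)) (≡.sym (ℚ.+-identityʳ _))))

  v-1 : v 1# ≡ 0∞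
  v-1 = ≡.trans (v-ord 1≉0) (≡.cong [_] ord-1)

  p+p≡0⇒p≡0 : ∀ p → p ℚ.+ p ≡ 0ℚ → p ≡ 0ℚ
  p+p≡0⇒p≡0 p eq = ℚ.≤-antisym (ℚ.≮⇒≥ λ 0<p → ℚ.<⇒≢ (ℚ.+-mono-< 0<p 0<p) (≡.trans (ℚ.+-identityˡ 0ℚ) (≡.sym eq)))
    (ℚ.≮⇒≥ λ p<0 → ℚ.<⇒≢ (ℚ.+-mono-< p<0 p<0) (≡.trans eq (≡.sym (ℚ.+-identityˡ 0ℚ))))

  v-‿1 : v (- 1#) ≡ 0∞
  v-‿1 = ≡.trans (v-ord -1≉0) (≡.cong [_] (p+p≡0⇒p≡0 _ (≡.trans (≡.sym (ord-* -1≉0 -1≉0))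
    (≡.trans (ord-cong square) ord-1))))
    where
    square : - 1# * - 1# ≈ 1#
    square = trans (neg* 1#) (*-identityˡ 1#)
      where
      neg* : ∀ z → - z * - z ≈ z * z
      neg* = solve 1 (λ z → (:- z) :* (:- z) := z :* z) refl

  v-neg : ∀ x → v (- x) ≡ v x
  v-neg x = ≡.trans (v-cong (solve 1 (λ x → :- x := (:- :1) :* x) refl x))
    (≡.trans (v-* (- 1#) x) (≡.trans (≡.cong (_+∞ v x) v-‿1) (+∞-identityˡ (v x))))

  v-+-≤ : ∀ {a x y} → a ≤⁺ v x → a ≤⁺ v y → a ≤⁺ v (x + y)
  v-+-≤ p q = ≤∞-trans (⊓∞-glb p q) (v-+ _ _)

  v-sub-≤ : ∀ {a x y} → a ≤⁺ v x → a ≤⁺ v y → a ≤⁺ v (x - y)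
  v-sub-≤ p q = v-+-≤ p (≤∞-trans q (≤∞-reflexive (≡.sym (v-neg _))))

  v-sub-< : ∀ {a x y} → a <⁺ v x → a <⁺ v y → a <⁺ v (x - y)
  v-sub-< p q = <-≤∞-trans (⊓∞-glb-< p (<-≤∞-trans q (≤∞-reflexive (≡.sym (v-neg _))))) (v-+ _ _)

  Integral : Carrier → Set
  Integral x = 0∞ ≤⁺ v x

  Unit : Carrier → Set
  Unit x = v x ≡ 0∞

  unit⇒integral : ∀ {x} → Unit x → Integral x
  unit⇒integral ux = ≤∞-reflexive (≡.sym ux)

  integral-* : ∀ {x y} → Integral x → Integral y → Integral (x * y)
  integral-* {x} {y} ix iy = ≤∞-trans (+∞-mono ix iy) (≤∞-reflexive (≡.sym (v-* x y)))

  integral-1 : Integral 1#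
  integral-1 = unit⇒integral v-1

  integral-eval : ∀ p {x} → (∀ n → Integral (coeff p n)) → Integral x → Integral (eval p x)
  integral-eval []      ip ix = ip 0
  integral-eval (a ∷ p) ip ix = v-+-≤ (ip 0) (integral-* ix (integral-eval p (ip ∘ suc) ix))

  -- Otherwise x and x - y would both have positive valuation, and so would their difference y.
  unit-sub : ∀ {x y} → 0∞ <⁺ v x → Unit y → Unit (x - y)
  unit-sub {x} {y} 0<x uy with v (x - y) ≟∞ 0∞
  ... | yes u  = u
  ... | no  ¬u = contradiction uy (<∞⇒≢ (<-≤∞-trans
    (v-sub-< 0<x (≤∞∧≢⇒<∞ (v-sub-≤ (<∞⇒≤∞ 0<x) (unit⇒integral uy)) ¬u))
    (≤∞-reflexive (v-cong (solve 2 (λ x y → x :- (x :- y) := y) refl x y)))))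

  unit-factors : ∀ {x y} → Integral x → Integral y → Unit (x * y) → Unit x × Unit y
  unit-factors {x} {y} ix iy uxy = unit ix iy (≡.trans (≡.sym (v-* x y)) uxy) , unit iy ix
    (≡.trans (≡.sym (v-* y x)) (≡.trans (v-cong (*-comm y x)) uxy))
    where
    unit : ∀ {a b} → 0∞ ≤⁺ a → 0∞ ≤⁺ b → a +∞ b ≡ 0∞ → a ≡ 0∞
    unit {[ p ]} {[ q ]} NonStrict.[ 0≤p ] NonStrict.[ 0≤q ] eq = ≡.cong [_] (ℚ.≤-antisym
      (ℚ.≤-trans (ℚ.≤-reflexive (≡.sym (ℚ.+-identityʳ p)))
        (ℚ.≤-trans (ℚ.+-monoʳ-≤ p 0≤q) (ℚ.≤-reflexive ([]-injective eq)))) 0≤p)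

  -- A root of ∏ (X - y) + 1 is congruent to none of the y modulo the maximal ideal.
  generic : ∀ ys → All Integral ys → ∃[ ξ ] Integral ξ × All (λ y → Unit (ξ - y)) ys
  -- `0#` is added so that the product is nonconstant also for empty `ys`; its factor is discarded
  -- at the end.
  generic ys iys = go (unit-rootProduct 0# ys)
    where
    go : ∃[ ξ ] rootProduct (0# ∷ ys) ξ ≈ - 1# → ∃[ ξ ] Integral ξ × All (λ y → Unit (ξ - y)) ys
    go (ξ , eq) = ξ , iξ , units ys iys (proj₂
      (unit-factors (v-sub-≤ iξ i0) (integral-product ys iys) (≡.trans (v-cong eq) v-‿1)))
      where
      i0 : Integral 0#
      i0 = ≤∞-trans (_ ≤⊤⁺) (≤∞-reflexive (≡.sym (v-0 refl)))

      negative-+ : ∀ {a b} → a <⁺ 0∞ → b ≤⁺ 0∞ → a +∞ b <⁺ 0∞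
      negative-+ Strict.[ p ] NonStrict.[ q ] = Strict.[ ℚ.<-≤-trans (ℚ.+-mono-<-≤ p q)
        (ℚ.≤-reflexive (ℚ.+-identityʳ 0ℚ)) ]

      negative-product : ¬ Integral ξ → ∀ y ys → All Integral (y ∷ ys) → v (rootProduct (y ∷ ys) ξ) <⁺ 0∞
      negative-product ¬iξ y ys (iy ∷ iys) = ≤-<∞-trans (≤∞-reflexive (v-* _ _))
        (negative-+ (negative (v (ξ - y)) ¬iξ-y) (rest ys iys))
        where
        ¬iξ-y : ¬ Integral (ξ - y)
        ¬iξ-y i = ¬iξ (≤∞-trans (v-+-≤ i iy) (≤∞-reflexive (v-cong (solve 2 (λ x y → x :- y :+ y := x) refl ξ y))))

        negative : ∀ a → ¬ 0∞ ≤⁺ a → a <⁺ 0∞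
        negative [ q ] ≰ = Strict.[ ℚ.≰⇒> (≰ ∘ NonStrict.[_]) ]
        negative ⊤⁺    ≰ = contradiction (_ ≤⊤⁺) ≰

        rest : ∀ ys → All Integral ys → v (rootProduct ys ξ) ≤⁺ 0∞
        rest []       []         = ≤∞-reflexive v-1
        rest (y ∷ ys) (iy ∷ iys) = <∞⇒≤∞ (negative-product ¬iξ y ys (iy ∷ iys))

      -- If ξ had negative valuation, so would every ξ - y and hence the product, whose value -1 is
      -- a unit.
      iξ : Integral ξ
      iξ with 0∞ ≤∞? v ξ
      ... | yes i = i
      ... | no ¬i = contradiction (≡.trans (≡.sym v-‿1) (v-cong (sym eq)))
        (<∞⇒≢ (negative-product ¬i 0# ys (i0 ∷ iys)))

      integral-product : ∀ ys → All Integral ys → Integral (rootProduct ys ξ)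
      integral-product []       []         = integral-1
      integral-product (y ∷ ys) (iy ∷ iys) = integral-* (v-sub-≤ iξ iy) (integral-product ys iys)

      units : ∀ ys → All Integral ys → Unit (rootProduct ys ξ) → All (λ y → Unit (ξ - y)) ys
      units []       []         _ = []
      units (y ∷ ys) (iy ∷ iys) u = let u₁ , u₂ = unit-factors (v-sub-≤ iξ iy) (integral-product ys iys) u in u₁ ∷
        units ys iys u₂

  ord-^ : ∀ {x} → ¬ x ≈ 0# → ∀ n → ord (x ^ n) ≡ n ⊗ ord x
  ord-^ x≉0 zero    = ord-1
  ord-^ x≉0 (suc n) = ≡.trans (ord-* x≉0 (^≉0 x≉0 n)) (≡.cong (ord _ ℚ.+_) (ord-^ x≉0 n))

  -- A coordinate of least valuation, chosen as an element so that the point can be divided by it.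
  scale : Point → Carrier
  scale (x , z) with v z ≤∞? v x
  ... | yes _ = z
  ... | no  _ = x

  -- Primitive coordinates in the two charts of the projective line over the ring of integers; the
  -- second constructor covers the points that reduce to infinity.
  data Direction : Point → Set (c ⊔ ℓ) where
    integral-ratio    : ∀ {y} → Integral y → Direction (y , 1#)
    nonintegral-ratio : ∀ {w} → 0∞ <⁺ v w → Direction (1# , w)

  record Normalised (P : Point) : Set (c ⊔ ℓ) where
    field
      scale≉0   : ¬ scale P ≈ 0#
      point     : Point
      direction : Direction point
      P≈        : P ≈² scale P *² point

  normalise : ∀ P → NonzeroPoint P → Normalised P
  normalise P@(x , z) P≢0 with v z ≤∞? v x in eq
  ... | yes vz≤vx = go (inverse z z≉0)
    where
    scale≡z : scale P ≡ z
    scale≡z rewrite eq = ≡.refl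

    z≉0 : ¬ z ≈ 0#
    z≉0 z≈0 = P≢0 (Equivalence.to (v-∞ x) (top (≡.subst (_≤⁺ v x) (v-0 z≈0) vz≤vx)) , z≈0)
      where
      top : ∀ {a} → ⊤⁺ ≤⁺ a → a ≡ ⊤⁺
      top (_ ≤⊤⁺) = ≡.refl

    go : ∃[ i ] z * i ≈ 1# → Normalised P
    go (i , zi≈1) = record
      { scale≉0   = λ eq → z≉0 (trans (reflexive (≡.sym scale≡z)) eq)
      ; point     = x * i , 1#
      ; direction = integral-ratio (cancel-v z≉0 (≤∞-trans vz≤vx (≤∞-reflexive (v-cong x≈))))
      ; P≈        = trans x≈ (*-congʳ (reflexive (≡.sym scale≡z))) , trans (sym (*-identityʳ z))
        (*-congʳ (reflexive (≡.sym scale≡z)))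
      }
      where
      x≈ : x ≈ z * (x * i)
      x≈ = sym (trans (solve 3 (λ z x i → z :* (x :* i) := (z :* i) :* x) refl z x i)
        (trans (*-congʳ zi≈1) (*-identityˡ x)))

      cancel-v : ∀ {k y} → ¬ k ≈ 0# → v k ≤⁺ v (k * y) → Integral y
      cancel-v {k} {y} k≉0 le with v y in vy
      ... | ⊤⁺    = _ ≤⊤⁺
      ... | [ q ] = NonStrict.[ +-cancelˡ-≤ (ord k) (ℚ.≤-trans (ℚ.≤-reflexive (ℚ.+-identityʳ _)) ([≤]-injective
        (≡.subst₂ _≤⁺_ (v-ord k≉0) (≡.trans (v-* k y) (≡.cong₂ _+∞_ (v-ord k≉0) vy)) le))) ]
  ... | no vz≰vx = go (inverse x x≉0)
    where
    scale≡x : scale P ≡ x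
    scale≡x rewrite eq = ≡.refl

    x≉0 : ¬ x ≈ 0#
    x≉0 x≈0 = vz≰vx (≡.subst (v z ≤⁺_) (≡.sym (v-0 x≈0)) (_ ≤⊤⁺))

    go : ∃[ i ] x * i ≈ 1# → Normalised P
    go (i , xi≈1) = record
      { scale≉0   = λ eq → x≉0 (trans (reflexive (≡.sym scale≡x)) eq)
      ; point     = 1# , z * i
      ; direction = nonintegral-ratio (positive x≉0 (≡.subst (λ a → ¬ a ≤⁺ v x) (v-cong z≈) vz≰vx))
      ; P≈        = trans (sym (*-identityʳ x)) (*-congʳ (reflexive (≡.sym scale≡x))) , trans z≈
        (*-congʳ (reflexive (≡.sym scale≡x)))
      }
      where
      z≈ : z ≈ x * (z * i)
      z≈ = sym (trans (solve 3 (λ z x i → x :* (z :* i) := (x :* i) :* z) refl z x i)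
        (trans (*-congʳ xi≈1) (*-identityˡ z)))

      positive : ∀ {k y} → ¬ k ≈ 0# → ¬ v (k * y) ≤⁺ v k → 0∞ <⁺ v y
      positive {k} {y} k≉0 ≰ = ≰∞⇒>∞ λ vy≤0 → ≰
        (≡.subst₂ _≤⁺_ (≡.sym (v-* k y)) (+∞-identityʳ (v k)) (+∞-mono (≤∞-refl {v k}) vy≤0))

  direction-integral : ∀ {X} → Direction X → Integral (proj₁ X) × Integral (proj₂ X)
  direction-integral (integral-ratio iy)     = iy , integral-1
  direction-integral (nonintegral-ratio 0<w) = integral-1 , <∞⇒≤∞ 0<w

  det-integral : ∀ {X Y} → Direction X → Direction Y → Integral (det X Y)
  det-integral dX dY = let ix , iz = direction-integral dX ; ix′ , iz′ = direction-integral dY in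
    v-sub-≤ (integral-* ix iz′) (integral-* iz ix′)

  det-scales : ∀ {k l X Y P Q} → P ≈² k *² X → Q ≈² l *² Y → det P Q ≈ k * l * det X Y
  det-scales {k} {l} {X} {Y} {P} {Q} P≈ Q≈ = trans (det-cong {P = Q} P≈) (trans (det-congʳ {k *² X} Q≈)
    (trans (det-scale k X (l *² Y)) (trans (*-congˡ (det-scaleʳ l X Y)) (sym (*-assoc k l _)))))

  -- Once the scales are extracted, the remaining coordinates are integral, and so is their
  -- determinant.
  scales≤det : ∀ P Q → NonzeroPoint P → NonzeroPoint Q → v (scale P * scale Q) ≤⁺ v (det P Q)
  scales≤det P Q P≢0 Q≢0 = ≤∞-trans (≤∞-reflexive (≡.sym (+∞-identityʳ _)))
    (≤∞-trans (+∞-mono ≤∞-refl (det-integral N.direction N′.direction))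
    (≤∞-reflexive (≡.sym (≡.trans (v-cong (det-scales {scale P} {scale Q} N.P≈ N′.P≈)) (v-* _ _)))))
    where
    module N  = Normalised (normalise P P≢0)
    module N′ = Normalised (normalise Q Q≢0)


  scaleProduct : List Point → Carrier
  scaleProduct = foldr (λ P acc → scale P * acc) 1#

  scaleProduct≉0 : ∀ {Ps} → All NonzeroPoint Ps → ¬ scaleProduct Ps ≈ 0#
  scaleProduct≉0 []            = 1≉0
  scaleProduct≉0 (P≢0 ∷ Ps≢0) = *≉0 (Normalised.scale≉0 (normalise _ P≢0)) (scaleProduct≉0 Ps≢0)

  -- Gauss's lemma: some integral point attains the content of a product of linear forms.
  content-attained : ∀ {Ps} → All NonzeroPoint Ps → ∃[ ξ ] Integral ξ × v (detProduct Ps (ξ , 1#)) ≡ v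
    (scaleProduct Ps)
  content-attained {Ps} Ps≢0 = go (generic (ratios Ps≢0) (ratios-integral Ps≢0))
    where
    -- Only the points (y , 1) restrict ξ, which must differ from y modulo the maximal ideal. For (1
    -- , w) the determinant wξ - 1, up to sign, is a unit at every integral ξ.
    ratio : ∀ {X} → Direction X → List Carrier
    ratio (integral-ratio {y} _)  = y ∷ []
    ratio (nonintegral-ratio _)   = []

    ratios : ∀ {Ps} → All NonzeroPoint Ps → List Carrier
    ratios []           = []
    ratios (P≢0 ∷ Ps≢0) = ratio (Normalised.direction (normalise _ P≢0)) ++ ratios Ps≢0

    ratio-integral : ∀ {X} (d : Direction X) → All Integral (ratio d)
    ratio-integral (integral-ratio iy)   = iy ∷ []
    ratio-integral (nonintegral-ratio _) = []

    ratios-integral : ∀ {Ps} (Ps≢0 : All NonzeroPoint Ps) → All Integral (ratios Ps≢0)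
    ratios-integral []           = []
    ratios-integral (P≢0 ∷ Ps≢0) = All.++⁺ (ratio-integral (Normalised.direction (normalise _ P≢0)))
      (ratios-integral Ps≢0)

    go : ∃[ ξ ] Integral ξ × All (λ y → Unit (ξ - y)) (ratios Ps≢0) → ∃[ ξ ] Integral ξ × v (detProduct Ps (ξ , 1#))
      ≡ v (scaleProduct Ps)
    go (ξ , iξ , units) = ξ , iξ , product Ps≢0 units
      where
      direction-unit : ∀ {X} (d : Direction X) → All (λ y → Unit (ξ - y)) (ratio d) → Unit (det X (ξ , 1#))
      direction-unit (integral-ratio {y} _) (u ∷ []) = ≡.trans
        (v-cong (solve 2 (λ y x → y :* :1 :- :1 :* x := :- (x :- y)) refl y ξ))
        (≡.trans (v-neg _) u)
      direction-unit (nonintegral-ratio {w} 0<w) [] = ≡.trans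
        (v-cong (solve 2 (λ w x → :1 :* :1 :- w :* x := :- (w :* x :- :1)) refl w ξ))
        (≡.trans (v-neg _) (unit-sub (<-≤∞-trans 0<w
          (≤∞-trans (≤∞-reflexive (≡.sym (+∞-identityʳ (v w))))
            (≤∞-trans (+∞-mono ≤∞-refl iξ) (≤∞-reflexive (≡.sym (v-* w ξ)))))) v-1))

      factor-value : ∀ {P} (N : Normalised P) → All (λ y → Unit (ξ - y)) (ratio (Normalised.direction N)) → v
        (det (ξ , 1#) P) ≡ v (scale P)
      factor-value {P} N us = ≡.trans (v-cong value) (≡.trans (v-* _ _) (≡.trans (≡.cong₂ _+∞_ (v-ord scale≉0)
        (≡.trans (v-neg (det point (ξ , 1#))) (direction-unit direction us)))
          (≡.trans (≡.cong [_] (ℚ.+-identityʳ _)) (≡.sym (v-ord scale≉0)))))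
        where
        open Normalised N
        value : det (ξ , 1#) P ≈ scale P * - det point (ξ , 1#)
        value = trans (det-congʳ {ξ , 1#} P≈) (trans (det-scaleʳ (scale P) (ξ , 1#) point) (*-congˡ
          (solve 4 (λ x z x′ z′ → x :* z′ :- z :* x′ := :- (x′ :* z :- z′ :* x)) refl ξ 1# (proj₁ point)
            (proj₂ point))))

      product : ∀ {Ps} (Ps≢0 : All NonzeroPoint Ps) → All (λ y → Unit (ξ - y)) (ratios Ps≢0) → v
        (detProduct Ps (ξ , 1#)) ≡ v (scaleProduct Ps)
      product []           _  = ≡.refl
      product {P ∷ Ps} (P≢0 ∷ Ps≢0) us = ≡.trans (v-* _ _) (≡.trans (≡.cong₂ _+∞_
        (factor-value (normalise P P≢0) (All.++⁻ˡ (ratio (Normalised.direction (normalise P P≢0))) us))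
        (product Ps≢0 (All.++⁻ʳ (ratio (Normalised.direction (normalise P P≢0))) us))) (≡.sym (v-* _ _)))

  -- Balanced point sets

  -- For roots r and s, being near means that v(r - s) is not 0. A point counts as near itself,
  -- because det P P = 0.
  near : Point → List Point → ℕ
  near P []       = 0
  near P (Q ∷ Qs) with v (det P Q) ≟∞ 0∞
  ... | yes _ = near P Qs
  ... | no  _ = suc (near P Qs)

  far : Point → List Point → ℕ
  far P []       = 0
  far P (Q ∷ Qs) with v (det P Q) ≟∞ 0∞
  ... | yes _ = suc (far P Qs)
  ... | no  _ = far P Qs

  near+far : ∀ P Qs → near P Qs ℕ.+ far P Qs ≡ length Qs
  near+far P []       = ≡.refl
  near+far P (Q ∷ Qs) with v (det P Q) ≟∞ 0∞
  ... | yes _ = ≡.trans (ℕ.+-suc _ _) (≡.cong suc (near+far P Qs))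
  ... | no  _ = ≡.cong suc (near+far P Qs)

  module _ (w : Point → ℚ) where

    total : List Point → ℚ
    total = foldr (λ P acc → w P ℚ.+ acc) 0ℚ

    maximum : ∀ P Ps → ∃[ Q ] Any (Q ≡_) (P ∷ Ps) × All (λ R → w R ℚ.≤ w Q) (P ∷ Ps)
    maximum P []        = P , here ≡.refl , ℚ.≤-refl ∷ []
    maximum P (P′ ∷ Ps) = extend (maximum P′ Ps)
      where
      extend : ∃[ Q ] Any (Q ≡_) (P′ ∷ Ps) × All (λ R → w R ℚ.≤ w Q) (P′ ∷ Ps) →
               ∃[ Q ] Any (Q ≡_) (P ∷ P′ ∷ Ps) × All (λ R → w R ℚ.≤ w Q) (P ∷ P′ ∷ Ps)
      extend (Q , Q∈ , ≤Q) with ℚ.≤-total (w P) (w Q)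
      ... | inj₁ P≤Q = Q , there Q∈ , P≤Q ∷ ≤Q
      ... | inj₂ Q≤P = P , here ≡.refl , ℚ.≤-refl ∷ All.map (λ ≤Q → ℚ.≤-trans ≤Q Q≤P) ≤Q

    total-near-far : ∀ P {σ τ} Qs → All (λ Q → w Q ℚ.≤ τ) Qs → All (λ Q → v (det P Q) ≡ 0∞ → w Q ℚ.≤ σ) Qs →
      total Qs ℚ.≤ near P Qs ⊗ τ ℚ.+ far P Qs ⊗ σ
    total-near-far P []       []         []         = ℚ.≤-reflexive (≡.sym (ℚ.+-identityˡ 0ℚ))
    total-near-far P {σ} {τ} (Q ∷ Qs) (≤τ ∷ ≤τs) (≤σ ∷ ≤σs) with v (det P Q) ≟∞ 0∞
    ... | yes u = ℚ.≤-trans (ℚ.+-mono-≤ (≤σ u) (total-near-far P Qs ≤τs ≤σs)) (ℚ.≤-reflexive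
      (≡.trans (≡.sym (ℚ.+-assoc σ N _)) (≡.trans (≡.cong (ℚ._+ far P Qs ⊗ σ) (ℚ.+-comm σ N)) (ℚ.+-assoc N σ _))))
      where
      N = near P Qs ⊗ τ
    ... | no  _ = ℚ.≤-trans (ℚ.+-mono-≤ ≤τ (total-near-far P Qs ≤τs ≤σs)) (ℚ.≤-reflexive (≡.sym (ℚ.+-assoc τ _ _)))

    total-bound : ∀ {τ} Qs → All (λ Q → w Q ℚ.≤ τ) Qs → total Qs ℚ.≤ length Qs ⊗ τ
    total-bound []       []         = ℚ.≤-refl
    total-bound (Q ∷ Qs) (≤τ ∷ ≤τs) = ℚ.+-mono-≤ ≤τ (total-bound Qs ≤τs)

    -- Let P have the largest weight τ. A point far from P has weight at most δ - τ, and at least half of the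
    -- points are far from P.
    balanced : ∀ {δ} k Ps → length Ps ≡ k ℕ.+ k → All (λ P → near P Ps ℕ.≤ k) Ps →
      (∀ {P Q} → Any (P ≡_) Ps → Any (Q ≡_) Ps → v (det P Q) ≡ 0∞ → w P ℚ.+ w Q ℚ.≤ δ) → total Ps ℚ.≤ k ⊗ δ
    balanced zero    []       _  _ _ = ℚ.≤-refl
    balanced {δ} k Ps@(P₀ ∷ Ps₀) len near≤k pair = go (maximum P₀ Ps₀)
      where
      self : ∀ {Ps : List Point} → All (λ P → Any (P ≡_) Ps) Ps
      self {[]}     = []
      self {P ∷ Ps} = here ≡.refl ∷ All.map there self

      go : ∃[ P ] Any (P ≡_) Ps × All (λ Q → w Q ℚ.≤ w P) Ps → total Ps ℚ.≤ k ⊗ δ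
      go (P , P∈ , ≤τ) = by-cases (ℚ.≤-total σ τ)
        where
        τ = w P
        σ = ℚ.- τ ℚ.+ δ

        τ+σ≡δ : τ ℚ.+ σ ≡ δ
        τ+σ≡δ = ≡.trans (≡.sym (ℚ.+-assoc τ (ℚ.- τ) δ)) (≡.trans (≡.cong (ℚ._+ δ) (ℚ.+-inverseʳ τ)) (ℚ.+-identityˡ δ))

        near-P : near P Ps ℕ.≤ k
        near-P = look P∈ near≤k
          where
          look : ∀ {Qs} → Any (P ≡_) Qs → All (λ P → near P Ps ℕ.≤ k) Qs → near P Ps ℕ.≤ k
          look (here ≡.refl) (h ∷ _)  = h
          look (there P∈)    (_ ∷ hs) = look P∈ hs

        ≤σ : All (λ Q → v (det P Q) ≡ 0∞ → w Q ℚ.≤ σ) Ps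
        ≤σ = All.map (λ Q∈ u → +-cancelˡ-≤ τ (ℚ.≤-trans (pair P∈ Q∈ u) (ℚ.≤-reflexive (≡.sym τ+σ≡δ)))) self

        by-cases : σ ℚ.≤ τ ⊎ τ ℚ.≤ σ → total Ps ℚ.≤ k ⊗ δ
        by-cases (inj₁ σ≤τ) = ℚ.≤-trans (total-near-far P Ps ≤τ ≤σ) (ℚ.≤-trans
          (majority σ≤τ k (near P Ps) (far P Ps) near-P (≡.trans (near+far P Ps) len))
            (ℚ.≤-reflexive (≡.cong (k ⊗_) τ+σ≡δ)))
        -- Here 2τ ≤ δ, so it is enough to bound every weight by τ; `majority` is used with the
        -- roles of σ and τ exchanged and no large numbers.
        by-cases (inj₂ τ≤σ) = ℚ.≤-trans (total-bound Ps ≤τ) (ℚ.≤-trans (ℚ.≤-reflexive (≡.sym (ℚ.+-identityˡ _)))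
          (ℚ.≤-trans (majority τ≤σ k 0 (length Ps) z≤n len)
            (ℚ.≤-reflexive (≡.cong (k ⊗_) (≡.trans (ℚ.+-comm σ τ) τ+σ≡δ)))))

  -- Comparison of the discriminants of equivalent forms.

  module _
    {k l e : Carrier} {Ps Qs : List Point} (m : ℕ) (M : Matrix)
    (similar : ∀ X → form (e * e * k) Ps X ≈ form l Qs (M ·² X))
    (length-Ps : length Ps ≡ m ℕ.+ m) (length-Qs : length Qs ≡ m ℕ.+ m)
    (e≉0 : ¬ e ≈ 0#) (k-unit : Unit k) (det≉0 : ¬ determinant M ≈ 0#)
    (Ps≢0 : All NonzeroPoint Ps) (near≤m : All (λ P → near P Ps ℕ.≤ m) Ps)
    (l-integral : ∀ ξ → Integral ξ → Integral (form l Qs (ξ , 1#))) where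
    private
      d = determinant M
      δ = ord d
      MPs = map (M ·²_) Ps

      e²≉0 : ¬ e * e ≈ 0#
      e²≉0 = *≉0 e≉0 e≉0

      MPs≢0 : All NonzeroPoint MPs
      MPs≢0 = All.map⁺ (All.map (λ {P} → ·²-nonzero M det≉0 {P}) Ps≢0)

      weight : Point → ℚ
      weight P = ord (scale (M ·² P))

      weights : ∀ Ps → All NonzeroPoint Ps → ord (scaleProduct (map (M ·²_) Ps)) ≡ total weight Ps
      weights []       []           = ord-1
      weights (P ∷ Ps) (P≢0 ∷ Ps≢0) = ≡.trans (ord-* (Normalised.scale≉0 (normalise _ (·²-nonzero M det≉0 {P} P≢0)))
        (scaleProduct≉0 (All.map⁺ (All.map (λ {P} → ·²-nonzero M det≉0 {P}) Ps≢0))))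
          (≡.cong (weight P ℚ.+_) (weights Ps Ps≢0))

      -- det(MP, MQ) is det(M) times a unit, and its valuation is at least the sum of the two
      -- weights.
      pair : ∀ {P Q} → Any (P ≡_) Ps → Any (Q ≡_) Ps → v (det P Q) ≡ 0∞ → weight P ℚ.+ weight Q ℚ.≤ δ
      pair {P} {Q} P∈ Q∈ u = [≤]-injective (≡.subst₂ _≤⁺_
        (≡.trans (v-* _ _) (≡.cong₂ _+∞_ (v-ord P-scale) (v-ord Q-scale)))
        (≡.trans (v-cong (det-transform M P Q)) (≡.trans (v-* d _)
          (≡.trans (≡.cong₂ _+∞_ (v-ord det≉0) u) (+∞-identityʳ [ δ ]))))
        (scales≤det (M ·² P) (M ·² Q) (nonzero P∈) (nonzero Q∈)))
        where
        nonzero : ∀ {P} → Any (P ≡_) Ps → NonzeroPoint (M ·² P)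
        nonzero {P} P∈ = ·²-nonzero M det≉0 {P} (look P∈ Ps≢0)
          where
          look : ∀ {Qs} → Any (P ≡_) Qs → All NonzeroPoint Qs → NonzeroPoint P
          look (here ≡.refl) (h ∷ _)  = h
          look (there P∈)    (_ ∷ hs) = look P∈ hs

        P-scale = Normalised.scale≉0 (normalise (M ·² P) (nonzero P∈))
        Q-scale = Normalised.scale≉0 (normalise (M ·² Q) (nonzero Q∈))

    -- With Σ the sum of the weights, `lower` says 2m v(d) ≤ v(e²) + Σ, by evaluation at a point
    -- that attains the content, and `upper` says Σ ≤ m v(d), by balancing. Cancelling m v(d) gives
    -- the claim.
    determinant-bound : ord (d ^ m) ℚ.≤ ord (e * e)
    determinant-bound = go (content-attained MPs≢0)
      where
      go : ∃[ ξ ] Integral ξ × v (detProduct MPs (ξ , 1#)) ≡ v (scaleProduct MPs) → ord (d ^ m) ℚ.≤ ord (e * e)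
      go (ξ , iξ , attained) = +-cancelˡ-≤ (ord (d ^ m))
        (ℚ.≤-trans lower (ℚ.≤-trans (ℚ.+-monoʳ-≤ (ord (e * e)) upper)
          (ℚ.≤-reflexive (ℚ.+-comm (ord (e * e)) (ord (d ^ m))))))
        where
        dᵐ≉0 : ¬ d ^ m ≈ 0#
        dᵐ≉0 = ^≉0 det≉0 m

        upper : ord (scaleProduct MPs) ℚ.≤ ord (d ^ m)
        upper = ℚ.≤-trans (ℚ.≤-reflexive (weights Ps Ps≢0)) (ℚ.≤-trans (balanced weight m Ps length-Ps near≤m pair)
          (ℚ.≤-reflexive (≡.sym (ord-^ det≉0 m))))

        value : v (d ^ length Qs * form l Qs (ξ , 1#)) ≡ [ ord (e * e) ℚ.+ ord (scaleProduct MPs) ]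
        value = ≡.trans (v-cong (similar-values {Ps = Ps} {Qs} M similar (ξ , 1#))) (≡.trans (v-* _ _) (≡.cong₂ _+∞_
          (≡.trans (v-* (e * e) k) (≡.trans (≡.cong (v (e * e) +∞_) k-unit) (≡.trans (+∞-identityʳ _) (v-ord e²≉0))))
          (≡.trans attained (v-ord (scaleProduct≉0 MPs≢0)))))

        lower : ord (d ^ m) ℚ.+ ord (d ^ m) ℚ.≤ ord (e * e) ℚ.+ ord (scaleProduct MPs)
        lower = [≤]-injective (≤∞-trans (≤∞-reflexive
          (≡.sym (≡.trans (v-cong (trans (reflexive (≡.cong (d ^_) length-Qs)) (^-homo-* d m m)))
          (≡.trans (v-* _ _) (≡.cong₂ _+∞_ (v-ord dᵐ≉0) (v-ord dᵐ≉0))))))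
          (≤∞-trans (≤∞-reflexive (≡.sym (+∞-identityʳ _)))
            (≤∞-trans (+∞-mono (≤∞-refl {v (d ^ length Qs)}) (l-integral ξ iξ))
            (≤∞-trans (≤∞-reflexive (≡.sym (v-* _ _))) (≤∞-reflexive value)))))

    ord-^-mono : ∀ {x y} → ¬ x ≈ 0# → ¬ y ≈ 0# → ord x ℚ.≤ ord y → ∀ n → ord (x ^ n) ℚ.≤ ord (y ^ n)
    ord-^-mono x≉0 y≉0 x≤y zero    = ℚ.≤-refl
    ord-^-mono x≉0 y≉0 x≤y (suc n) = ℚ.≤-trans (ℚ.≤-reflexive (ord-* x≉0 (^≉0 x≉0 n)))
      (ℚ.≤-trans (ℚ.+-mono-≤ x≤y (ord-^-mono x≉0 y≉0 x≤y n)) (ℚ.≤-reflexive (≡.sym (ord-* y≉0 (^≉0 y≉0 n)))))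

    ord-square-mono : ∀ {x y} → ¬ x ≈ 0# → ¬ y ≈ 0# → ord x ℚ.≤ ord y → ord (x * x) ℚ.≤ ord (y * y)
    ord-square-mono x≉0 y≉0 x≤y = ℚ.≤-trans (ℚ.≤-reflexive (ord-* x≉0 x≉0))
      (ℚ.≤-trans (ℚ.+-mono-≤ x≤y x≤y) (ℚ.≤-reflexive (≡.sym (ord-* y≉0 y≉0))))

    triangular-double : ∀ n → triangular (suc n) ℕ.+ triangular (suc n) ≡ n ℕ.* suc n
    triangular-double zero    = ≡.refl
    triangular-double (suc n) = ≡.trans (ℕ-interchange (suc n) (triangular (suc n)))
      (≡.trans (≡.cong ((suc n ℕ.+ suc n) ℕ.+_) (triangular-double n)) (expand n))
      where
      open +-*-Solver using () renaming (solve to ℕ-solve; _:+_ to _⊕_; _:*_ to _⊛_; con to κ; _:=_ to _⊜_)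
      ℕ-interchange : ∀ a b → (a ℕ.+ b) ℕ.+ (a ℕ.+ b) ≡ (a ℕ.+ a) ℕ.+ (b ℕ.+ b)
      ℕ-interchange = ℕ-solve 2 (λ a b → (a ⊕ b) ⊕ (a ⊕ b) ⊜ (a ⊕ a) ⊕ (b ⊕ b)) ≡.refl
      expand : ∀ n → (suc n ℕ.+ suc n) ℕ.+ n ℕ.* suc n ≡ suc n ℕ.* suc (suc n)
      expand = ℕ-solve 1 (λ n → ((κ 1 ⊕ n) ⊕ (κ 1 ⊕ n)) ⊕ n ⊛ (κ 1 ⊕ n) ⊜ (κ 1 ⊕ n) ⊛ (κ 2 ⊕ n)) ≡.refl

    -- This makes the determinant factor an n-th power of d^m · d^m, to be compared with the n-th
    -- power of e² · e².
    triangular-half : ∀ n → m ℕ.+ m ≡ suc n → triangular (suc n) ≡ m ℕ.* n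
    triangular-half n eq = ℕ.*-cancelˡ-≡ _ _ 2 (≡.trans (≡.cong (triangular (suc n) ℕ.+_) (ℕ.+-identityʳ _))
      (≡.trans (triangular-double n) (≡.trans (≡.cong (n ℕ.*_) (≡.sym eq)) (rearrange n m))))
      where
      open +-*-Solver using () renaming (solve to ℕ-solve; _:+_ to _⊕_; _:*_ to _⊛_; con to κ; _:=_ to _⊜_)
      rearrange : ∀ n m → n ℕ.* (m ℕ.+ m) ≡ 2 ℕ.* (m ℕ.* n)
      rearrange = ℕ-solve 2 (λ n m → n ⊛ (m ⊕ m) ⊜ κ 2 ⊛ (m ⊛ n)) ≡.refl

    -- The discriminants satisfy E X = D Y, where `determinant-bound` gives v(D) ≤ v(E); hence v(X)
    -- ≤ v(Y).
    discriminant-bound : ∀ n → m ℕ.+ m ≡ suc n → ¬ l ≈ 0# → All NonzeroPoint Qs →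
      v ((k * k) ^ n * discriminantOf Ps) ≤⁺ v ((l * l) ^ n * discriminantOf Qs)
    discriminant-bound n m+m≡1+n l≉0 Qs≢0 = go (v-decide Y 0#)
      where
      X = (k * k) ^ n * discriminantOf Ps
      Y = (l * l) ^ n * discriminantOf Qs
      E = ((e * e) * (e * e)) ^ n
      D = (d ^ m * d ^ m) ^ n

      dᵐ≉0 : ¬ d ^ m ≈ 0#
      dᵐ≉0 = ^≉0 det≉0 m

      D≉0 : ¬ D ≈ 0#
      D≉0 = ^≉0 (*≉0 dᵐ≉0 dᵐ≉0) n

      E≉0 : ¬ E ≈ 0#
      E≉0 = ^≉0 (*≉0 e²≉0 e²≉0) n

      powers : (d * d) ^ triangular (suc n) ≈ D
      powers = trans (reflexive (≡.cong ((d * d) ^_) (triangular-half n m+m≡1+n)))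
        (trans (sym (^-assocʳ (d * d) m n)) (^-congˡ n (^-distrib-* d d m)))

      EX≈DY : E * X ≈ D * Y
      EX≈DY = trans (similar-discriminants {Ps = Ps} {Qs} M similar n (≡.trans length-Ps m+m≡1+n)
        (≡.trans length-Qs m+m≡1+n)
        e≉0 (v-finite⇒≉0 k-unit) l≉0 det≉0 Ps≢0 Qs≢0) (*-congʳ powers)

      D≤E : ord D ℚ.≤ ord E
      D≤E = ord-^-mono (*≉0 dᵐ≉0 dᵐ≉0) (*≉0 e²≉0 e²≉0) (ord-square-mono dᵐ≉0 e²≉0 determinant-bound) n

      go : Dec (Y ≈ 0#) → v X ≤⁺ v Y
      go (yes Y≈0) = ≤∞-trans (_ ≤⊤⁺) (≤∞-reflexive (≡.sym (v-0 Y≈0)))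
      go (no Y≉0)  = ≡.subst₂ _≤⁺_ (≡.sym (v-ord X≉0)) (≡.sym (v-ord Y≉0)) NonStrict.[ +-cancelˡ-≤ (ord E) (ℚ.≤-trans
        (ℚ.≤-reflexive (≡.trans (≡.sym (ord-* E≉0 X≉0)) (≡.trans (ord-cong EX≈DY) (ord-* D≉0 Y≉0))))
          (ℚ.+-monoˡ-≤ (ord Y) D≤E)) ]
        where
        X≉0 : ¬ X ≈ 0#
        X≉0 X≈0 = *≉0 D≉0 Y≉0 (trans (sym EX≈DY) (trans (*-congˡ X≈0) (zeroʳ E)))

-- Isomorphisms of hyperelliptic function fields

module Pullback {c ℓ c′ ℓ′} (K : LocalField c ℓ) (K̄ : AlgebraicClosure K c′ ℓ′) where
  private
    module K  = LocalField K
    module KP = Polynomials K.baseField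
    module L  = AlgebraicClosure K̄
  open ValuedField L.closure L.v̄ L.isValuation L.algebraicallyClosed public
  open L using (ι; coeff-ι) public
  open RingMorphisms.IsRingMonomorphism L.isRingMonomorphism public using ()
    renaming
    ( ⟦⟧-cong to ι-cong; injective to ι-injective; +-homo to ι-+; *-homo to ι-*
    ; 0#-homo to ι-0; 1#-homo to ι-1 )

  ⟦_⟧ : KP.Poly → Carrier → Carrier
  ⟦ p ⟧ = eval (map ι p)

  ⟦⟧-poly : ∀ p → IsPoly ⟦ p ⟧
  ⟦⟧-poly p = poly (map ι p)

  ⟦⟧-≈ₚ : ∀ p q → p KP.≈ₚ q → ∀ ρ → ⟦ p ⟧ ρ ≈ ⟦ q ⟧ ρ
  ⟦⟧-≈ₚ p q p≈q = eval-≈ₚ (map ι p) (map ι q) λ n → trans (coeff-ι p n) (trans (ι-cong (p≈q n)) (sym (coeff-ι q n)))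

  -- Polynomial identities over K can be checked by evaluation in the closure, so the solver for
  -- field elements takes the place of ring laws for coefficient lists.
  ⟦⟧-injective : ∀ p q → (∀ ρ → ⟦ p ⟧ ρ ≈ ⟦ q ⟧ ρ) → p KP.≈ₚ q
  ⟦⟧-injective p q eq n = ι-injective (trans (sym (coeff-ι p n))
    (trans (eval-injective (map ι p) (map ι q) eq n) (coeff-ι q n)))

  ⟦⟧-factored : ∀ p → ¬ p KP.≈ₚ KP.0ₚ → Factored ⟦ p ⟧
  ⟦⟧-factored p p≉0 = factored (⟦⟧-poly p) λ p≈0 → p≉0 (⟦⟧-injective p [] p≈0)

  ⟦⟧-constant : ∀ a ρ → ⟦ a ∷ [] ⟧ ρ ≈ ι a
  ⟦⟧-constant a ρ = eval-constant (ι a) ρ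

  ⟦1⟧ : ∀ ρ → ⟦ KP.1ₚ ⟧ ρ ≈ 1#
  ⟦1⟧ ρ = trans (⟦⟧-constant K.1# ρ) ι-1

  ⟦X⟧ : ∀ ρ → ⟦ K.0# ∷ K.1# ∷ [] ⟧ ρ ≈ ρ
  ⟦X⟧ ρ = trans (+-cong ι-0 (*-congˡ (⟦1⟧ ρ))) (trans (+-identityˡ _) (*-identityʳ ρ))

  module _ {ρ : Carrier} where

    ⟦⟧-+ : ∀ p q {x y} → ⟦ p ⟧ ρ ≈ x → ⟦ q ⟧ ρ ≈ y → ⟦ p KP.+ₚ q ⟧ ρ ≈ x + y
    ⟦⟧-+ p q p≈ q≈ = trans (go p q) (+-cong p≈ q≈)
      where
      go : ∀ p q → ⟦ p KP.+ₚ q ⟧ ρ ≈ ⟦ p ⟧ ρ + ⟦ q ⟧ ρ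
      go []      q       = sym (+-identityˡ _)
      go (a ∷ p) []      = sym (+-identityʳ _)
      go (a ∷ p) (b ∷ q) = trans (+-cong (ι-+ a b) (*-congˡ (go p q)))
        (solve 5 (λ a b x p q → (a :+ b) :+ x :* (p :+ q) := (a :+ x :* p) :+ (b :+ x :* q)) refl (ι a) (ι b) ρ
          (⟦ p ⟧ ρ) (⟦ q ⟧ ρ))

    ⟦⟧-scale : ∀ a p → ⟦ map (a K.*_) p ⟧ ρ ≈ ι a * ⟦ p ⟧ ρ
    ⟦⟧-scale a []      = sym (zeroʳ _)
    ⟦⟧-scale a (b ∷ p) = trans (+-cong (ι-* a b) (*-congˡ (⟦⟧-scale a p)))
      (solve 4 (λ a b x p → a :* b :+ x :* (a :* p) := a :* (b :+ x :* p)) refl (ι a) (ι b) ρ (⟦ p ⟧ ρ))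

    ⟦⟧-* : ∀ p q {x y} → ⟦ p ⟧ ρ ≈ x → ⟦ q ⟧ ρ ≈ y → ⟦ p KP.*ₚ q ⟧ ρ ≈ x * y
    ⟦⟧-* p q p≈ q≈ = trans (go p) (*-cong p≈ q≈)
      where
      go : ∀ p → ⟦ p KP.*ₚ q ⟧ ρ ≈ ⟦ p ⟧ ρ * ⟦ q ⟧ ρ
      go []      = sym (zeroˡ _)
      go (a ∷ p) = trans (⟦⟧-+ (map (a K.*_) q) (K.0# ∷ p KP.*ₚ q) (⟦⟧-scale a q)
        (trans (+-congʳ ι-0) (trans (+-identityˡ _) (*-congˡ (go p)))))
        (solve 4 (λ a q x p → a :* q :+ x :* (p :* q) := (a :+ x :* p) :* q) refl (ι a) (⟦ q ⟧ ρ) ρ (⟦ p ⟧ ρ))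

  -- A total function with default value `0#`, so that fractions can be evaluated without a proof
  -- that the denominator is nonzero.
  reciprocal : Carrier → Carrier
  reciprocal x with v-decide x 0#
  ... | yes _   = 0#
  ... | no  x≉0 = proj₁ (inverse x x≉0)

  reciprocal-inverse : ∀ {x} → ¬ x ≈ 0# → x * reciprocal x ≈ 1#
  reciprocal-inverse {x} x≉0 with v-decide x 0#
  ... | yes x≈0  = contradiction x≈0 x≉0
  ... | no  x≉0′ = proj₂ (inverse x x≉0′)

  Fraction′ : Set (c ⊔ ℓ)
  Fraction′ = Fraction K.baseField

  Xₚ : KP.Poly
  Xₚ = K.0# ∷ K.1# ∷ []

  X Y : Fraction′
  X = fraction Xₚ [] KP.1ₚ (1ₚ≉0 K.baseField)
  Y = fraction [] KP.1ₚ KP.1ₚ (1ₚ≉0 K.baseField)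

  polynomial : KP.Poly → Fraction′
  polynomial q = fraction q [] KP.1ₚ (1ₚ≉0 K.baseField)

  module Evaluation (f : KP.Poly) where
    private
      module Kf = RawRing (functionField K.baseField f)

    Defined : Fraction′ → Carrier → Set ℓ′
    Defined z ρ = ¬ ⟦ Fraction.δ z ⟧ ρ ≈ 0#

    defined : ∀ z → Cofinitely (Defined z)
    defined z = cofinitely-≉0 (⟦⟧-factored (Fraction.δ z) (Fraction.δ≉0 z))

    numerator : Fraction′ → Carrier → Carrier → Carrier
    numerator z ρ η = ⟦ Fraction.α z ⟧ ρ + ⟦ Fraction.β z ⟧ ρ * η

    val : Fraction′ → Carrier → Carrier → Carrier
    val z ρ η = numerator z ρ η * reciprocal (⟦ Fraction.δ z ⟧ ρ)

    val-spec : ∀ z {ρ} → Defined z ρ → ∀ η → ⟦ Fraction.δ z ⟧ ρ * val z ρ η ≈ numerator z ρ η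
    val-spec z {ρ} def η = trans (solve 3 (λ d n i → d :* (n :* i) := (d :* i) :* n) refl (⟦ Fraction.δ z ⟧ ρ)
      (numerator z ρ η) (reciprocal (⟦ Fraction.δ z ⟧ ρ)))
      (trans (*-congʳ (reciprocal-inverse def)) (*-identityˡ _))

    val-unique : ∀ z {ρ η t} → Defined z ρ → ⟦ Fraction.δ z ⟧ ρ * t ≈ numerator z ρ η → val z ρ η ≈ t
    val-unique z {ρ} {η} def eq = *-cancelˡ def (trans (val-spec z def η) (sym eq))

    val-cong : ∀ z z′ → z Kf.≈ z′ → ∀ {ρ η} → Defined z ρ → Defined z′ ρ → val z ρ η ≈ val z′ ρ η
    val-cong z@(fraction α β δ _) z′@(fraction α′ β′ δ′ _) (α≈ , β≈) {ρ} {η} def def′ = val-unique z def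
      (*-cancelˡ def′ (begin
      ⟦ δ′ ⟧ ρ * (⟦ δ ⟧ ρ * val z′ ρ η)   ≈⟨ solve 3 (λ a b t → a :* (b :* t) := b :* (a :* t)) refl (⟦ δ′ ⟧ ρ)
        (⟦ δ ⟧ ρ) (val z′ ρ η) ⟩
      ⟦ δ ⟧ ρ * (⟦ δ′ ⟧ ρ * val z′ ρ η)   ≈⟨ *-congˡ (val-spec z′ def′ η) ⟩
      ⟦ δ ⟧ ρ * (⟦ α′ ⟧ ρ + ⟦ β′ ⟧ ρ * η) ≈⟨ solve 4 (λ d a b y → d :* (a :+ b :* y) := a :* d :+ b :* d :* y) refl
        (⟦ δ ⟧ ρ) (⟦ α′ ⟧ ρ) (⟦ β′ ⟧ ρ) η ⟩
      ⟦ α′ ⟧ ρ * ⟦ δ ⟧ ρ + ⟦ β′ ⟧ ρ * ⟦ δ ⟧ ρ * η ≈⟨ +-cong (cross α′ δ α δ′ α≈) (*-congʳ (cross β′ δ β δ′ β≈)) ⟩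
      ⟦ α ⟧ ρ * ⟦ δ′ ⟧ ρ + ⟦ β ⟧ ρ * ⟦ δ′ ⟧ ρ * η
        ≈⟨ solve 4 (λ d a b y → d :* (a :+ b :* y) := a :* d :+ b :* d :* y) refl (⟦ δ′ ⟧ ρ) (⟦ α ⟧ ρ) (⟦ β ⟧ ρ) η ⟨
      ⟦ δ′ ⟧ ρ * (⟦ α ⟧ ρ + ⟦ β ⟧ ρ * η) ∎))
      where
      open ≈-Reasoning
      cross : ∀ a b a′ b′ → (a′ KP.*ₚ b′) KP.≈ₚ (a KP.*ₚ b) → ⟦ a ⟧ ρ * ⟦ b ⟧ ρ ≈ ⟦ a′ ⟧ ρ * ⟦ b′ ⟧ ρ
      cross a b a′ b′ eq = trans (sym (⟦⟧-* a b refl refl))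
        (trans (sym (⟦⟧-≈ₚ (a′ KP.*ₚ b′) (a KP.*ₚ b) eq ρ)) (⟦⟧-* a′ b′ refl refl))

    defined-*ₚ : ∀ δ δ′ {ρ} → ¬ ⟦ δ ⟧ ρ ≈ 0# → ¬ ⟦ δ′ ⟧ ρ ≈ 0# → ¬ ⟦ δ KP.*ₚ δ′ ⟧ ρ ≈ 0#
    defined-*ₚ δ δ′ def def′ eq = *≉0 def def′ (trans (sym (⟦⟧-* δ δ′ refl refl)) eq)

    val-+ : ∀ z z′ {ρ η} → Defined z ρ → Defined z′ ρ → val (z Kf.+ z′) ρ η ≈ val z ρ η + val z′ ρ η
    val-+ z@(fraction α β δ _) z′@(fraction α′ β′ δ′ _) {ρ} {η} def def′ = val-unique (z Kf.+ z′)
      (defined-*ₚ δ δ′ def def′) (begin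
      ⟦ δ KP.*ₚ δ′ ⟧ ρ * (val z ρ η + val z′ ρ η)
        ≈⟨ *-congʳ (⟦⟧-* δ δ′ refl refl) ⟩
      ⟦ δ ⟧ ρ * ⟦ δ′ ⟧ ρ * (val z ρ η + val z′ ρ η)
        ≈⟨ solve 4 (λ d d′ t t′ → d :* d′ :* (t :+ t′) := d :* t :* d′ :+ d′ :* t′ :* d) refl (⟦ δ ⟧ ρ) (⟦ δ′ ⟧ ρ)
          (val z ρ η) (val z′ ρ η) ⟩
      ⟦ δ ⟧ ρ * val z ρ η * ⟦ δ′ ⟧ ρ + ⟦ δ′ ⟧ ρ * val z′ ρ η * ⟦ δ ⟧ ρ
        ≈⟨ +-cong (*-congʳ (val-spec z def η)) (*-congʳ (val-spec z′ def′ η)) ⟩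
      (⟦ α ⟧ ρ + ⟦ β ⟧ ρ * η) * ⟦ δ′ ⟧ ρ + (⟦ α′ ⟧ ρ + ⟦ β′ ⟧ ρ * η) * ⟦ δ ⟧ ρ
        ≈⟨ solve 7 (λ a b d a′ b′ d′ y → (a :+ b :* y) :* d′ :+ (a′ :+ b′ :* y) :* d := (a :* d′ :+ a′ :* d) :+
          (b :* d′ :+ b′ :* d) :* y) refl
             (⟦ α ⟧ ρ) (⟦ β ⟧ ρ) (⟦ δ ⟧ ρ) (⟦ α′ ⟧ ρ) (⟦ β′ ⟧ ρ) (⟦ δ′ ⟧ ρ) η ⟩
      (⟦ α ⟧ ρ * ⟦ δ′ ⟧ ρ + ⟦ α′ ⟧ ρ * ⟦ δ ⟧ ρ) + (⟦ β ⟧ ρ * ⟦ δ′ ⟧ ρ + ⟦ β′ ⟧ ρ * ⟦ δ ⟧ ρ) * η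
        ≈⟨ +-cong (⟦⟧-+ (α KP.*ₚ δ′) (α′ KP.*ₚ δ) (⟦⟧-* α δ′ refl refl) (⟦⟧-* α′ δ refl refl))
             (*-congʳ (⟦⟧-+ (β KP.*ₚ δ′) (β′ KP.*ₚ δ) (⟦⟧-* β δ′ refl refl) (⟦⟧-* β′ δ refl refl))) ⟨
      numerator (z Kf.+ z′) ρ η ∎)
      where open ≈-Reasoning

    -- The evaluation law for which the point must lie on the curve: multiplication in the function
    -- field replaces y² by f.
    val-* : ∀ z z′ {ρ η} → η * η ≈ ⟦ f ⟧ ρ → Defined z ρ → Defined z′ ρ → val (z Kf.* z′) ρ η ≈ val z ρ η * val z′ ρ η
    val-* z@(fraction α β δ _) z′@(fraction α′ β′ δ′ _) {ρ} {η} η² def def′ = val-unique (z Kf.* z′)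
      (defined-*ₚ δ δ′ def def′) (begin
      ⟦ δ KP.*ₚ δ′ ⟧ ρ * (val z ρ η * val z′ ρ η)
        ≈⟨ *-congʳ (⟦⟧-* δ δ′ refl refl) ⟩
      ⟦ δ ⟧ ρ * ⟦ δ′ ⟧ ρ * (val z ρ η * val z′ ρ η)
        ≈⟨ solve 4 (λ d d′ t t′ → d :* d′ :* (t :* t′) := (d :* t) :* (d′ :* t′)) refl (⟦ δ ⟧ ρ) (⟦ δ′ ⟧ ρ)
          (val z ρ η) (val z′ ρ η) ⟩
      (⟦ δ ⟧ ρ * val z ρ η) * (⟦ δ′ ⟧ ρ * val z′ ρ η)
        ≈⟨ *-cong (val-spec z def η) (val-spec z′ def′ η) ⟩
      (⟦ α ⟧ ρ + ⟦ β ⟧ ρ * η) * (⟦ α′ ⟧ ρ + ⟦ β′ ⟧ ρ * η)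
        ≈⟨ solve 5 (λ a b a′ b′ y → (a :+ b :* y) :* (a′ :+ b′ :* y) := (a :* a′ :+ (y :* y) :* (b :* b′)) :+
          (a :* b′ :+ a′ :* b) :* y) refl
             (⟦ α ⟧ ρ) (⟦ β ⟧ ρ) (⟦ α′ ⟧ ρ) (⟦ β′ ⟧ ρ) η ⟩
      (⟦ α ⟧ ρ * ⟦ α′ ⟧ ρ + (η * η) * (⟦ β ⟧ ρ * ⟦ β′ ⟧ ρ)) + (⟦ α ⟧ ρ * ⟦ β′ ⟧ ρ + ⟦ α′ ⟧ ρ * ⟦ β ⟧ ρ) * η
        ≈⟨ +-congʳ (+-congˡ (*-congʳ η²)) ⟩
      (⟦ α ⟧ ρ * ⟦ α′ ⟧ ρ + ⟦ f ⟧ ρ * (⟦ β ⟧ ρ * ⟦ β′ ⟧ ρ)) + (⟦ α ⟧ ρ * ⟦ β′ ⟧ ρ + ⟦ α′ ⟧ ρ * ⟦ β ⟧ ρ) * η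
        ≈⟨ +-cong (⟦⟧-+ (α KP.*ₚ α′) (f KP.*ₚ (β KP.*ₚ β′)) (⟦⟧-* α α′ refl refl)
          (⟦⟧-* f (β KP.*ₚ β′) refl (⟦⟧-* β β′ refl refl)))
             (*-congʳ (⟦⟧-+ (α KP.*ₚ β′) (α′ KP.*ₚ β) (⟦⟧-* α β′ refl refl) (⟦⟧-* α′ β refl refl))) ⟨
      numerator (z Kf.* z′) ρ η ∎)
      where open ≈-Reasoning

    defined-1 : ∀ ρ → ¬ ⟦ KP.1ₚ ⟧ ρ ≈ 0#
    defined-1 ρ eq = 1≉0 (trans (sym (⟦1⟧ ρ)) eq)

    val-constant : ∀ a ρ η → val (constant K.baseField a) ρ η ≈ ι a
    val-constant a ρ η = val-unique (constant K.baseField a) (defined-1 ρ)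
      (trans (*-congʳ (⟦1⟧ ρ)) (trans (*-identityˡ _)
      (sym (trans (+-cong (⟦⟧-constant a ρ) (zeroˡ η)) (+-identityʳ _)))))

    val-X : ∀ ρ η → val X ρ η ≈ ρ
    val-X ρ η = val-unique X (defined-1 ρ) (trans (*-congʳ (⟦1⟧ ρ)) (trans (*-identityˡ _)
      (sym (trans (+-cong (⟦X⟧ ρ) (zeroˡ η)) (+-identityʳ _)))))

    val-Y : ∀ ρ η → val Y ρ η ≈ η
    val-Y ρ η = val-unique Y (defined-1 ρ) (trans (*-congʳ (⟦1⟧ ρ)) (sym (trans (+-identityˡ _) (*-congʳ (⟦1⟧ ρ)))))

  module _ {f h : KP.Poly} (iso : _≅_ K.baseField h f) where
    open Evaluation f
    open _≅_ iso
    open RingMorphisms.IsRingIsomorphism isIsomorphism using (surjective) renaming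
      (⟦⟧-cong to to-cong; +-homo to to-+; *-homo to to-*)
    private
      module Kf = RawRing (functionField K.baseField f)
      module Kh = RawRing (functionField K.baseField h)

    -- An element z of the function field of y² = h is evaluated at (ρ , η) through its image under
    -- `to`; this amounts to evaluating z itself at the image point (μ , ω).
    value : Fraction′ → Carrier → Carrier → Carrier
    value z = val (to z)

    μ ω : Carrier → Carrier → Carrier
    μ = value X
    ω = value Y

    value-cong : ∀ z z′ → z Kh.≈ z′ → Generically ⟦ f ⟧ λ ρ η → value z ρ η ≈ value z′ ρ η
    value-cong z z′ z≈z′ = cofinitely-map (λ (def , def′) η _ → val-cong (to z) (to z′) (to-cong z≈z′) def def′)
      (cofinitely-∩ (defined (to z)) (defined (to z′)))

    value-+ : ∀ z z′ → Generically ⟦ f ⟧ λ ρ η → value (z Kh.+ z′) ρ η ≈ value z ρ η + value z′ ρ η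
    value-+ z z′ = cofinitely-map (λ (def , def′ , def″) η _ → trans
        (val-cong (to (z Kh.+ z′)) (to z Kf.+ to z′) (to-+ z z′) def″
          (defined-*ₚ (Fraction.δ (to z)) (Fraction.δ (to z′)) def def′))
        (val-+ (to z) (to z′) def def′))
      (cofinitely-∩ (defined (to z)) (cofinitely-∩ (defined (to z′)) (defined (to (z Kh.+ z′)))))

    value-* : ∀ z z′ → Generically ⟦ f ⟧ λ ρ η → value (z Kh.* z′) ρ η ≈ value z ρ η * value z′ ρ η
    value-* z z′ = cofinitely-map (λ (def , def′ , def″) η η² → trans
        (val-cong (to (z Kh.* z′)) (to z Kf.* to z′) (to-* z z′) def″
          (defined-*ₚ (Fraction.δ (to z)) (Fraction.δ (to z′)) def def′))
        (val-* (to z) (to z′) η² def def′))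
      (cofinitely-∩ (defined (to z)) (cofinitely-∩ (defined (to z′)) (defined (to (z Kh.* z′)))))

    value-constant : ∀ a → Generically ⟦ f ⟧ λ ρ η → value (constant K.baseField a) ρ η ≈ ι a
    value-constant a = cofinitely-map (λ {ρ} def η _ → trans
        (val-cong (to (constant K.baseField a)) (constant K.baseField a) (fixesConstants a) def (defined-1 ρ))
          (val-constant a ρ η))
      (defined (to (constant K.baseField a)))

    polynomial-∷ : ∀ a q → polynomial (a ∷ q) Kh.≈ (constant K.baseField a Kh.+ X Kh.* polynomial q)
    polynomial-∷ a q =
      ⟦⟧-injective ((a ∷ q) KP.*ₚ δ′) (α′ KP.*ₚ KP.1ₚ) (λ ρ → trans
        (⟦⟧-* (a ∷ q) δ′ {ι a + ρ * ⟦ q ⟧ ρ} refl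
          (⟦⟧-* KP.1ₚ (KP.1ₚ KP.*ₚ KP.1ₚ) (⟦1⟧ ρ) (⟦⟧-* KP.1ₚ KP.1ₚ (⟦1⟧ ρ) (⟦1⟧ ρ))))
        (trans (solve 4 (λ a x q h → (a :+ x :* q) :* (:1 :* (:1 :* :1)) :=
          (a :* (:1 :* :1) :+ (x :* q :+ h :* (:0 :* :0)) :* :1) :* :1) refl
          (ι a) ρ (⟦ q ⟧ ρ) (⟦ h ⟧ ρ))
        (sym (⟦⟧-* α′ KP.1ₚ (⟦⟧-+ ((a ∷ []) KP.*ₚ (KP.1ₚ KP.*ₚ KP.1ₚ)) (α″ KP.*ₚ KP.1ₚ)
          (⟦⟧-* (a ∷ []) (KP.1ₚ KP.*ₚ KP.1ₚ) (⟦⟧-constant a ρ) (⟦⟧-* KP.1ₚ KP.1ₚ (⟦1⟧ ρ) (⟦1⟧ ρ)))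
          (⟦⟧-* α″ KP.1ₚ (⟦⟧-+ (Xₚ KP.*ₚ q) (h KP.*ₚ []) (⟦⟧-* Xₚ q (⟦X⟧ ρ) refl) (⟦⟧-* h [] refl (sym (zeroˡ 0#))))
            (⟦1⟧ ρ))) (⟦1⟧ ρ))))) ,
      ⟦⟧-injective [] (β′ KP.*ₚ KP.1ₚ) (λ ρ → trans
        (solve 2 (λ x q → :0 := (:0 :+ (x :* :0 :+ q :* :0) :* :1) :* :1) refl ρ (⟦ q ⟧ ρ))
        (sym (⟦⟧-* β′ KP.1ₚ (⟦⟧-+ [] (β″ KP.*ₚ KP.1ₚ) refl
          (⟦⟧-* β″ KP.1ₚ (⟦⟧-+ (Xₚ KP.*ₚ []) (q KP.*ₚ []) (⟦⟧-* Xₚ [] (⟦X⟧ ρ) refl) (⟦⟧-* q [] refl refl)) (⟦1⟧ ρ)))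
            (⟦1⟧ ρ))))
      where
      δ′ = KP.1ₚ KP.*ₚ (KP.1ₚ KP.*ₚ KP.1ₚ)
      α″ = Xₚ KP.*ₚ q KP.+ₚ h KP.*ₚ []
      α′ = (a ∷ []) KP.*ₚ (KP.1ₚ KP.*ₚ KP.1ₚ) KP.+ₚ α″ KP.*ₚ KP.1ₚ
      β″ = Xₚ KP.*ₚ [] KP.+ₚ q KP.*ₚ []
      β′ = [] KP.+ₚ β″ KP.*ₚ KP.1ₚ

    -- A homomorphism that fixes constants commutes with polynomials. The recursion is Horner's
    -- scheme, and each step excludes finitely many further points.
    value-polynomial : ∀ q → Generically ⟦ f ⟧ λ ρ η → value (polynomial q) ρ η ≈ ⟦ q ⟧ (μ ρ η)
    value-polynomial []      = cofinitely-map (λ (eq , eq′) η η² → trans (eq η η²) (trans (eq′ η η²) ι-0))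
      (cofinitely-∩ (value-cong (polynomial []) (constant K.baseField K.0#) polynomial-[]) (value-constant K.0#))
      where
      polynomial-[] : polynomial [] Kh.≈ constant K.baseField K.0#
      polynomial-[] = ⟦⟧-injective [] ((K.0# ∷ []) KP.*ₚ KP.1ₚ)
        (λ ρ → sym (trans (⟦⟧-* (K.0# ∷ []) KP.1ₚ (trans (⟦⟧-constant K.0# ρ) ι-0) refl) (zeroˡ _))) ,
        λ _ → K.refl
    value-polynomial (a ∷ q) = cofinitely-map (λ (eq , sum , const , prod , rec) η η² →
        trans (eq η η²) (trans (sum η η²) (+-cong (const η η²) (trans (prod η η²) (*-congˡ (rec η η²))))))
      (cofinitely-∩ (value-cong (polynomial (a ∷ q)) (constant K.baseField a Kh.+ X Kh.* polynomial q)
        (polynomial-∷ a q))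
      (cofinitely-∩ (value-+ (constant K.baseField a) (X Kh.* polynomial q)) (cofinitely-∩ (value-constant a)
      (cofinitely-∩ (value-* X (polynomial q)) (value-polynomial q)))))

    private
      ⟦0⟧ : ∀ ρ → ⟦ [] ⟧ ρ ≈ 0#
      ⟦0⟧ ρ = refl

      ⟦1*1⟧ : ∀ ρ → ⟦ KP.1ₚ KP.*ₚ KP.1ₚ ⟧ ρ ≈ 1# * 1#
      ⟦1*1⟧ ρ = ⟦⟧-* KP.1ₚ KP.1ₚ (⟦1⟧ ρ) (⟦1⟧ ρ)

    fraction-≈ : ∀ q r s s≉0 → (polynomial s Kh.* fraction q r s s≉0) Kh.≈ (polynomial q Kh.+ polynomial r Kh.* Y)
    fraction-≈ q r s s≉0 =
      ⟦⟧-injective (αˡ KP.*ₚ δʳ) (αʳ KP.*ₚ δˡ) (λ ρ → trans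
        (⟦⟧-* αˡ δʳ (⟦⟧-+ (s KP.*ₚ q) (h KP.*ₚ []) (⟦⟧-* s q refl refl) (⟦⟧-* h [] refl (⟦0⟧ ρ)))
          (⟦⟧-* KP.1ₚ (KP.1ₚ KP.*ₚ KP.1ₚ) (⟦1⟧ ρ) (⟦1*1⟧ ρ)))
        (trans (solve 4 (λ s q h r → (s :* q :+ h :* :0) :* (:1 :* (:1 :* :1)) :=
          (q :* (:1 :* :1) :+ (r :* :0 :+ h :* :0) :* :1) :* (:1 :* s)) refl (⟦ s ⟧ ρ) (⟦ q ⟧ ρ) (⟦ h ⟧ ρ) (⟦ r ⟧ ρ))
        (sym (⟦⟧-* αʳ δˡ (⟦⟧-+ (q KP.*ₚ (KP.1ₚ KP.*ₚ KP.1ₚ)) (α″ KP.*ₚ KP.1ₚ)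
          (⟦⟧-* q (KP.1ₚ KP.*ₚ KP.1ₚ) refl (⟦1*1⟧ ρ))
            (⟦⟧-* α″ KP.1ₚ (⟦⟧-+ (r KP.*ₚ []) (h KP.*ₚ []) (⟦⟧-* r [] refl (⟦0⟧ ρ)) (⟦⟧-* h [] refl (⟦0⟧ ρ)))
              (⟦1⟧ ρ)))
          (⟦⟧-* KP.1ₚ s (⟦1⟧ ρ) refl))))) ,
      ⟦⟧-injective (βˡ KP.*ₚ δʳ) (βʳ KP.*ₚ δˡ) (λ ρ → trans
        (⟦⟧-* βˡ δʳ (⟦⟧-+ (s KP.*ₚ r) (q KP.*ₚ []) (⟦⟧-* s r refl refl) (⟦⟧-* q [] refl (⟦0⟧ ρ)))
          (⟦⟧-* KP.1ₚ (KP.1ₚ KP.*ₚ KP.1ₚ) (⟦1⟧ ρ) (⟦1*1⟧ ρ)))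
        (trans (solve 3 (λ s q r → (s :* r :+ q :* :0) :* (:1 :* (:1 :* :1)) :=
          (:0 :+ (r :* :1 :+ :0) :* :1) :* (:1 :* s)) refl (⟦ s ⟧ ρ) (⟦ q ⟧ ρ) (⟦ r ⟧ ρ))
        (sym (⟦⟧-* βʳ δˡ (⟦⟧-+ [] (β″ KP.*ₚ KP.1ₚ) (⟦0⟧ ρ)
            (⟦⟧-* β″ KP.1ₚ (⟦⟧-+ (r KP.*ₚ KP.1ₚ) [] (⟦⟧-* r KP.1ₚ refl (⟦1⟧ ρ)) (⟦0⟧ ρ)) (⟦1⟧ ρ)))
          (⟦⟧-* KP.1ₚ s (⟦1⟧ ρ) refl)))))
      where
      αˡ = s KP.*ₚ q KP.+ₚ h KP.*ₚ []
      βˡ = s KP.*ₚ r KP.+ₚ q KP.*ₚ []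
      δˡ = KP.1ₚ KP.*ₚ s
      α″ = r KP.*ₚ [] KP.+ₚ h KP.*ₚ []
      αʳ = q KP.*ₚ (KP.1ₚ KP.*ₚ KP.1ₚ) KP.+ₚ α″ KP.*ₚ KP.1ₚ
      β″ = r KP.*ₚ KP.1ₚ KP.+ₚ []
      βʳ = [] KP.+ₚ β″ KP.*ₚ KP.1ₚ
      δʳ = KP.1ₚ KP.*ₚ (KP.1ₚ KP.*ₚ KP.1ₚ)

    Y²≈h : (Y Kh.* Y) Kh.≈ polynomial h
    Y²≈h =
      ⟦⟧-injective (α′ KP.*ₚ KP.1ₚ) (h KP.*ₚ (KP.1ₚ KP.*ₚ KP.1ₚ)) (λ ρ → trans
        (⟦⟧-* α′ KP.1ₚ (⟦⟧-+ [] (h KP.*ₚ (KP.1ₚ KP.*ₚ KP.1ₚ)) (⟦0⟧ ρ) (⟦⟧-* h (KP.1ₚ KP.*ₚ KP.1ₚ) refl (⟦1*1⟧ ρ)))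
          (⟦1⟧ ρ))
        (trans (solve 1 (λ h → (:0 :+ h :* (:1 :* :1)) :* :1 := h :* (:1 :* :1)) refl (⟦ h ⟧ ρ))
        (sym (⟦⟧-* h (KP.1ₚ KP.*ₚ KP.1ₚ) refl (⟦1*1⟧ ρ))))) ,
      λ _ → K.refl
      where
      α′ = [] KP.+ₚ h KP.*ₚ (KP.1ₚ KP.*ₚ KP.1ₚ)

    polynomial-inverse : ∀ q q≉0 → (polynomial q Kh.* fraction KP.1ₚ [] q q≉0) Kh.≈ constant K.baseField K.1#
    polynomial-inverse q q≉0 =
      ⟦⟧-injective (α′ KP.*ₚ KP.1ₚ) (KP.1ₚ KP.*ₚ (KP.1ₚ KP.*ₚ q)) (λ ρ → trans
        (⟦⟧-* α′ KP.1ₚ (⟦⟧-+ (q KP.*ₚ KP.1ₚ) (h KP.*ₚ []) (⟦⟧-* q KP.1ₚ refl (⟦1⟧ ρ)) (⟦⟧-* h [] refl (⟦0⟧ ρ)))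
          (⟦1⟧ ρ))
        (trans (solve 2 (λ q h → (q :* :1 :+ h :* :0) :* :1 := :1 :* (:1 :* q)) refl (⟦ q ⟧ ρ) (⟦ h ⟧ ρ))
        (sym (⟦⟧-* KP.1ₚ (KP.1ₚ KP.*ₚ q) (⟦1⟧ ρ) (⟦⟧-* KP.1ₚ q (⟦1⟧ ρ) refl))))) ,
      ⟦⟧-injective (β′ KP.*ₚ KP.1ₚ) [] (λ ρ → trans
        (⟦⟧-* β′ KP.1ₚ (⟦⟧-+ (q KP.*ₚ []) (KP.1ₚ KP.*ₚ []) (⟦⟧-* q [] refl (⟦0⟧ ρ)) (⟦⟧-* KP.1ₚ [] (⟦1⟧ ρ) (⟦0⟧ ρ)))
          (⟦1⟧ ρ))
        (solve 1 (λ q → (q :* :0 :+ :1 :* :0) :* :1 := :0) refl (⟦ q ⟧ ρ)))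
      where
      α′ = q KP.*ₚ KP.1ₚ KP.+ₚ h KP.*ₚ []
      β′ = q KP.*ₚ [] KP.+ₚ KP.1ₚ KP.*ₚ []

    -- The relation δz = α + βy holds in the function field of y² = h and is transported by the
    -- isomorphism. Keeping it in multiplied form avoids dividing by δ(μ).
    value-fraction : ∀ z → Generically ⟦ f ⟧ λ ρ η →
      ⟦ Fraction.δ z ⟧ (μ ρ η) * value z ρ η ≈ ⟦ Fraction.α z ⟧ (μ ρ η) + ⟦ Fraction.β z ⟧ (μ ρ η) * ω ρ η
    value-fraction z@(fraction q r s s≉0) = cofinitely-map
      (λ (eq , prod , sum , prod′ , s≈ , q≈ , r≈) η η² → trans (*-congʳ (sym (s≈ η η²)))
        (trans (sym (prod η η²)) (trans (eq η η²)
        (trans (sum η η²) (+-cong (q≈ η η²) (trans (prod′ η η²) (*-congʳ (r≈ η η²))))))))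
      (cofinitely-∩ (value-cong (polynomial s Kh.* z) (polynomial q Kh.+ polynomial r Kh.* Y) (fraction-≈ q r s s≉0))
      (cofinitely-∩ (value-* (polynomial s) z) (cofinitely-∩ (value-+ (polynomial q) (polynomial r Kh.* Y))
      (cofinitely-∩ (value-* (polynomial r) Y) (cofinitely-∩ (value-polynomial s)
      (cofinitely-∩ (value-polynomial q) (value-polynomial r)))))))

    value-curve : Generically ⟦ f ⟧ λ ρ η → ω ρ η * ω ρ η ≈ ⟦ h ⟧ (μ ρ η)
    value-curve = cofinitely-map (λ (eq , prod , h≈) η η² → trans (sym (prod η η²)) (trans (eq η η²) (h≈ η η²)))
      (cofinitely-∩ (value-cong (Y Kh.* Y) (polynomial h) Y²≈h) (cofinitely-∩ (value-* Y Y) (value-polynomial h)))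

    -- A nonzero polynomial is invertible in the function field, so the value of its image has an
    -- inverse at generic points.
    value-≉0 : ∀ q → ¬ q KP.≈ₚ KP.0ₚ → Generically ⟦ f ⟧ λ ρ η → ¬ ⟦ q ⟧ (μ ρ η) ≈ 0#
    value-≉0 q q≉0 = cofinitely-map (λ (eq , prod , const , q≈) η η² q≈0 → 1≉0
      (trans (sym ι-1) (trans (sym (const η η²))
        (trans (sym (eq η η²)) (trans (prod η η²) (trans (*-congʳ (trans (q≈ η η²) q≈0)) (zeroˡ _)))))))
      (cofinitely-∩ (value-cong (polynomial q Kh.* q⁻¹) (constant K.baseField K.1#) (polynomial-inverse q q≉0))
      (cofinitely-∩ (value-* (polynomial q) q⁻¹) (cofinitely-∩ (value-constant K.1#) (value-polynomial q))))
      where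
      q⁻¹ = fraction KP.1ₚ [] q q≉0

    -- Every element of K̄ is algebraic over K, whereas x has a transcendental image.
    value-transcendental : ∀ τ → Generically ⟦ f ⟧ λ ρ η → ¬ μ ρ η ≈ τ
    value-transcendental τ = go (L.algebraic τ)
      where
      go : ∃[ q ] ¬ q KP.≈ₚ KP.0ₚ × ⟦ q ⟧ τ ≈ 0# → Generically ⟦ f ⟧ λ ρ η → ¬ μ ρ η ≈ τ
      go (q , q≉0 , qτ≈0) = cofinitely-map (λ ≉0 η η² μ≈τ → ≉0 η η² (trans (eval-cong (map ι q) μ≈τ) qτ≈0))
        (value-≉0 q q≉0)

    preimage : Fraction′ → Fraction′
    preimage z = proj₁ (surjective z)

    -- Here surjectivity enters: applied to x and y, it expresses them as rational functions of
    -- their images u and w.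
    value-preimage : ∀ z → Generically ⟦ f ⟧ λ ρ η → value (preimage z) ρ η ≈ val z ρ η
    value-preimage z = cofinitely-map (λ (def , def′) η _ →
        val-cong (to (preimage z)) z (proj₂ (surjective z) ((λ _ → K.refl) , λ _ → K.refl)) def def′)
      (cofinitely-∩ (defined (to (preimage z))) (defined z))

    correspondence : Correspondence ⟦ f ⟧ ⟦ h ⟧
    correspondence = record
      { A = ⟦ Fraction.α (to X) ⟧ ; B = ⟦ Fraction.β (to X) ⟧ ; D = ⟦ Fraction.δ (to X) ⟧
      ; α = ⟦ Fraction.α (to Y) ⟧ ; β = ⟦ Fraction.β (to Y) ⟧ ; δ = ⟦ Fraction.δ (to Y) ⟧
      ; Aˣ = ⟦ Fraction.α x′ ⟧ ; Bˣ = ⟦ Fraction.β x′ ⟧ ; Dˣ = ⟦ Fraction.δ x′ ⟧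
      ; Aʸ = ⟦ Fraction.α y′ ⟧ ; Bʸ = ⟦ Fraction.β y′ ⟧ ; Dʸ = ⟦ Fraction.δ y′ ⟧
      ; A-poly = ⟦⟧-poly (Fraction.α (to X)) ; B-poly = ⟦⟧-poly (Fraction.β (to X)) ; D-poly = ⟦⟧-poly
        (Fraction.δ (to X))
      ; α-poly = ⟦⟧-poly (Fraction.α (to Y)) ; β-poly = ⟦⟧-poly (Fraction.β (to Y)) ; δ-poly = ⟦⟧-poly
        (Fraction.δ (to Y))
      ; Aˣ-poly = ⟦⟧-poly (Fraction.α x′) ; Bˣ-poly = ⟦⟧-poly (Fraction.β x′) ; Dˣ-poly = ⟦⟧-poly (Fraction.δ x′)
      ; Aʸ-poly = ⟦⟧-poly (Fraction.α y′) ; Bʸ-poly = ⟦⟧-poly (Fraction.β y′) ; Dʸ-poly = ⟦⟧-poly (Fraction.δ y′)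
      ; D-factored  = ⟦⟧-factored (Fraction.δ (to X)) (Fraction.δ≉0 (to X))
      ; δ-factored  = ⟦⟧-factored (Fraction.δ (to Y)) (Fraction.δ≉0 (to Y))
      ; Dˣ-factored = ⟦⟧-factored (Fraction.δ x′) (Fraction.δ≉0 x′)
      ; Dʸ-factored = ⟦⟧-factored (Fraction.δ y′) (Fraction.δ≉0 y′)
      ; μ = μ ; ω = ω
      ; μ-eq = cofinitely-map (λ def η _ → val-spec (to X) def η) (defined (to X))
      ; ω-eq = cofinitely-map (λ def η _ → val-spec (to Y) def η) (defined (to Y))
      ; curve = value-curve
      ; x-preimage = cofinitely-map (λ (eq , pre) η η² → trans (*-congˡ (sym (trans (pre η η²) (val-X _ η))))
        (eq η η²))
          (cofinitely-∩ (value-fraction x′) (value-preimage X))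
      ; y-preimage = cofinitely-map (λ (eq , pre) η η² → trans (*-congˡ (sym (trans (pre η η²) (val-Y _ η))))
        (eq η η²))
          (cofinitely-∩ (value-fraction y′) (value-preimage Y))
      ; transcendental = value-transcendental
      }
      where
      x′ = preimage X
      y′ = preimage Y

-- Minimality of the given equation.

module Minimality {c ℓ c′ ℓ′} (K : LocalField c ℓ) (K̄ : AlgebraicClosure K c′ ℓ′) where
  private
    module K  = LocalField K
    module KP = Polynomials K.baseField
    module L  = AlgebraicClosure K̄
    module H  = Hyperelliptic K K̄
  open Pullback K K̄

  identity : ∀ f → _≅_ K.baseField f f
  identity f = record
    { to = λ z → z
    ; isIsomorphism = Identity.isRingIsomorphism (functionField K.baseField f) ((λ _ → K.refl) , λ _ → K.refl)
    ; fixesConstants = λ _ → (λ _ → K.refl) , λ _ → K.refl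
    }

  module Curve {g : ℕ} (C : H.HyperellipticCurve g) where
    open H.HyperellipticCurve C public

    leading : Carrier
    leading = ι c-f

    leading≉0 : ¬ leading ≈ 0#
    leading≉0 eq = proj₁ hasDegree (ι-injective (trans eq (sym ι-0)))

    splitting : Σ[ rs ∈ List Carrier ] length rs ≡ degree × map ι f ≈ₚ linearProduct (coeff (map ι f) degree) rs
    splitting = splits L.algebraicallyClosed degree (map ι f) (L.degree-ι f degree hasDegree)

    f≈ : ∀ x → ⟦ f ⟧ x ≈ leading * rootProduct rootList x
    f≈ x = trans (eval-≈ₚ (map ι f) (linearProduct (coeff (map ι f) degree) rootList) (proj₂ (proj₂ splitting)) x)
      (trans (eval-linearProduct (coeff (map ι f) degree) rootList x) (*-congʳ (coeff-ι f degree)))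

    f-factored : Factored ⟦ f ⟧
    f-factored = leading , rootList , leading≉0 , f≈

    f-squarefree : Squarefree ⟦ f ⟧
    f-squarefree r (q , q≈) eq = separable r q (eval-injective (map ι f) (X- r *ₚ (X- r *ₚ q)) λ x → trans (eq x) (sym
      (trans (eval-*ₚ (X- r) (X- r *ₚ q) x) (*-cong (eval-X- r x)
        (trans (eval-*ₚ (X- r) q x) (*-cong (eval-X- r x) (sym (q≈ x))))))))

    length-roots : length rootList ≡ degree
    length-roots = proj₁ (proj₂ splitting)

    size : ℕ
    size = suc g

    size+size : size ℕ.+ size ≡ suc (suc (2 ℕ.* g))
    size+size = ≡.cong suc (≡.trans (ℕ.+-suc g g) (≡.cong suc (≡.cong (g ℕ.+_) (≡.sym (ℕ.+-identityʳ g)))))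

    -- In odd degree ∞ is adjoined, so that in both cases there are 2g + 2 zeros.
    projective : Σ[ Ps ∈ List Point ] ProjectiveRoots rootList Ps × length Ps ≡ size ℕ.+ size
    projective with degree≡
    ... | inj₁ odd  = ∞ ∷ affine rootList , infinite , ≡.trans (≡.cong suc (≡.trans (List.length-map _ rootList)
      (≡.trans length-roots (≡.trans odd (ℕ.+-comm (2 ℕ.* g) 1))))) (≡.sym size+size)
    ... | inj₂ even = affine rootList , finite , ≡.trans (List.length-map _ rootList)
      (≡.trans length-roots (≡.trans even (≡.trans (ℕ.+-comm (2 ℕ.* g) 2) (≡.sym size+size))))

    points : List Point
    points = proj₁ projective

    points-projective : ProjectiveRoots rootList points
    points-projective = proj₁ (proj₂ projective)

    length-points : length points ≡ size ℕ.+ size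
    length-points = proj₂ (proj₂ projective)

    5≤degree : 2 ≤ g → 5 ≤ length rootList
    5≤degree 2≤g = ℕ.≤-trans (ℕ.+-monoˡ-≤ 1 (ℕ.*-monoʳ-≤ 2 2≤g))
      (ℕ.≤-trans (bound degree≡) (ℕ.≤-reflexive (≡.sym length-roots)))
      where
      bound : degree ≡ 2 ℕ.* g ℕ.+ 1 ⊎ degree ≡ 2 ℕ.* g ℕ.+ 2 → 2 ℕ.* g ℕ.+ 1 ≤ degree
      bound (inj₁ eq) = ℕ.≤-reflexive (≡.sym eq)
      bound (inj₂ eq) = ℕ.≤-trans (ℕ.+-monoʳ-≤ (2 ℕ.* g) (s≤s z≤n)) (ℕ.≤-reflexive (≡.sym eq))

    -- The exponent 4g + 2 is twice 2g + 1, which is one less than the number of zeros. This is the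
    -- normalisation in which the discriminant depends only on the binary form.
    discriminant≈ : discriminant ≈ (16 · 1#) ^ g * ((leading * leading) ^ suc (2 ℕ.* g) * discriminantOf points)
    discriminant≈ = trans (*-assoc _ _ _) (*-congˡ (*-cong
      (trans (reflexive (≡.cong (leading ^_) (exponent g)))
        (trans (^-homo-* leading (suc (2 ℕ.* g)) (suc (2 ℕ.* g)))
          (sym (^-distrib-* leading leading (suc (2 ℕ.* g))))))
      (sym (discriminant-projective points-projective))))
      where
      open +-*-Solver using () renaming (solve to ℕ-solve; _:+_ to _⊕_; _:*_ to _⊛_; con to κ; _:=_ to _⊜_)
      exponent : ∀ g → 4 ℕ.* g ℕ.+ 2 ≡ suc (2 ℕ.* g) ℕ.+ suc (2 ℕ.* g)
      exponent = ℕ-solve 1 (λ g → κ 4 ⊛ g ⊕ κ 2 ⊜ (κ 1 ⊕ κ 2 ⊛ g) ⊕ (κ 1 ⊕ κ 2 ⊛ g)) ≡.refl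

    integral-values : H.IsIntegral C → ∀ ξ → Integral ξ → Integral (form leading points (ξ , 1#))
    integral-values integral ξ iξ = ≤∞-trans (integral-eval (map ι f) (λ n → ≤∞-trans (integral n)
        (≤∞-reflexive (≡.trans (≡.sym (L.extends _)) (v-cong (sym (coeff-ι f n)))))) iξ)
      (≤∞-reflexive (v-cong (trans (f≈ ξ) (*-congˡ (sym (trans (detProduct-cong points (sym (*-identityʳ ξ) , refl))
        (trans (detProduct-projective points-projective ξ 1#)
          (trans (*-congʳ (1^ (length points))) (*-identityˡ _)))))))))
      where
      open IsValuation L.isValuation using (v-cong)
      1^ : ∀ n → 1# ^ n ≈ 1#
      1^ zero    = refl
      1^ (suc n) = trans (*-identityˡ _) (1^ n)

    -- A repeated root would be a double root of f. The function `q` collects the factors of the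
    -- roots already passed, so that the product under consideration remains all of f.
    roots-unique : ∀ rs {k q} → IsPoly q → Squarefree (λ x → k * (q x * rootProduct rs x)) → UniqueSetoid.Unique
      setoid rs
    roots-unique []       pq sf = []
    roots-unique (r ∷ rs) {k} {q} pq sf = distinct rs pq sf ∷ roots-unique rs {k} {λ x → q x * (x - r)}
      (pq *ᵖ linearᵖ r)
      λ s pt eq → sf s pt λ x → trans (solve 4 (λ k q y p → k :* (q :* (y :* p)) := k :* ((q :* y) :* p)) refl k
        (q x) (x - r) (rootProduct rs x)) (eq x)
      where
      distinct : ∀ rs {q} → IsPoly q → Squarefree (λ x → k * (q x * ((x - r) * rootProduct rs x))) → All
        (λ s → ¬ r ≈ s) rs
      distinct []       pq sf = []
      distinct (s ∷ rs) {q} pq sf =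
        (λ r≈s → sf r (constantᵖ k *ᵖ (pq *ᵖ rootProductᵖ rs)) λ x → trans
          (*-congˡ (*-congˡ (*-congˡ (*-congʳ (+-congˡ (-‿cong (sym r≈s)))))))
          (solve 4 (λ k q y p → k :* (q :* (y :* (y :* p))) := y :* (y :* (k :* (q :* p)))) refl k (q x) (x - r)
            (rootProduct rs x))) ∷
        distinct rs {λ x → q x * (x - s)} (pq *ᵖ linearᵖ s) λ t pt eq → sf t pt λ x → trans
          (solve 5 (λ k q y z p → k :* (q :* (y :* (z :* p))) := k :* ((q :* z) :* (y :* p))) refl k (q x) (x - r)
            (x - s) (rootProduct rs x)) (eq x)

    rootList-unique : UniqueSetoid.Unique setoid rootList
    rootList-unique = roots-unique rootList {leading} {λ _ → 1#} (constantᵖ 1#) λ r pq eq →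
      f-squarefree r pq λ x → trans (f≈ x) (trans (*-congˡ (sym (*-identityˡ _))) (eq x))

    root⇒∈ : ∀ {x} → ℛ x → Any (x ≈_) rootList
    root⇒∈ {x} fx≈0 = rootProduct≈0 rootList (*-nonzero leading≉0 (trans (sym (f≈ x)) fx≈0))

    ∈⇒root : ∀ {x} → Any (x ≈_) rootList → ℛ x
    ∈⇒root {x} x∈ = trans (f≈ x) (trans (*-congˡ (rootProduct-root x∈)) (zeroʳ leading))

  -- Residue classes of roots as clusters.

  module Clusters
    {g : ℕ} (C : H.HyperellipticCurve g) (depth : H.HasDepth (H.ℛ C) 0∞)
    (no-large-cluster : ¬ (∃₂ λ 𝔰 n → H.IsCluster C 𝔰 × ¬ (𝔰 ≐ H.ℛ C) × H.HasSize 𝔰 n × n ℕ.> g ℕ.+ 1)) where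
    open Curve C
    open IsValuation L.isValuation using (v-cong)

    module _ (r : Carrier) (r∈ : Any (r ≈_) rootList) where

      Near : Carrier → Set
      Near s = ¬ L.v̄ (det (r , 1#) (s , 1#)) ≡ 0∞

      near? : ∀ s → Dec (Near s)
      near? s = ¬? (L.v̄ (det (r , 1#) (s , 1#)) ≟∞ 0∞)

      v-det : ∀ s → L.v̄ (det (r , 1#) (s , 1#)) ≡ L.v̄ (s - r)
      v-det s = ≡.trans (v-cong (solve 2 (λ r s → r :* :1 :- :1 :* s := :- (s :- r)) refl r s)) (v-neg (s - r))

      nears : List Carrier
      nears = filter near? rootList

      near≡length : ∀ rs → near (r , 1#) (affine rs) ≡ length (filter near? rs)
      near≡length []       = ≡.refl
      near≡length (s ∷ rs) with L.v̄ (det (r , 1#) (s , 1#)) ≟∞ 0∞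
      ... | yes _ = near≡length rs
      ... | no  _ = ≡.cong suc (near≡length rs)

      near-resp : ∀ {s t} → s ≈ t → Near s → Near t
      near-resp {s} {t} s≈t ns eq = ns (≡.trans (v-cong (det-congʳ {r , 1#} (s≈t , refl))) eq)

      near-positive : ∀ {s} → ℛ s → Near s → 0∞ <⁺ L.v̄ (s - r)
      near-positive {s} s∈ℛ ns = ≤∞∧≢⇒<∞ (proj₂ depth s r s∈ℛ (∈⇒root r∈)) (ns ∘ ≡.trans (v-det s))

      -- Nearness is the strict condition v(s - r) > 0, whereas discs are given by v(s - r) ≥ d. For
      -- finitely many roots one positive d works for all; for the empty list 1 is an arbitrary
      -- choice.
      radius : ∀ ss → All (λ s → 0∞ <⁺ L.v̄ (s - r)) ss → ∃[ d ] 0ℚ ℚ.< d × All (λ s → [ d ] ≤⁺ L.v̄ (s - r)) ss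
      radius []       []           = ℚ.1ℚ , ℚ.positive⁻¹ ℚ.1ℚ , []
      radius (s ∷ ss) (0<s ∷ 0<ss) = pack (shrink (L.v̄ (s - r)) 0<s (radius ss 0<ss))
        where
        pack : ∃[ d ] 0ℚ ℚ.< d × [ d ] ≤⁺ L.v̄ (s - r) × All (λ s → [ d ] ≤⁺ L.v̄ (s - r)) ss →
          ∃[ d ] 0ℚ ℚ.< d × All (λ s → [ d ] ≤⁺ L.v̄ (s - r)) (s ∷ ss)
        pack (d , 0<d , h , hs) = d , 0<d , h ∷ hs

        shrink : ∀ a → 0∞ <⁺ a → ∃[ d ] 0ℚ ℚ.< d × All (λ s → [ d ] ≤⁺ L.v̄ (s - r)) ss →
          ∃[ d ] 0ℚ ℚ.< d × [ d ] ≤⁺ a × All (λ s → [ d ] ≤⁺ L.v̄ (s - r)) ss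
        shrink ⊤⁺    _              (d , 0<d , ≤ss) = d , 0<d , (_ ≤⊤⁺) , ≤ss
        shrink [ q ] Strict.[ 0<q ] (d , 0<d , ≤ss) with ℚ.≤-total d q
        ... | inj₁ d≤q = d , 0<d , NonStrict.[ d≤q ] , ≤ss
        ... | inj₂ q≤d = q , 0<q , NonStrict.[ ℚ.≤-refl ] , All.map (≤∞-trans NonStrict.[ q≤d ]) ≤ss

      private
        nears∈ : ∀ {x} → Any (x ≈_) nears → Any (x ≈_) rootList × Near x
        nears∈ = Membership.∈-filter⁻ setoid near? near-resp

        nears-positive : ∀ ss → (∀ {x} → Any (x ≈_) ss → 0∞ <⁺ L.v̄ (x - r)) → All (λ s → 0∞ <⁺ L.v̄ (s - r)) ss
        nears-positive []       h = []
        nears-positive (s ∷ ss) h = h (here refl) ∷ nears-positive ss (h ∘ there)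

      -- The roots near r are exactly those in the disc of this radius about r. They form a cluster
      -- other than the set of all roots, so there are at most g + 1 of them.
      near≤size : near (r , 1#) (affine rootList) ≤ suc g
      near≤size = ℕ.≤-trans (ℕ.≤-reflexive (near≡length rootList))
        (ℕ.≤-trans (ℕ.≮⇒≥ (small (radius nears positive))) (ℕ.≤-reflexive (ℕ.+-comm g 1)))
        where
        positive : All (λ s → 0∞ <⁺ L.v̄ (s - r)) nears
        positive = nears-positive nears λ x∈ → near-positive (∈⇒root (proj₁ (nears∈ x∈))) (proj₂ (nears∈ x∈))

        small : ∃[ d ] 0ℚ ℚ.< d × All (λ s → [ d ] ≤⁺ L.v̄ (s - r)) nears → ¬ length nears ℕ.> g ℕ.+ 1
        small (d , 0<d , ≤nears) large = no-large-cluster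
          (𝔰 , length nears , (( r , r∈𝔰) , r , d , (λ x∈ → x∈) , λ x∈ → x∈) , proper , has-size , large)
          where
          𝔰 : Carrier → Set ℓ′
          𝔰 x = [ d ] ≤⁺ L.v̄ (x - r) × ℛ x

          r∈𝔰 : 𝔰 r
          r∈𝔰 = ≤∞-trans (_ ≤⊤⁺) (≤∞-reflexive (≡.sym (v-0 (-‿inverseʳ r)))) , ∈⇒root r∈

          close : ∀ {x} → Any (x ≈_) nears → [ d ] ≤⁺ L.v̄ (x - r)
          close x∈ = look x∈ ≤nears
            where
            look : ∀ {x ss} → Any (x ≈_) ss → All (λ s → [ d ] ≤⁺ L.v̄ (s - r)) ss → [ d ] ≤⁺ L.v̄ (x - r)
            look (here x≈s) (h ∷ _)  = ≤∞-trans h (≤∞-reflexive (v-cong (+-congʳ (sym x≈s))))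
            look (there x∈) (_ ∷ hs) = look x∈ hs

          has-size : H.HasSize 𝔰 (length nears)
          has-size = nears , ≡.refl , Unique.filter⁺ setoid near? rootList-unique , λ x → mk⇔
            (λ (d≤ , x∈ℛ) → Membership.∈-filter⁺ setoid near? near-resp (root⇒∈ x∈ℛ)
              (<∞⇒≢ (<-≤∞-trans Strict.[ 0<d ] d≤) ∘ ≡.trans (≡.sym (v-det x))))
            (λ x∈ → close x∈ , ∈⇒root (proj₁ (nears∈ x∈)))

          -- The depth 0 is attained by some roots s and t. If both lay in the disc, v(s - t) would
          -- be at least d > 0.
          proper : ¬ (𝔰 ≐ ℛ)
          proper (_ , ℛ⊆𝔰) = separated (proj₁ depth)
            where
            separated : ¬ (∃₂ λ s t → ℛ s × ℛ t × L.v̄ (s - t) ≡ 0∞)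
            separated (s , t , s∈ℛ , t∈ℛ , eq) = <∞⇒≢
              (<-≤∞-trans Strict.[ 0<d ] (≤∞-trans (v-sub-≤ (proj₁ (ℛ⊆𝔰 s∈ℛ)) (proj₁ (ℛ⊆𝔰 t∈ℛ)))
              (≤∞-reflexive (v-cong (solve 3 (λ s t r → (s :- r) :- (t :- r) := s :- t) refl s t r))))) eq

    -- The determinant of ∞ with any (r , 1) is ±1, so adjoining ∞ enlarges no residue class of
    -- roots, and ∞ is near at most itself.
    near-projective : ∀ {Ps} → ProjectiveRoots rootList Ps → All (λ P → near P Ps ≤ suc g) Ps
    near-projective finite   = go rootList (λ r∈ → r∈)
      where
      go : ∀ rs → (∀ {r} → Any (r ≈_) rs → Any (r ≈_) rootList) → All (λ P → near P (affine rootList) ≤ suc g)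
        (affine rs)
      go []       sub = []
      go (r ∷ rs) sub = near≤size r (sub (here refl)) ∷ go rs (sub ∘ there)
    near-projective infinite = near-∞ ∷ go rootList (λ r∈ → r∈)
      where
      none : ∀ rs → near ∞ (affine rs) ≡ 0
      none []       = ≡.refl
      none (s ∷ rs) with L.v̄ (det ∞ (s , 1#)) ≟∞ 0∞
      ... | yes _ = none rs
      ... | no ¬u = contradiction (≡.trans (v-cong (solve 1 (λ s → (:- :1) :* :1 :- :0 :* s := :- :1) refl s)) v-‿1)
        ¬u

      near-∞ : near ∞ (∞ ∷ affine rootList) ≤ suc g
      near-∞ with L.v̄ (det ∞ ∞) ≟∞ 0∞
      ... | yes _ = ℕ.≤-trans (ℕ.≤-reflexive (none rootList)) z≤n
      ... | no  _ = s≤s (ℕ.≤-trans (ℕ.≤-reflexive (none rootList)) z≤n)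

      skip-∞ : ∀ r → near (r , 1#) (∞ ∷ affine rootList) ≡ near (r , 1#) (affine rootList)
      skip-∞ r with L.v̄ (det (r , 1#) ∞) ≟∞ 0∞
      ... | yes _ = ≡.refl
      ... | no ¬u = contradiction (≡.trans (v-cong (solve 1 (λ r → r :* :0 :- :1 :* (:- :1) := :1) refl r)) v-1) ¬u

      go : ∀ rs → (∀ {r} → Any (r ≈_) rs → Any (r ≈_) rootList) → All (λ P → near P (∞ ∷ affine rootList) ≤ suc g)
        (affine rs)
      go []       sub = []
      go (r ∷ rs) sub = ℕ.≤-trans (ℕ.≤-reflexive (skip-∞ r)) (near≤size r (sub (here refl))) ∷ go rs (sub ∘ there)

  -- If 2 = 0, then both discriminants vanish.
  16ᵍ≈0 : 2# ≈ 0# → ∀ {g} → 2 ≤ g → (16 · 1#) ^ g ≈ 0#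
  16ᵍ≈0 2≈0 {suc g} _ = trans (*-congʳ (trans (×1-homo-* 2 8)
    (trans (*-congʳ (trans (+-congˡ (+-identityʳ 1#)) 2≈0)) (zeroˡ _)))) (zeroˡ _)
    where open Multiples semiring using (×1-homo-*)

  module _
    {g : ℕ} (2≤g : 2 ≤ g) (C : H.HyperellipticCurve g) (integral : H.IsIntegral C)
    (depth : H.HasDepth (H.ℛ C) 0∞) (unit : K.v (H.c-f C) ≡ 0∞)
    (no-large-cluster : ¬ (∃₂ λ 𝔰 n → H.IsCluster C 𝔰 × ¬ (𝔰 ≐ H.ℛ C) × H.HasSize 𝔰 n × n ℕ.> g ℕ.+ 1)) where
    private
      module C = Curve C

    discriminant-minimal : ∀ E → H.IsIntegralWeierstrassEquation C E → L.v̄ (H.discriminant C) ≤⁺ L.v̄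
      (H.discriminant E)
    discriminant-minimal E (E-integral , iso) = go (v-decide 2# 0#)
      where
      module E = Curve E
      open IsValuation L.isValuation using (v-cong; v-*)

      split : ∀ {Δ x y} → Δ ≈ x * y → L.v̄ Δ ≡ L.v̄ x +∞ L.v̄ y
      split Δ≈ = ≡.trans (v-cong Δ≈) (v-* _ _)

      go : Dec (2# ≈ 0#) → L.v̄ (H.discriminant C) ≤⁺ L.v̄ (H.discriminant E)
      go (yes 2≈0) = ≤∞-trans (_ ≤⊤⁺) (≤∞-reflexive
        (≡.sym (v-0 (trans E.discriminant≈ (trans (*-congʳ (16ᵍ≈0 2≈0 2≤g)) (zeroˡ _))))))
      -- The power of 16 is common to both discriminants, so the comparison reduces to the
      -- discriminants of the binary forms.
      go (no 2≉0)  = ≤∞-trans (≤∞-reflexive (split C.discriminant≈)) (≤∞-trans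
          (+∞-mono (≤∞-refl {L.v̄ ((16 · 1#) ^ g)})
            (compare (forms-similar {Ps = C.points} {Qs = E.points} {k = suc g} (⟦⟧-poly C.f) C.f-squarefree
              C.leading≉0 C.f≈ E.f≈
            C.points-projective E.points-projective C.length-points E.length-points möbius)))
          (≤∞-reflexive (≡.sym (split E.discriminant≈))))
        where
        -- The isomorphism leads from the function field of E to that of C, so C provides f and E
        -- provides h.
        open HyperellipticMaps 2≉0 (⟦⟧-poly C.f) (⟦⟧-poly E.f) C.f-factored C.f-squarefree (C.5≤degree 2≤g)
          (correspondence iso) using (möbius)

        n = suc (2 ℕ.* g)

        compare : ∃[ M ] ∃[ e ] ¬ determinant M ≈ 0# × ¬ e ≈ 0# ×
          (∀ X → form (e * e * C.leading) C.points X ≈ form E.leading E.points (M ·² X)) →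
          L.v̄ ((C.leading * C.leading) ^ n * discriminantOf C.points) ≤⁺ L.v̄
            ((E.leading * E.leading) ^ n * discriminantOf E.points)
        compare (M , e , det≉0 , e≉0 , similar) = discriminant-bound (suc g) M similar C.length-points
          E.length-points e≉0
          (≡.trans (L.extends (H.c-f C)) unit) det≉0 (nonzero-projective C.points-projective)
          (Clusters.near-projective C depth no-large-cluster C.points-projective) (E.integral-values E-integral)
          n C.size+size E.leading≉0 (nonzero-projective E.points-projective)

    minimal : H.IsMinimalWeierstrassEquation C C
    minimal = (integral , identity C.f) , discriminant-minimal

open import Data.Nat using (_>_; _+_)
open import Relation.Binary.PropositionalEquality using (_≢_)

theorem17p1 : ∀ {c ℓ c′ ℓ′ : Level} (K : LocalField c ℓ) (K̄ : AlgebraicClosure K c′ ℓ′) →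
    let open Hyperelliptic K K̄ in
    LocalField.p K ≢ 2 →
    ∀ (g : ℕ) → 2 ≤ g →
    ∀ (C : HyperellipticCurve g) →
    IsIntegral C →
    HasDepth (ℛ C) 0∞ →
    LocalField.v K (c-f C) ≡ 0∞ →
    ¬ (∃₂ λ 𝔰 n → IsCluster C 𝔰 × ¬ (𝔰 ≐ ℛ C) × HasSize 𝔰 n × n > g + 1) →
    IsMinimalWeierstrassEquation C C
theorem17p1 K K̄ _ _ 2≤g C integral depth unit no-large-cluster =
  Minimality.minimal K K̄ 2≤g C integral depth unit no-large-cluster
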